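{- Let $p_{\xi}(n)$ be defined by $\sum_{n\ge 0} p_{\xi}(n)q^n=\xi(q)$. Then $$\sum_{n=0}^{\infty} p_{\xi}(3n)q^n = \frac{f_{2}f_{3}^4}{f_{1}^2f_{6}^2},\qquad \sum_{n=0}^{\infty} p_{\xi}(3n+1)q^n = 2\frac{f_{3}f_{6}}{f_{1}},\qquad \sum_{n=0}^{\infty} p_{\xi}(3n+2)q^n = \omega(q) + \frac{f_{6}^4}{f_2f_{3}^2}.$$
   Context: For $|q|<1$, $(a;q)_0=1$, $(a;q)_n=(1-a)(1-aq)\cdots(1-aq^{n-1})$, $(a;q)_\infty=\lim_{n\to\infty}(a;q)_n$, and $f_k:=(q^k;q^k)_\infty$. $\xi(q)=1+2\sum_{n\ge1}\frac{q^{6n^2-6n+1}}{(q;q^6)_n(q^5;q^6)_n}$ (a mock theta function of Gordon and McIntosh) and $p_\xi(n)$ is its $n$-th coefficient. $\omega(q)=\sum_{n\ge0}\frac{q^{2n(n+1)}}{(q;q^2)_{n+1}^2}$ is Ramanujan's third order mock theta function. -}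

module Defs where

open import Data.Nat using (ℕ; zero; suc; _∸_; _≡ᵇ_) renaming (_+_ to _+ℕ_; _*_ to _*ℕ_)
open import Data.Integer using (ℤ; _+_; _*_; -_; 0ℤ; 1ℤ; +_)
open import Data.Bool using (if_then_else_)

Series : Set
Series = ℕ → ℤ

Σ≤ : ℕ → (ℕ → ℤ) → ℤ
Σ≤ zero    f = f 0
Σ≤ (suc n) f = Σ≤ n f + f (suc n)

infixl 6 _⊕_ _⊖_
infixl 7 _⊛_

_⊕_ : Series → Series → Series
(a ⊕ b) n = a n + b n

_⊖_ : Series → Series → Series
(a ⊖ b) n = a n + - b n

_⊛_ : Series → Series → Series
(a ⊛ b) n = Σ≤ n (λ i → a i * b (n ∸ i))

scale : ℤ → Series → Series
scale c a n = c * a n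

mono : ℕ → Series
mono e n = if e ≡ᵇ n then 1ℤ else 0ℤ

one : Series
one = mono 0

_^ˢ_ : Series → ℕ → Series
a ^ˢ zero  = one
a ^ˢ suc k = a ⊛ (a ^ˢ k)

-- Multiplicative inverse of a series with constant term 1:
-- 1/a = Σ_{k≥0} (1 - a)^k ; since (1-a)^k has order ≥ k, the
-- coefficient of q^n only needs k ≤ n.
inv : Series → Series
inv a n = Σ≤ n (λ k → ((one ⊖ a) ^ˢ k) n)

prod< : ℕ → (ℕ → Series) → Series
prod< zero    g = one
prod< (suc n) g = prod< n g ⊛ g n

poch : ℕ → ℕ → ℕ → Series
poch a b n = prod< n (λ j → one ⊖ mono (a +ℕ b *ℕ j))

-- f_k = (q^k;q^k)_∞ = ∏_{m≥1} (1 - q^{km})   (k ≥ 1).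
-- The coefficient of q^n only depends on the factors with m ≤ n.
f : ℕ → Series
f k n = prod< n (λ j → one ⊖ mono (k *ℕ suc j)) n

-- ξ(q) = 1 + 2 Σ_{n≥1} q^{6n²-6n+1} / ((q;q^6)_n (q^5;q^6)_n).
-- Writing n = m+1, 6n²-6n+1 = 6m(m+1)+1 ≥ m+1, so for the coefficient
-- of q^N only m ≤ N matter.
ξTerm : ℕ → Series
ξTerm m = mono (6 *ℕ m *ℕ suc m +ℕ 1) ⊛ inv (poch 1 6 (suc m) ⊛ poch 5 6 (suc m))

ξ : Series
ξ = one ⊕ scale (+ 2) (λ N → Σ≤ N (λ m → ξTerm m N))

pξ : ℕ → ℤ
pξ = ξ

-- ω(q) = Σ_{n≥0} q^{2n(n+1)} / (q;q²)_{n+1}² ; 2n(n+1) ≥ n.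
ωTerm : ℕ → Series
ωTerm n = mono (2 *ℕ n *ℕ suc n) ⊛ inv (poch 1 2 (suc n) ^ˢ 2)

ω : Series
ω N = Σ≤ N (λ n → ωTerm n N)

{-# OPTIONS --safe #-}
-- Put g₃(x,Q) = Σ Q^{n²+n}/((x;Q)_{n+1}(y;Q)_{n+1}) with xy = Q, so that
-- ξ(q) = 1 + 2q g₃(q,q⁶) and ω(q) = g₃(q,q²). The partial fraction expansion of
-- 1/((x;Q)_{n+1}(y;Q)_{n+1}) yields, as n → ∞,
--   (Q;Q)²/((x;Q)(y;Q)) = Σ_{r≥0} (-1)^r Q^{r(r+1)/2} (1-Q^{2r+1})/((1-xQ^r)(1-yQ^r)),
-- and, summed over n with the Durfee rectangle identity,
--   (Q;Q) g₃(x,Q) = Σ_{r≥0} (-1)^r Q^{3r(r+1)/2} (1-Q^{2r+1})/((1-xQ^r)(1-yQ^r)).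
-- With x = y = q, Q = q² the first series equals ψ(q)², ψ(q) = f₂²/f₁. Splitting it
-- by r mod 3 produces the second series at (q,q⁶) and at (q³,q⁶) together with the
-- pentagonal number series of f₆, which gives
--   ψ(q)² = f₆ + 2q f₆ g₃(q,q⁶) - q² f₆ ω(q³),  i.e.  ξ(q) = q² ω(q³) + ψ(q)²/f₆.
-- Finally ψ(q) = f₆f₉²/(f₃f₁₈) + q f₁₈²/f₉ by the triple product identity, and
-- squaring separates the exponents modulo 3.
module Submission where

open import Defs
open import Algebra.Bundles using (CommutativeRing)
import Algebra.Solver.Ring
open import Algebra.Solver.Ring.AlmostCommutativeRing using (AlmostCommutativeRing; fromCommutativeRing; _-Raw-AlmostCommutative⟶_)
open import Algebra.Structures using (IsCommutativeRing)
open import Data.Integer using (ℤ; +_; 0ℤ; 1ℤ)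
import Data.Integer as ℤ
import Data.Integer.Properties as ℤₚ
import Data.Integer.Tactic.RingSolver as ℤSolver
open import Data.Maybe as Maybe using (Maybe)
open import Data.Nat using (ℕ; zero; suc; _∸_; _≤_; _<_; z≤n; s≤s; s≤s⁻¹; NonZero) renaming (_+_ to _+ℕ_; _*_ to _*ℕ_)
import Data.Nat.Properties as ℕₚ
open import Data.Nat.Tactic.RingSolver using (solve-∀)
open import Data.Product using (_×_; _,_; proj₁; proj₂)
open import Function using (_∘_)
open import Level using (0ℓ)
open import Relation.Binary using (Setoid)
open import Relation.Binary.PropositionalEquality as ≡ using (_≡_)
import Relation.Binary.Reasoning.Setoid as SetoidReasoning
open import Relation.Nullary.Decidable using (dec⇒maybe)

-- Everything is formal: convergence means agreement of coefficients below n (`≈[ n ]`), and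
-- infinite sums and products are truncated where the rest has order at least n. Laurent series are
-- avoided: Q/x is replaced by a second element y of positive order with xy = Q, and bilateral theta
-- series are folded into two unilateral ones. The identities hold for every base with zero constant
-- term, so a change of base is a choice of argument; only the stated quotients and ω have to be
-- carried from q to q³ by a substitution map. The splitting modulo 3 works because the Lambert
-- series for ψ² has exponents m(m+1) and denominators 1 - q^{2m+1}. For m = 3r, 3r+1, 3r+2 the
-- denominators are 1 - q^{6r+1}, 1 - q^{6r+3}, 1 - q^{6r+5}, those of g₃(q,q⁶) and g₃(q³,q⁶), and
-- the quadratic part 9r² of the exponent is that of Q^{3r(r+1)/2} at Q = q⁶. The cases m = 3r and m
-- = 3r+2 match only after the expansion 1/(1-u) = 1 + u/(1-u); the constants left over form the
-- pentagonal series.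

-- Wrapping series in a record without η and making the operations opaque
-- keeps unification from unfolding convolutions into coefficients.
record PS : Set where
  no-eta-equality
  constructor ser
  field coef : Series

open PS

infix 4 _≈_ _≈[_]_

record _≈_ (a b : PS) : Set where
  constructor pointwise
  field at : ∀ n → coef a n ≡ coef b n

record _≈[_]_ (a : PS) (n : ℕ) (b : PS) : Set where
  constructor below
  field at : ∀ k → k < n → coef a k ≡ coef b k

open _≈_
open _≈[_]_ renaming (at to at<)

-- Convolution of integer sequences

tail : Series → Series
tail a n = a (suc n)

Σ≤-head : ∀ n (g : Series) → Σ≤ (suc n) g ≡ g 0 ℤ.+ Σ≤ n (tail g)
Σ≤-head zero    g = ≡.refl
Σ≤-head (suc n) g = ≡.trans (≡.cong (ℤ._+ g (suc (suc n))) (Σ≤-head n g)) (ℤₚ.+-assoc (g 0) _ _)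

-- Splitting off the first coefficient of the left factor turns each law of the product into an
-- induction on the index, in place of a manipulation of double sums.
⊛-suc : ∀ (a b : Series) n → (a ⊛ b) (suc n) ≡ a 0 ℤ.* b (suc n) ℤ.+ (tail a ⊛ b) n
⊛-suc a b n = Σ≤-head n (λ i → a i ℤ.* b (suc n ∸ i))

⊛-cong : ∀ (a a′ b b′ : Series) n → (∀ k → k ≤ n → a k ≡ a′ k) → (∀ k → k ≤ n → b k ≡ b′ k) → (a ⊛ b) n ≡ (a′ ⊛ b′) n
⊛-cong a a′ b b′ zero p r = ≡.cong₂ ℤ._*_ (p 0 z≤n) (r 0 z≤n)
⊛-cong a a′ b b′ (suc n) p r =
  ≡.trans (⊛-suc a b n)
  (≡.trans (≡.cong₂ ℤ._+_ (≡.cong₂ ℤ._*_ (p 0 z≤n) (r (suc n) ℕₚ.≤-refl))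
                          (⊛-cong (tail a) (tail a′) b b′ n (λ k h → p (suc k) (s≤s h)) (λ k h → r k (ℕₚ.m≤n⇒m≤1+n h))))
  (≡.sym (⊛-suc a′ b′ n)))

⊛-distribʳ : ∀ (a b c : Series) n → ((b ⊕ c) ⊛ a) n ≡ (b ⊛ a) n ℤ.+ (c ⊛ a) n
⊛-distribʳ a b c zero = ℤₚ.*-distribʳ-+ (a 0) (b 0) (c 0)
⊛-distribʳ a b c (suc n) rewrite ⊛-suc (b ⊕ c) a n | ⊛-suc b a n | ⊛-suc c a n | ⊛-distribʳ a (tail b) (tail c) n =
  shuffle (b 0) (c 0) (a (suc n)) _ _
  where
  shuffle : ∀ u v w s t → (u ℤ.+ v) ℤ.* w ℤ.+ (s ℤ.+ t) ≡ (u ℤ.* w ℤ.+ s) ℤ.+ (v ℤ.* w ℤ.+ t)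
  shuffle = ℤSolver.solve-∀

⊛-scale : ∀ c (a b : Series) n → (scale c a ⊛ b) n ≡ c ℤ.* (a ⊛ b) n
⊛-scale c a b zero = ℤₚ.*-assoc c (a 0) (b 0)
⊛-scale c a b (suc n) rewrite ⊛-suc (scale c a) b n | ⊛-suc a b n | ⊛-scale c (tail a) b n =
  shuffle c (a 0) (b (suc n)) _
  where
  shuffle : ∀ u v w s → u ℤ.* v ℤ.* w ℤ.+ u ℤ.* s ≡ u ℤ.* (v ℤ.* w ℤ.+ s)
  shuffle = ℤSolver.solve-∀

⊛-assoc : ∀ (a b c : Series) n → ((a ⊛ b) ⊛ c) n ≡ (a ⊛ (b ⊛ c)) n
⊛-assoc a b c zero = ℤₚ.*-assoc (a 0) (b 0) (c 0)
⊛-assoc a b c (suc n) rewrite ⊛-suc (a ⊛ b) c n | ⊛-suc a (b ⊛ c) n | ⊛-suc b c n =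
  ≡.trans (≡.cong (λ t → a 0 ℤ.* b 0 ℤ.* c (suc n) ℤ.+ t)
    (≡.trans (⊛-cong (tail (a ⊛ b)) (scale (a 0) (tail b) ⊕ (tail a ⊛ b)) c c n (λ k _ → ⊛-suc a b k) (λ _ _ → ≡.refl))
    (≡.trans (⊛-distribʳ c (scale (a 0) (tail b)) (tail a ⊛ b) n)
             (≡.cong₂ ℤ._+_ (⊛-scale (a 0) (tail b) c n) (⊛-assoc (tail a) b c n)))))
    (shuffle (a 0) (b 0) (c (suc n)) _ _)
  where
  shuffle : ∀ u v w s t → u ℤ.* v ℤ.* w ℤ.+ (u ℤ.* s ℤ.+ t) ≡ u ℤ.* (v ℤ.* w ℤ.+ s) ℤ.+ t
  shuffle = ℤSolver.solve-∀

⊛-last : ∀ (a b : Series) n → (a ⊛ b) (suc n) ≡ (a ⊛ tail b) n ℤ.+ a (suc n) ℤ.* b 0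
⊛-last a b zero = ≡.refl
⊛-last a b (suc n) rewrite ⊛-suc a b (suc n) | ⊛-suc a (tail b) n | ⊛-last (tail a) b n =
  ≡.sym (ℤₚ.+-assoc (a 0 ℤ.* b (suc (suc n))) _ _)

⊛-comm : ∀ (a b : Series) n → (a ⊛ b) n ≡ (b ⊛ a) n
⊛-comm a b zero = ℤₚ.*-comm (a 0) (b 0)
⊛-comm a b (suc n) rewrite ⊛-suc a b n | ⊛-last b a n | ⊛-comm (tail a) b n | ℤₚ.*-comm (a 0) (b (suc n)) =
  ℤₚ.+-comm _ ((b ⊛ tail a) n)

constant : ℤ → Series
constant c zero    = c
constant c (suc n) = 0ℤ

⊛-zeroˡ : ∀ (b : Series) n → ((λ _ → 0ℤ) ⊛ b) n ≡ 0ℤ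
⊛-zeroˡ b zero = ℤₚ.*-zeroˡ (b 0)
⊛-zeroˡ b (suc n) rewrite ⊛-suc (λ _ → 0ℤ) b n | ⊛-zeroˡ b n = ≡.trans (ℤₚ.+-identityʳ _) (ℤₚ.*-zeroˡ (b (suc n)))

⊛-constant : ∀ c (b : Series) n → (constant c ⊛ b) n ≡ c ℤ.* b n
⊛-constant c b zero = ≡.refl
⊛-constant c b (suc n) rewrite ⊛-suc (constant c) b n | ⊛-zeroˡ b n = ℤₚ.+-identityʳ _

⊛-order : ∀ i j (a b : Series) → (∀ k → k < i → a k ≡ 0ℤ) → (∀ k → k < j → b k ≡ 0ℤ) → ∀ k → k < i +ℕ j → (a ⊛ b) k ≡ 0ℤ
⊛-order zero    j a b p r zero    h rewrite r 0 h = ℤₚ.*-zeroʳ (a 0)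
⊛-order zero    j a b p r (suc k) h rewrite ⊛-suc a b k | r (suc k) h | ⊛-order zero j (tail a) b (λ _ ()) r k (ℕₚ.<-trans (ℕₚ.n<1+n k) h) =
  ≡.trans (ℤₚ.+-identityʳ _) (ℤₚ.*-zeroʳ (a 0))
⊛-order (suc i) j a b p r zero    h rewrite p 0 (s≤s z≤n) = ℤₚ.*-zeroˡ (b 0)
⊛-order (suc i) j a b p r (suc k) h rewrite ⊛-suc a b k | p 0 (s≤s z≤n) | ⊛-order i j (tail a) b (λ l g → p (suc l) (s≤s g)) r k (s≤s⁻¹ h) =
  ≡.trans (ℤₚ.+-identityʳ _) (ℤₚ.*-zeroˡ (b (suc k)))

-- The commutative ring of power series

infixl 6 _+_
infixl 7 _*_
infix  8 -_

opaque
  _+_ _*_ : PS → PS → PS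
  a + b = ser (coef a ⊕ coef b)
  a * b = ser (coef a ⊛ coef b)

  -_ : PS → PS
  - a = ser (λ n → ℤ.- coef a n)

  const : ℤ → PS
  const c = ser (constant c)

  q : PS
  q = ser (mono 1)

0# 1# : PS
0# = const 0ℤ
1# = const 1ℤ

opaque
  unfolding _+_

  0#-coef : ∀ k → coef 0# k ≡ 0ℤ
  0#-coef zero    = ≡.refl
  0#-coef (suc k) = ≡.refl

  coef-+ : ∀ a b n → coef (a + b) n ≡ coef a n ℤ.+ coef b n
  coef-+ a b n = ≡.refl

  coef-const* : ∀ c b n → coef (const c * b) n ≡ c ℤ.* coef b n
  coef-const* c b n = ⊛-constant c (coef b) n

  coef-q*-zero : ∀ a → coef (q * a) 0 ≡ 0ℤ
  coef-q*-zero a = ≡.refl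

  coef-q*-suc : ∀ a n → coef (q * a) (suc n) ≡ coef a n
  coef-q*-suc a n =
    ≡.trans (⊛-suc (mono 1) (coef a) n)
    (≡.trans (ℤₚ.+-identityˡ _)
    (≡.trans (⊛-cong (tail (mono 1)) (constant 1ℤ) (coef a) (coef a) n (λ { zero _ → ≡.refl ; (suc k) _ → ≡.refl }) (λ _ _ → ≡.refl))
    (≡.trans (⊛-constant 1ℤ (coef a) n) (ℤₚ.*-identityˡ _))))

  isCommutativeRing : IsCommutativeRing _≈_ _+_ _*_ -_ 0# 1#
  isCommutativeRing = record
    { isRing = record
      { +-isAbelianGroup = record
        { isGroup = record
          { isMonoid = record
            { isSemigroup = record
              { isMagma = record
                { isEquivalence = record
                  { refl  = pointwise λ _ → ≡.refl
                  ; sym   = λ e → pointwise λ n → ≡.sym (at e n)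
                  ; trans = λ e f → pointwise λ n → ≡.trans (at e n) (at f n)
                  }
                ; ∙-cong = λ e f → pointwise λ n → ≡.cong₂ ℤ._+_ (at e n) (at f n)
                }
              ; assoc = λ a b c → pointwise λ n → ℤₚ.+-assoc (coef a n) (coef b n) (coef c n)
              }
            ; identity = (λ a → pointwise λ { zero → ℤₚ.+-identityˡ _ ; (suc n) → ℤₚ.+-identityˡ _ })
                       , (λ a → pointwise λ { zero → ℤₚ.+-identityʳ _ ; (suc n) → ℤₚ.+-identityʳ _ })
            }
          ; inverse = (λ a → pointwise λ { zero → ℤₚ.+-inverseˡ (coef a 0) ; (suc n) → ℤₚ.+-inverseˡ (coef a (suc n)) })
                    , (λ a → pointwise λ { zero → ℤₚ.+-inverseʳ (coef a 0) ; (suc n) → ℤₚ.+-inverseʳ (coef a (suc n)) })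
          ; ⁻¹-cong = λ e → pointwise λ n → ≡.cong ℤ.-_ (at e n)
          }
        ; comm = λ a b → pointwise λ n → ℤₚ.+-comm (coef a n) (coef b n)
        }
      ; *-cong = λ {a} {b} {c} {d} e f → pointwise λ n → ⊛-cong (coef a) (coef b) (coef c) (coef d) n (λ k _ → at e k) (λ k _ → at f k)
      ; *-assoc = λ a b c → pointwise λ n → ⊛-assoc (coef a) (coef b) (coef c) n
      ; *-identity = (λ a → pointwise λ n → ≡.trans (⊛-constant 1ℤ (coef a) n) (ℤₚ.*-identityˡ _))
                   , (λ a → pointwise λ n → ≡.trans (⊛-comm (coef a) (constant 1ℤ) n) (≡.trans (⊛-constant 1ℤ (coef a) n) (ℤₚ.*-identityˡ _)))
      ; distrib = (λ a b c → pointwise λ n →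
                    ≡.trans (⊛-comm (coef a) (coef b ⊕ coef c) n)
                    (≡.trans (⊛-distribʳ (coef a) (coef b) (coef c) n)
                    (≡.cong₂ ℤ._+_ (⊛-comm (coef b) (coef a) n) (⊛-comm (coef c) (coef a) n))))
                , (λ a b c → pointwise λ n → ⊛-distribʳ (coef a) (coef b) (coef c) n)
      }
    ; *-comm = λ a b → pointwise λ n → ⊛-comm (coef a) (coef b) n
    }

  q≈[1]0 : q ≈[ 1 ] 0#
  q≈[1]0 = below λ { zero _ → ≡.refl ; (suc k) (s≤s ()) }

  +-cong[] : ∀ {n a b c d} → a ≈[ n ] b → c ≈[ n ] d → a + c ≈[ n ] b + d
  +-cong[] e f = below λ k h → ≡.cong₂ ℤ._+_ (at< e k h) (at< f k h)

  *-cong[] : ∀ {n a b c d} → a ≈[ n ] b → c ≈[ n ] d → a * c ≈[ n ] b * d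
  *-cong[] {_} {a} {b} {c} {d} e f = below λ k h → ⊛-cong (coef a) (coef b) (coef c) (coef d) k
    (λ l g → at< e l (ℕₚ.≤-<-trans g h)) (λ l g → at< f l (ℕₚ.≤-<-trans g h))

  -‿cong[] : ∀ {n a b} → a ≈[ n ] b → - a ≈[ n ] - b
  -‿cong[] e = below λ k h → ≡.cong ℤ.-_ (at< e k h)

  *-order : ∀ {i j a b} → a ≈[ i ] 0# → b ≈[ j ] 0# → a * b ≈[ i +ℕ j ] 0#
  *-order {i} {j} {a} {b} e f = below λ k h → ≡.trans
    (⊛-order i j (coef a) (coef b) (λ l g → ≡.trans (at< e l g) (0#-coef l)) (λ l g → ≡.trans (at< f l g) (0#-coef l)) k h)
    (≡.sym (0#-coef k))

  const-+ : ∀ c d → const (c ℤ.+ d) ≈ const c + const d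
  const-+ c d = pointwise λ { zero → ≡.refl ; (suc n) → ≡.refl }

  const-* : ∀ c d → const (c ℤ.* d) ≈ const c * const d
  const-* c d = pointwise λ { zero → ≡.refl ; (suc n) → ≡.sym (≡.trans (⊛-constant c (constant d) (suc n)) (ℤₚ.*-zeroʳ c)) }

  const-‿ : ∀ c → const (ℤ.- c) ≈ - const c
  const-‿ c = pointwise λ { zero → ≡.refl ; (suc n) → ≡.refl }

PS-commutativeRing : CommutativeRing 0ℓ 0ℓ
PS-commutativeRing = record { isCommutativeRing = isCommutativeRing }

module Ring = CommutativeRing PS-commutativeRing
open Ring using (refl; sym; trans; setoid; semiring; +-cong; +-congˡ; +-congʳ; *-cong; *-congˡ; *-congʳ; -‿cong;
  +-assoc; +-comm; +-identityˡ; +-identityʳ; -‿inverseʳ; *-assoc; *-comm; *-identityˡ; *-identityʳ; zeroˡ; zeroʳ; distribˡ)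
open import Algebra.Properties.CommutativeSemiring.Exp Ring.commutativeSemiring using (^-distrib-*)
open import Algebra.Properties.Semiring.Exp semiring using (_^_; ^-congˡ; ^-congʳ; ^-homo-*; ^-assocʳ)

infixl 6 _-_
_-_ : PS → PS → PS
a - b = a + - b

PS-almostCommutativeRing : AlmostCommutativeRing 0ℓ 0ℓ
PS-almostCommutativeRing = fromCommutativeRing PS-commutativeRing

const-morphism : ℤ.+-*-rawRing -Raw-AlmostCommutative⟶ PS-almostCommutativeRing
const-morphism = record { ⟦_⟧ = const ; +-homo = const-+ ; *-homo = const-* ; -‿homo = const-‿ ; 0-homo = refl ; 1-homo = refl }

const≟ : ∀ c d → Maybe (const c ≈ const d)
const≟ c d = Maybe.map (λ { ≡.refl → refl }) (dec⇒maybe (c ℤ.≟ d))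

module Solver = Algebra.Solver.Ring ℤ.+-*-rawRing PS-almostCommutativeRing const-morphism const≟
open Solver using (solve; _:=_; _:+_; _:*_; _:-_; :-_; _:^_; con)

-- Congruence modulo powers of q

modulo : ℕ → Setoid _ _
modulo n = record
  { Carrier = PS ; _≈_ = _≈[ n ]_
  ; isEquivalence = record
    { refl  = below λ _ _ → ≡.refl
    ; sym   = λ e → below λ k h → ≡.sym (at< e k h)
    ; trans = λ e f → below λ k h → ≡.trans (at< e k h) (at< f k h)
    }
  }

module Mod {n} = Setoid (modulo n)
module ≈-Reasoning = SetoidReasoning setoid
module ≈[]-Reasoning n = SetoidReasoning (modulo n)

≈⇒≈[] : ∀ {n a b} → a ≈ b → a ≈[ n ] b
≈⇒≈[] e = below λ k _ → at e k

≈[]⇒≈ : ∀ {a b} → (∀ n → a ≈[ n ] b) → a ≈ b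
≈[]⇒≈ e = pointwise λ n → at< (e (suc n)) n ℕₚ.≤-refl

weaken : ∀ {m n a b} → m ≤ n → a ≈[ n ] b → a ≈[ m ] b
weaken m≤n e = below λ k h → at< e k (ℕₚ.≤-trans h m≤n)

≈[0] : ∀ {a b} → a ≈[ 0 ] b
≈[0] = below λ _ ()

+-order : ∀ {n a b} → a ≈[ n ] 0# → b ≈[ n ] 0# → a + b ≈[ n ] 0#
+-order e f = Mod.trans (+-cong[] e f) (≈⇒≈[] (+-identityˡ 0#))

-‿order : ∀ {n a} → a ≈[ n ] 0# → - a ≈[ n ] 0#
-‿order e = Mod.trans (-‿cong[] e) (≈⇒≈[] (solve 0 (:- con 0ℤ := con 0ℤ) refl))

*-orderˡ : ∀ {n a} b → a ≈[ n ] 0# → a * b ≈[ n ] 0#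
*-orderˡ b e = Mod.trans (*-cong[] e Mod.refl) (≈⇒≈[] (zeroˡ b))

*-orderʳ : ∀ {n b} a → b ≈[ n ] 0# → a * b ≈[ n ] 0#
*-orderʳ a e = Mod.trans (*-cong[] Mod.refl e) (≈⇒≈[] (zeroʳ a))

^-order : ∀ {a} → a ≈[ 1 ] 0# → ∀ n → a ^ n ≈[ n ] 0#
^-order a∈m zero    = ≈[0]
^-order a∈m (suc n) = *-order a∈m (^-order a∈m n)

^-order-≥ : ∀ {a m n} → a ≈[ 1 ] 0# → m ≤ n → a ^ n ≈[ m ] 0#
^-order-≥ {n = n} a∈m m≤n = weaken m≤n (^-order a∈m n)

^-order-suc : ∀ {a} n → a ≈[ 1 ] 0# → a ^ suc n ≈[ 1 ] 0#
^-order-suc n a∈m = *-orderˡ _ a∈m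

-- A factor of order i moves the other one up by i places, so agreement below n - i is enough. This
-- gain of precision drives both the limit of the partial fractions and the multiplicativity of
-- `inflate`.
*-cong[]-order : ∀ {n i a b c} → a ≈[ i ] 0# → b ≈[ n ∸ i ] c → a * b ≈[ n ] a * c
*-cong[]-order {n} {i} {a} {b} {c} e f = begin
  a * b                  ≈⟨ ≈⇒≈[] (solve 3 (λ a b c → a :* b := a :* (b :- c) :+ a :* c) refl a b c) ⟩
  a * (b - c) + a * c    ≈⟨ +-cong[] (weaken (ℕₚ.m≤n+m∸n n i) (*-order e b-c)) Mod.refl ⟩
  0# + a * c             ≈⟨ ≈⇒≈[] (+-identityˡ _) ⟩
  a * c                  ∎
  where
  open ≈[]-Reasoning n
  b-c : b - c ≈[ n ∸ i ] 0#
  b-c = Mod.trans (+-cong[] f Mod.refl) (≈⇒≈[] (-‿inverseʳ c))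

≈⇒-≈0 : ∀ {a b} → a ≈ b → a - b ≈ 0#
≈⇒-≈0 {b = b} e = trans (+-congʳ e) (-‿inverseʳ b)

-≈0⇒≈ : ∀ {a b} → a - b ≈ 0# → a ≈ b
-≈0⇒≈ {a} {b} e = begin
  a          ≈⟨ solve 2 (λ a b → a := a :- b :+ b) refl a b ⟩
  a - b + b  ≈⟨ +-congʳ e ⟩
  0# + b     ≈⟨ +-identityˡ b ⟩
  b          ∎
  where open ≈-Reasoning

-- Finite sums

Σ< : ℕ → (ℕ → PS) → PS
Σ< zero    t = 0#
Σ< (suc n) t = Σ< n t + t n

Σ<-cong : ∀ {t u} n → (∀ i → t i ≈ u i) → Σ< n t ≈ Σ< n u
Σ<-cong zero    e = refl
Σ<-cong (suc n) e = +-cong (Σ<-cong n e) (e n)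

Σ<-cong[] : ∀ {t u m} n → (∀ i → t i ≈[ m ] u i) → Σ< n t ≈[ m ] Σ< n u
Σ<-cong[] zero    e = Mod.refl
Σ<-cong[] (suc n) e = +-cong[] (Σ<-cong[] n e) (e n)

Σ<-+ : ∀ t u n → Σ< n (λ i → t i + u i) ≈ Σ< n t + Σ< n u
Σ<-+ t u zero    = sym (+-identityˡ 0#)
Σ<-+ t u (suc n) = trans (+-congʳ (Σ<-+ t u n))
  (solve 4 (λ a b c d → a :+ b :+ (c :+ d) := a :+ c :+ (b :+ d)) refl (Σ< n t) (Σ< n u) (t n) (u n))

Σ<-* : ∀ c t n → c * Σ< n t ≈ Σ< n (λ i → c * t i)
Σ<-* c t zero    = zeroʳ c
Σ<-* c t (suc n) = trans (distribˡ c _ _) (+-congʳ (Σ<-* c t n))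

Σ<-0 : ∀ n → Σ< n (λ _ → 0#) ≈ 0#
Σ<-0 zero    = refl
Σ<-0 (suc n) = trans (+-identityʳ _) (Σ<-0 n)

Σ<-zeros : ∀ {t} n → (∀ i → i < n → t i ≈ 0#) → Σ< n t ≈ 0#
Σ<-zeros zero    e = refl
Σ<-zeros (suc n) e = trans (+-cong (Σ<-zeros n (λ i h → e i (ℕₚ.m≤n⇒m≤1+n h))) (e n ℕₚ.≤-refl)) (+-identityʳ 0#)

Σ<-append : ∀ t m n → Σ< (m +ℕ n) t ≈ Σ< m t + Σ< n (λ i → t (m +ℕ i))
Σ<-append t m zero rewrite ℕₚ.+-identityʳ m = sym (+-identityʳ _)
Σ<-append t m (suc n) rewrite ℕₚ.+-suc m n = trans (+-congʳ (Σ<-append t m n)) (+-assoc _ _ _)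

Σ<-swap : ∀ (g : ℕ → ℕ → PS) m n → Σ< m (λ i → Σ< n (g i)) ≈ Σ< n (λ j → Σ< m (λ i → g i j))
Σ<-swap g zero    n = sym (Σ<-0 n)
Σ<-swap g (suc m) n = trans (+-congʳ (Σ<-swap g m n)) (sym (Σ<-+ (λ j → Σ< m (λ i → g i j)) (g m) n))

Σ<-blocks : ∀ t k n → Σ< (n *ℕ k) t ≈ Σ< n (λ r → Σ< k (λ i → t (r *ℕ k +ℕ i)))
Σ<-blocks t k zero    = refl
Σ<-blocks t k (suc n) rewrite ℕₚ.+-comm k (n *ℕ k) = trans (Σ<-append t (n *ℕ k) k) (+-congʳ (Σ<-blocks t k n))

-- Infinite sums

-- The rate is tied to the truncation inside `Σ∞`: when term i vanishes below i, coefficient n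
-- receives nothing from the terms beyond n, so the truncated sum is the true one.
Summable : (ℕ → PS) → Set
Summable t = ∀ i → t i ≈[ i ] 0#

Σ∞ : (ℕ → PS) → PS
Σ∞ t = ser (λ n → Σ≤ n (λ i → coef (t i) n))

Σ≤-cong : ∀ {g h : Series} n → (∀ i → g i ≡ h i) → Σ≤ n g ≡ Σ≤ n h
Σ≤-cong zero    e = e 0
Σ≤-cong (suc n) e = ≡.cong₂ ℤ._+_ (Σ≤-cong n e) (e (suc n))

coef-Σ< : ∀ t n k → coef (Σ< (suc n) t) k ≡ Σ≤ n (λ i → coef (t i) k)
coef-Σ< t zero    k = at (+-identityˡ (t 0)) k
coef-Σ< t (suc n) k = ≡.trans (coef-+ _ (t (suc n)) k) (≡.cong (ℤ._+ coef (t (suc n)) k) (coef-Σ< t n k))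

Σ<-stable : ∀ {t} → Summable t → ∀ {m n} → m ≤ n → Σ< n t ≈[ m ] Σ< m t
Σ<-stable {t} s {m} {n} m≤n = ≡.subst (λ l → Σ< l t ≈[ m ] Σ< m t) (ℕₚ.m+[n∸m]≡n m≤n) (go (n ∸ m))
  where
  go : ∀ d → Σ< (m +ℕ d) t ≈[ m ] Σ< m t
  go zero    rewrite ℕₚ.+-identityʳ m = Mod.refl
  go (suc d) rewrite ℕₚ.+-suc m d = Mod.trans (+-cong[] (go d) (weaken (ℕₚ.m≤m+n m d) (s (m +ℕ d)))) (≈⇒≈[] (+-identityʳ _))

Σ∞≈[]Σ< : ∀ {t} → Summable t → ∀ n → Σ∞ t ≈[ n ] Σ< n t
Σ∞≈[]Σ< {t} s n = below λ k h → ≡.trans (≡.sym (coef-Σ< t k k)) (≡.sym (at< (Σ<-stable s h) k ℕₚ.≤-refl))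

summable-suc : ∀ {t} → Summable t → Summable (t ∘ suc)
summable-suc s i = weaken (ℕₚ.n≤1+n i) (s (suc i))

summable-+ : ∀ {t u} → Summable t → Summable u → Summable (λ i → t i + u i)
summable-+ s r i = +-order (s i) (r i)

summable-* : ∀ {t} c → Summable t → Summable (λ i → c * t i)
summable-* c s i = *-orderʳ c (s i)

Σ∞-cong : ∀ {t u} → (∀ i → t i ≈ u i) → Σ∞ t ≈ Σ∞ u
Σ∞-cong e = pointwise λ n → Σ≤-cong n (λ i → at (e i) n)

Σ∞-order : ∀ {t n} → Summable t → (∀ i → t i ≈[ n ] 0#) → Σ∞ t ≈[ n ] 0#
Σ∞-order {n = n} s e = Mod.trans (Σ∞≈[]Σ< s n) (Mod.trans (Σ<-cong[] n e) (≈⇒≈[] (Σ<-0 n)))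

Σ∞-+ : ∀ {t u} → Summable t → Summable u → Σ∞ (λ i → t i + u i) ≈ Σ∞ t + Σ∞ u
Σ∞-+ {t} {u} s r = ≈[]⇒≈ λ n → let open ≈[]-Reasoning n in begin
  Σ∞ (λ i → t i + u i)    ≈⟨ Σ∞≈[]Σ< (summable-+ s r) n ⟩
  Σ< n (λ i → t i + u i)  ≈⟨ ≈⇒≈[] (Σ<-+ t u n) ⟩
  Σ< n t + Σ< n u         ≈⟨ +-cong[] (Σ∞≈[]Σ< s n) (Σ∞≈[]Σ< r n) ⟨
  Σ∞ t + Σ∞ u             ∎

Σ∞-* : ∀ {t} c → Summable t → c * Σ∞ t ≈ Σ∞ (λ i → c * t i)
Σ∞-* {t} c s = ≈[]⇒≈ λ n → let open ≈[]-Reasoning n in begin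
  c * Σ∞ t              ≈⟨ *-cong[] Mod.refl (Σ∞≈[]Σ< s n) ⟩
  c * Σ< n t            ≈⟨ ≈⇒≈[] (Σ<-* c t n) ⟩
  Σ< n (λ i → c * t i)  ≈⟨ Σ∞≈[]Σ< (summable-* c s) n ⟨
  Σ∞ (λ i → c * t i)    ∎

Σ∞-‿- : ∀ {t u} → Summable t → Summable u → Σ∞ (λ i → t i - u i) ≈ Σ∞ t - Σ∞ u
Σ∞-‿- {t} {u} s r = begin
  Σ∞ (λ i → t i - u i)             ≈⟨ Σ∞-cong (λ i → +-congˡ (neg (u i))) ⟩
  Σ∞ (λ i → t i + (- 1#) * u i)    ≈⟨ Σ∞-+ s (summable-* (- 1#) r) ⟩
  Σ∞ t + Σ∞ (λ i → (- 1#) * u i)   ≈⟨ +-congˡ (Σ∞-* (- 1#) r) ⟨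
  Σ∞ t + (- 1#) * Σ∞ u             ≈⟨ +-congˡ (neg (Σ∞ u)) ⟨
  Σ∞ t - Σ∞ u                      ∎
  where
  open ≈-Reasoning
  neg : ∀ a → - a ≈ (- 1#) * a
  neg = solve 1 (λ a → :- a := :- con 1ℤ :* a) refl

summable-+ℕ : ∀ {t} m → Summable t → Summable (λ i → t (m +ℕ i))
summable-+ℕ m s i = weaken (ℕₚ.m≤n+m i m) (s (m +ℕ i))

Σ∞-append : ∀ {t} → Summable t → ∀ m → Σ∞ t ≈ Σ< m t + Σ∞ (λ i → t (m +ℕ i))
Σ∞-append {t} s m = ≈[]⇒≈ λ n → let open ≈[]-Reasoning n in begin
  Σ∞ t                                ≈⟨ weaken (ℕₚ.m≤n+m n m) (Σ∞≈[]Σ< s (m +ℕ n)) ⟩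
  Σ< (m +ℕ n) t                       ≈⟨ ≈⇒≈[] (Σ<-append t m n) ⟩
  Σ< m t + Σ< n (λ i → t (m +ℕ i))    ≈⟨ +-cong[] Mod.refl (Σ∞≈[]Σ< (summable-+ℕ m s) n) ⟨
  Σ< m t + Σ∞ (λ i → t (m +ℕ i))      ∎

Σ∞-head : ∀ {t} → Summable t → Σ∞ t ≈ t 0 + Σ∞ (t ∘ suc)
Σ∞-head s = trans (Σ∞-append s 1) (+-congʳ (+-identityˡ _))

Σ∞-drop : ∀ {t} → Summable t → ∀ m → (∀ i → i < m → t i ≈ 0#) → Σ∞ t ≈ Σ∞ (λ i → t (m +ℕ i))
Σ∞-drop {t} s m e = trans (Σ∞-append s m) (trans (+-congʳ (Σ<-zeros m e)) (+-identityˡ _))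

Σ∞-finite : ∀ {t} → Summable t → ∀ m → (∀ i → t (m +ℕ i) ≈ 0#) → Σ∞ t ≈ Σ< m t
Σ∞-finite {t} s m e = trans (Σ∞-append s m)
  (trans (+-congˡ (≈[]⇒≈ λ n → Σ∞-order (summable-+ℕ m s) (λ i → ≈⇒≈[] (e i)))) (+-identityʳ _))

-- With a bound in each index separately, the terms outside the square i, j < n do not contribute
-- below n, and both orders of summation truncate to that square.
Summable₂ : (ℕ → ℕ → PS) → Set
Summable₂ g = (∀ i j → g i j ≈[ i ] 0#) × (∀ i j → g i j ≈[ j ] 0#)

summable-rows : ∀ {g} → Summable₂ g → Summable (λ i → Σ∞ (g i))
summable-rows (s , r) i = Σ∞-order (r i) (s i)

transpose : ∀ {g} → Summable₂ g → Summable₂ (λ j i → g i j)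
transpose (s , r) = (λ j i → r i j) , (λ j i → s i j)

Σ∞Σ∞≈[]Σ<Σ< : ∀ {g} → Summable₂ g → ∀ n → Σ∞ (λ i → Σ∞ (g i)) ≈[ n ] Σ< n (λ i → Σ< n (g i))
Σ∞Σ∞≈[]Σ<Σ< S@(s , r) n = Mod.trans (Σ∞≈[]Σ< (summable-rows S) n) (Σ<-cong[] n (λ i → Σ∞≈[]Σ< (r i) n))

Σ∞-swap : ∀ {g} → Summable₂ g → Σ∞ (λ i → Σ∞ (g i)) ≈ Σ∞ (λ j → Σ∞ (λ i → g i j))
Σ∞-swap {g} S = ≈[]⇒≈ λ n → let open ≈[]-Reasoning n in begin
  Σ∞ (λ i → Σ∞ (g i))              ≈⟨ Σ∞Σ∞≈[]Σ<Σ< S n ⟩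
  Σ< n (λ i → Σ< n (g i))          ≈⟨ ≈⇒≈[] (Σ<-swap g n n) ⟩
  Σ< n (λ j → Σ< n (λ i → g i j))  ≈⟨ Σ∞Σ∞≈[]Σ<Σ< (transpose S) n ⟨
  Σ∞ (λ j → Σ∞ (λ i → g i j))      ∎

m≤m*[1+k] : ∀ m k → m ≤ m *ℕ suc k
m≤m*[1+k] m k = ℕₚ.m≤m*n m (suc k)

summable-block : ∀ {t} k i → Summable t → Summable (λ r → t (r *ℕ suc k +ℕ i))
summable-block k i s r = weaken (ℕₚ.≤-trans (m≤m*[1+k] r k) (ℕₚ.m≤m+n _ i)) (s (r *ℕ suc k +ℕ i))

Σ∞-blocks : ∀ {t} k → Summable t → Σ∞ t ≈ Σ∞ (λ r → Σ< (suc k) (λ i → t (r *ℕ suc k +ℕ i)))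
Σ∞-blocks {t} k s = ≈[]⇒≈ λ n → let open ≈[]-Reasoning n in begin
  Σ∞ t                                                ≈⟨ weaken (m≤m*[1+k] n k) (Σ∞≈[]Σ< s (n *ℕ suc k)) ⟩
  Σ< (n *ℕ suc k) t                                   ≈⟨ ≈⇒≈[] (Σ<-blocks t (suc k) n) ⟩
  Σ< n (λ r → Σ< (suc k) (λ i → t (r *ℕ suc k +ℕ i))) ≈⟨ Σ∞≈[]Σ< blocks n ⟨
  Σ∞ (λ r → Σ< (suc k) (λ i → t (r *ℕ suc k +ℕ i)))   ∎
  where
  blocks : Summable (λ r → Σ< (suc k) (λ i → t (r *ℕ suc k +ℕ i)))
  blocks r = Mod.trans (Σ<-cong[] (suc k) (λ i → summable-block k i s r)) (≈⇒≈[] (Σ<-0 (suc k)))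

Σ∞-2 : ∀ {t} → Summable t → Σ∞ t ≈ Σ∞ (λ r → t (r *ℕ 2) + t (1 +ℕ r *ℕ 2))
Σ∞-2 {t} s = trans (Σ∞-blocks 1 s) (Σ∞-cong λ r →
  +-cong (trans (+-identityˡ _) (Ring.reflexive (≡.cong t (ℕₚ.+-identityʳ _)))) (Ring.reflexive (≡.cong t (ℕₚ.+-comm (r *ℕ 2) 1))))

Σ∞-3 : ∀ {t} → Summable t → Σ∞ t ≈ Σ∞ (λ r → t (r *ℕ 3) + t (1 +ℕ r *ℕ 3) + t (2 +ℕ r *ℕ 3))
Σ∞-3 {t} s = trans (Σ∞-blocks 2 s) (Σ∞-cong λ r →
  +-cong (+-cong (trans (+-identityˡ _) (Ring.reflexive (≡.cong t (ℕₚ.+-identityʳ _)))) (Ring.reflexive (≡.cong t (ℕₚ.+-comm (r *ℕ 3) 1))))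
         (Ring.reflexive (≡.cong t (ℕₚ.+-comm (r *ℕ 3) 2))))

-- Σ_{i,j} g i j = Σ_j (Σ_r g (j+r) j + Σ_r g j (j+1+r)): peel off the first row
-- and the first column; the remainder g (i+1) (j+1) is of higher order.
diagonal : (ℕ → ℕ → PS) → ℕ → PS
diagonal g j = Σ∞ (λ r → g (j +ℕ r) j) + Σ∞ (λ r → g j (j +ℕ suc r))

peel : ∀ {g} → Summable₂ g → Σ∞ (λ i → Σ∞ (g i)) ≈ diagonal g 0 + Σ∞ (λ i → Σ∞ (λ j → g (suc i) (suc j)))
peel {g} S@(s , r) = begin
  Σ∞ (λ i → Σ∞ (g i))
    ≈⟨ Σ∞-head (summable-rows S) ⟩
  Σ∞ (g 0) + Σ∞ (λ i → Σ∞ (g (suc i)))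
    ≈⟨ +-cong (Σ∞-head (r 0)) (Σ∞-cong (λ i → Σ∞-head (r (suc i)))) ⟩
  g 0 0 + Σ∞ (g 0 ∘ suc) + Σ∞ (λ i → g (suc i) 0 + Σ∞ (λ j → g (suc i) (suc j)))
    ≈⟨ +-congˡ (Σ∞-+ (λ i → summable-suc {λ i → g i 0} (λ i → s i 0) i) (λ i → Σ∞-order (summable-suc (r (suc i))) (λ j → weaken (ℕₚ.n≤1+n i) (s (suc i) (suc j))))) ⟩
  g 0 0 + Σ∞ (g 0 ∘ suc) + (Σ∞ (λ i → g (suc i) 0) + Σ∞ (λ i → Σ∞ (λ j → g (suc i) (suc j))))
    ≈⟨ solve 4 (λ a b c d → a :+ b :+ (c :+ d) := a :+ c :+ b :+ d) refl (g 0 0) (Σ∞ (g 0 ∘ suc)) (Σ∞ (λ i → g (suc i) 0)) _ ⟩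
  g 0 0 + Σ∞ (λ i → g (suc i) 0) + Σ∞ (g 0 ∘ suc) + Σ∞ (λ i → Σ∞ (λ j → g (suc i) (suc j)))
    ≈⟨ +-congʳ (+-congʳ (Σ∞-head (λ i → s i 0))) ⟨
  diagonal g 0 + Σ∞ (λ i → Σ∞ (λ j → g (suc i) (suc j)))
    ∎
  where open ≈-Reasoning

Σ∞-diagonals : ∀ {g} → Summable₂ g → Σ∞ (λ i → Σ∞ (g i)) ≈ Σ∞ (diagonal g)
Σ∞-diagonals {g} S@(s , r) = ≈[]⇒≈ λ n → let open ≈[]-Reasoning n in begin
  Σ∞ (λ i → Σ∞ (g i))                      ≈⟨ ≈⇒≈[] (peels n) ⟩
  Σ< n (diagonal g) + Σ∞ (λ i → Σ∞ (λ j → g (n +ℕ i) (n +ℕ j)))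
    ≈⟨ +-cong[] Mod.refl (Σ∞-order (summable-rows (shifted n)) (λ i → Σ∞-order (λ j → weaken (ℕₚ.m≤n+m j n) (r (n +ℕ i) (n +ℕ j))) (λ j → weaken (ℕₚ.m≤m+n n i) (s (n +ℕ i) (n +ℕ j))))) ⟩
  Σ< n (diagonal g) + 0#                   ≈⟨ ≈⇒≈[] (+-identityʳ _) ⟩
  Σ< n (diagonal g)                        ≈⟨ Σ∞≈[]Σ< summable n ⟨
  Σ∞ (diagonal g)                          ∎
  where
  shifted : ∀ n → Summable₂ (λ i j → g (n +ℕ i) (n +ℕ j))
  shifted n = (λ i j → weaken (ℕₚ.m≤n+m i n) (s (n +ℕ i) (n +ℕ j))) , (λ i j → weaken (ℕₚ.m≤n+m j n) (r (n +ℕ i) (n +ℕ j)))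

  summable : Summable (diagonal g)
  summable j = +-order
    (Σ∞-order (λ r → weaken (ℕₚ.m≤n+m r j) (s (j +ℕ r) j)) (λ i → r (j +ℕ i) j))
    (Σ∞-order (λ i → weaken (ℕₚ.≤-trans (ℕₚ.n≤1+n i) (ℕₚ.m≤n+m (suc i) j)) (r j (j +ℕ suc i))) (λ i → s j (j +ℕ suc i)))

  peels : ∀ n → Σ∞ (λ i → Σ∞ (g i)) ≈ Σ< n (diagonal g) + Σ∞ (λ i → Σ∞ (λ j → g (n +ℕ i) (n +ℕ j)))
  peels zero    = sym (+-identityˡ _)
  peels (suc n) = begin
    Σ∞ (λ i → Σ∞ (g i))
      ≈⟨ peels n ⟩
    Σ< n (diagonal g) + Σ∞ (λ i → Σ∞ (λ j → g (n +ℕ i) (n +ℕ j)))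
      ≈⟨ +-congˡ (peel (shifted n)) ⟩
    Σ< n (diagonal g) + (diagonal (λ i j → g (n +ℕ i) (n +ℕ j)) 0 + Σ∞ (λ i → Σ∞ (λ j → g (n +ℕ suc i) (n +ℕ suc j))))
      ≈⟨ +-assoc _ _ _ ⟨
    Σ< n (diagonal g) + diagonal (λ i j → g (n +ℕ i) (n +ℕ j)) 0 + Σ∞ (λ i → Σ∞ (λ j → g (n +ℕ suc i) (n +ℕ suc j)))
      ≈⟨ +-cong (+-congˡ (+-cong (Σ∞-cong (λ r → Ring.reflexive (≡.cong (g (n +ℕ r)) (ℕₚ.+-identityʳ n))))
                                 (Σ∞-cong (λ r → Ring.reflexive (≡.cong (λ m → g m (n +ℕ suc r)) (ℕₚ.+-identityʳ n))))))
                (Σ∞-cong (λ i → Σ∞-cong (λ j → Ring.reflexive (≡.cong₂ g (ℕₚ.+-suc n i) (ℕₚ.+-suc n j))))) ⟩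
    Σ< (suc n) (diagonal g) + Σ∞ (λ i → Σ∞ (λ j → g (suc n +ℕ i) (suc n +ℕ j)))
      ∎
    where open ≈-Reasoning

Σ∞-*-Σ∞ : ∀ {t u} → Summable t → Summable u → Σ∞ t * Σ∞ u ≈ Σ∞ (λ i → Σ∞ (λ j → t i * u j))
Σ∞-*-Σ∞ {t} {u} s r = begin
  Σ∞ t * Σ∞ u                       ≈⟨ *-comm _ _ ⟩
  Σ∞ u * Σ∞ t                       ≈⟨ Σ∞-* (Σ∞ u) s ⟩
  Σ∞ (λ i → Σ∞ u * t i)             ≈⟨ Σ∞-cong (λ i → trans (*-comm _ _) (Σ∞-* (t i) r)) ⟩
  Σ∞ (λ i → Σ∞ (λ j → t i * u j))   ∎
  where open ≈-Reasoning

-- Limits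

-- The rate of the products `⟨ u ∣ Q ⟩ n`: the next factor 1 - u Q^n, with u and Q in the ideal (q),
-- changes nothing up to the coefficient of q^n. It makes the diagonal in `lim` final, since
-- coefficient n is settled at stage n.
Stable : (ℕ → PS) → Set
Stable s = ∀ n → s (suc n) ≈[ suc n ] s n

lim : (ℕ → PS) → PS
lim s = ser (λ n → coef (s n) n)

stable-≤ : ∀ {s} → Stable s → ∀ {m n} → m ≤ n → s n ≈[ suc m ] s m
stable-≤ {s} st {m} {n} m≤n = ≡.subst (λ l → s l ≈[ suc m ] s m) (ℕₚ.m+[n∸m]≡n m≤n) (go (n ∸ m))
  where
  go : ∀ d → s (m +ℕ d) ≈[ suc m ] s m
  go zero    rewrite ℕₚ.+-identityʳ m = Mod.refl
  go (suc d) rewrite ℕₚ.+-suc m d = Mod.trans (weaken (s≤s (ℕₚ.m≤m+n m d)) (st (m +ℕ d))) (go d)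

lim≈[] : ∀ {s} → Stable s → ∀ n → lim s ≈[ suc n ] s n
lim≈[] st n = below λ k h → ≡.sym (at< (stable-≤ st (s≤s⁻¹ h)) k ℕₚ.≤-refl)

lim≈[]′ : ∀ {s} → Stable s → ∀ n → lim s ≈[ n ] s n
lim≈[]′ st n = weaken (ℕₚ.n≤1+n n) (lim≈[] st n)

lim-cong : ∀ {s t} → (∀ n → s n ≈ t n) → lim s ≈ lim t
lim-cong e = pointwise λ n → at (e n) n

-- Inverses

opaque
  unfolding _+_

  ser-⊕ : ∀ a b → ser (a ⊕ b) ≈ ser a + ser b
  ser-⊕ a b = pointwise λ _ → ≡.refl

  ser-⊖ : ∀ a b → ser (a ⊖ b) ≈ ser a - ser b
  ser-⊖ a b = pointwise λ _ → ≡.refl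

  ser-⊛ : ∀ a b → ser (a ⊛ b) ≈ ser a * ser b
  ser-⊛ a b = pointwise λ _ → ≡.refl

  ser-scale : ∀ c a → ser (scale c a) ≈ const c * ser a
  ser-scale c a = pointwise λ n → ≡.sym (coef-const* c (ser a) n)

  ser-one : ser one ≈ 1#
  ser-one = pointwise λ { zero → ≡.refl ; (suc n) → ≡.refl }

ser-mono : ∀ e → ser (mono e) ≈ q ^ e
ser-mono zero    = ser-one
ser-mono (suc e) = pointwise λ
  { zero    → ≡.sym (coef-q*-zero (q ^ e))
  ; (suc n) → ≡.trans (at (ser-mono e) n) (≡.sym (coef-q*-suc (q ^ e) n))
  }

ser-^ : ∀ a k → ser (a ^ˢ k) ≈ ser a ^ k
ser-^ a zero    = ser-one
ser-^ a (suc k) = trans (ser-⊛ a (a ^ˢ k)) (*-congˡ (ser-^ a k))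

ser-coef : ∀ a → ser (coef a) ≈ a
ser-coef a = pointwise λ _ → ≡.refl

-- The ideal (q) and its coset 1 + (q), on which the geometric series behind `inv` converges.
𝔪 Unit : PS → Set
𝔪 a = a ≈[ 1 ] 0#
Unit a = a ≈[ 1 ] 1#

1-𝔪 : ∀ {u} → 𝔪 u → Unit (1# - u)
1-𝔪 u∈𝔪 = Mod.trans (+-cong[] Mod.refl (-‿order u∈𝔪)) (≈⇒≈[] (+-identityʳ 1#))

1-Unit : ∀ {a} → Unit a → 𝔪 (1# - a)
1-Unit ua = Mod.trans (+-cong[] Mod.refl (-‿cong[] ua)) (≈⇒≈[] (-‿inverseʳ 1#))

*-unit : ∀ {a b} → Unit a → Unit b → Unit (a * b)
*-unit ua ub = Mod.trans (*-cong[] ua ub) (≈⇒≈[] (*-identityˡ 1#))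

iv : PS → PS
iv a = ser (inv (coef a))

iv≈geometric : ∀ a → iv a ≈ Σ∞ (λ k → (1# - a) ^ k)
iv≈geometric a = pointwise λ n → Σ≤-cong n (λ k → at (power k) n)
  where
  power : ∀ k → ser ((one ⊖ coef a) ^ˢ k) ≈ (1# - a) ^ k
  power k = trans (ser-^ _ k) (^-congˡ k (trans (ser-⊖ one (coef a)) (+-cong ser-one (-‿cong (ser-coef a)))))

*-inverseʳ : ∀ {a} → Unit a → a * iv a ≈ 1#
*-inverseʳ {a} ua = begin
  a * iv a                       ≈⟨ *-congˡ (iv≈geometric a) ⟩
  a * G                          ≈⟨ solve 2 (λ a G → a :* G := G :- (con 1ℤ :- a) :* G) refl a G ⟩
  G - u * G                      ≈⟨ +-congʳ (Σ∞-head summable) ⟩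
  1# + Σ∞ (λ k → u ^ suc k) - u * G  ≈⟨ +-congʳ (+-congˡ (Σ∞-* u summable)) ⟨
  1# + u * G - u * G             ≈⟨ solve 2 (λ u G → con 1ℤ :+ u :* G :- u :* G := con 1ℤ) refl u G ⟩
  1#                             ∎
  where
  open ≈-Reasoning
  u G : PS
  u = 1# - a
  G = Σ∞ (λ k → u ^ k)
  summable : Summable (λ k → u ^ k)
  summable = ^-order (1-Unit ua)

*-cancelˡ : ∀ {a b c} → Unit a → a * b ≈ a * c → b ≈ c
*-cancelˡ {a} {b} {c} ua e = trans (sym (undo b)) (trans (*-congˡ e) (undo c))
  where
  undo : ∀ b → iv a * (a * b) ≈ b
  undo b = trans (solve 3 (λ a i b → i :* (a :* b) := a :* i :* b) refl a (iv a) b)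
                 (trans (*-congʳ (*-inverseʳ ua)) (*-identityˡ b))

iv-unique : ∀ {a b} → Unit a → a * b ≈ 1# → b ≈ iv a
iv-unique ua e = *-cancelˡ ua (trans e (sym (*-inverseʳ ua)))

/-unique : ∀ {a b c} → Unit b → a ≈ c * b → a * iv b ≈ c
/-unique {a} {b} {c} ub e = trans (*-congʳ e) (trans (*-assoc _ _ _) (trans (*-congˡ (*-inverseʳ ub)) (*-identityʳ c)))

iv-cong[] : ∀ {n a b} → Unit a → Unit b → a ≈[ n ] b → iv a ≈[ n ] iv b
iv-cong[] {n} {a} {b} ua ub e = begin
  iv a                ≈⟨ ≈⇒≈[] (/-unique ub (solve 2 (λ i b → i :* b := i :* b) refl (iv a) b)) ⟨
  iv a * b * iv b     ≈⟨ *-cong[] (*-cong[] Mod.refl e) Mod.refl ⟨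
  iv a * a * iv b     ≈⟨ ≈⇒≈[] (trans (*-congʳ (trans (*-comm _ _) (*-inverseʳ ua))) (*-identityˡ _)) ⟩
  iv b                ∎
  where open ≈[]-Reasoning n

iv-cong : ∀ {a b} → Unit a → a ≈ b → iv a ≈ iv b
iv-cong ua e = ≈[]⇒≈ λ n → iv-cong[] ua (Mod.trans (≈⇒≈[] (sym e)) ua) (≈⇒≈[] e)

iv-* : ∀ {a b} → Unit a → Unit b → iv (a * b) ≈ iv a * iv b
iv-* {a} {b} ua ub = sym (iv-unique (*-unit ua ub) (begin
  a * b * (iv a * iv b)    ≈⟨ solve 4 (λ a b i j → a :* b :* (i :* j) := a :* i :* (b :* j)) refl a b (iv a) (iv b) ⟩
  a * iv a * (b * iv b)    ≈⟨ *-cong (*-inverseʳ ua) (*-inverseʳ ub) ⟩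
  1# * 1#                  ≈⟨ *-identityˡ 1# ⟩
  1#                       ∎))
  where open ≈-Reasoning

-- q-Pochhammer symbols

⟨_∣_⟩_ : PS → PS → ℕ → PS
⟨ u ∣ Q ⟩ zero  = 1#
⟨ u ∣ Q ⟩ suc n = (⟨ u ∣ Q ⟩ n) * (1# - u * Q ^ n)

⟨_∣_⟩∞ : PS → PS → PS
⟨ u ∣ Q ⟩∞ = lim (λ n → ⟨ u ∣ Q ⟩ n)

poch-cong : ∀ {u v Q R} → u ≈ v → Q ≈ R → ∀ n → ⟨ u ∣ Q ⟩ n ≈ ⟨ v ∣ R ⟩ n
poch-cong e f zero    = refl
poch-cong e f (suc n) = *-cong (poch-cong e f n) (+-congˡ (-‿cong (*-cong e (^-congˡ n f))))

poch∞-cong : ∀ {u v Q R} → u ≈ v → Q ≈ R → ⟨ u ∣ Q ⟩∞ ≈ ⟨ v ∣ R ⟩∞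
poch∞-cong e f = lim-cong (poch-cong e f)

module _ {u Q} (u∈𝔪 : 𝔪 u) (Q∈𝔪 : 𝔪 Q) where

  u*Q^-order : ∀ n → u * Q ^ n ≈[ suc n ] 0#
  u*Q^-order n = *-order u∈𝔪 (^-order Q∈𝔪 n)

  poch-factor-unit : ∀ n → Unit (1# - u * Q ^ n)
  poch-factor-unit n = 1-𝔪 (*-orderˡ _ u∈𝔪)

  poch-unit : ∀ n → Unit (⟨ u ∣ Q ⟩ n)
  poch-unit zero    = Mod.refl
  poch-unit (suc n) = *-unit (poch-unit n) (poch-factor-unit n)

  poch-stable : Stable (λ n → ⟨ u ∣ Q ⟩ n)
  poch-stable n = begin
    (⟨ u ∣ Q ⟩ n) * (1# - u * Q ^ n)  ≈⟨ *-cong[] Mod.refl (+-cong[] Mod.refl (-‿order (u*Q^-order n))) ⟩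
    (⟨ u ∣ Q ⟩ n) * (1# + 0#)         ≈⟨ ≈⇒≈[] (solve 1 (λ p → p :* (con 1ℤ :+ con 0ℤ) := p) refl _) ⟩
    (⟨ u ∣ Q ⟩ n)                     ∎
    where open ≈[]-Reasoning (suc n)

  poch∞≈[] : ∀ n → ⟨ u ∣ Q ⟩∞ ≈[ suc n ] ⟨ u ∣ Q ⟩ n
  poch∞≈[] = lim≈[] poch-stable

  poch∞≈[]′ : ∀ n → ⟨ u ∣ Q ⟩∞ ≈[ n ] ⟨ u ∣ Q ⟩ n
  poch∞≈[]′ = lim≈[]′ poch-stable

  poch∞-unit : Unit ⟨ u ∣ Q ⟩∞
  poch∞-unit = Mod.trans (poch∞≈[] 0) Mod.refl

-- Indexed so that tri n = n(n-1)/2.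
tri : ℕ → ℕ
tri zero    = 0
tri (suc n) = tri n +ℕ n

tri-+ : ∀ m n → tri (m +ℕ n) ≡ tri m +ℕ tri n +ℕ m *ℕ n
tri-+ zero    n = ≡.sym (ℕₚ.+-identityʳ (tri n))
tri-+ (suc m) n rewrite tri-+ m n = shuffle (tri m) (tri n) m n
  where
  shuffle : ∀ a b m n → a +ℕ b +ℕ m *ℕ n +ℕ (m +ℕ n) ≡ a +ℕ m +ℕ b +ℕ (n +ℕ m *ℕ n)
  shuffle = solve-∀

tri+tri+n : ∀ n → tri n +ℕ tri n +ℕ n ≡ n *ℕ n
tri+tri+n zero    = ≡.refl
tri+tri+n (suc n) = ≡.trans (shuffle (tri n) n) (≡.trans (≡.cong (λ s → s +ℕ n +ℕ suc n) (tri+tri+n n)) (square n))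
  where
  shuffle : ∀ a n → a +ℕ n +ℕ (a +ℕ n) +ℕ suc n ≡ a +ℕ a +ℕ n +ℕ n +ℕ suc n
  shuffle = solve-∀
  square : ∀ n → n *ℕ n +ℕ n +ℕ suc n ≡ suc n *ℕ suc n
  square = solve-∀

σ : ℕ → PS
σ r = (- 1#) ^ r

g₃Term : PS → PS → PS → ℕ → PS
g₃Term x y Q n = Q ^ (n *ℕ n +ℕ n) * iv ((⟨ x ∣ Q ⟩ suc n) * (⟨ y ∣ Q ⟩ suc n))

-- Identities in a general base Q

module QSeries (Q : PS) (Q∈𝔪 : 𝔪 Q) where

  P rP : ℕ → PS
  P n = ⟨ Q ∣ Q ⟩ n
  rP n = iv (P n)

  P∞ rP∞ : PS
  P∞ = ⟨ Q ∣ Q ⟩∞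
  rP∞ = iv P∞

  P-unit : ∀ n → Unit (P n)
  P-unit = poch-unit Q∈𝔪 Q∈𝔪

  P∞-unit : Unit P∞
  P∞-unit = poch∞-unit Q∈𝔪 Q∈𝔪

  rP-suc : ∀ n → (1# - Q ^ suc n) * rP (suc n) ≈ rP n
  rP-suc n = iv-unique (P-unit n) (trans (sym (*-assoc _ _ _)) (*-inverseʳ (P-unit (suc n))))

  rP-zero : rP 0 ≈ 1#
  rP-zero = sym (iv-unique Mod.refl (*-identityˡ 1#))

  rP≈[] : ∀ n → rP n ≈[ n ] rP∞
  rP≈[] n = iv-cong[] (P-unit n) P∞-unit (Mod.sym (poch∞≈[]′ Q∈𝔪 Q∈𝔪 n))

  -- 1/(Q;Q)_{n-r}, with the usual convention 1/(Q;Q)_{-k} = 0.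
  rPd : ℕ → ℕ → PS
  rPd n       zero    = rP n
  rPd zero    (suc r) = 0#
  rPd (suc n) (suc r) = rPd n r

  -- The truncated difference is harmless. At r = n + 1 the factor is 1 - Q^0 = 0, which agrees with
  -- 1/(Q;Q)_k = 0 for k = -1 on the right; for larger r both sides are 0.
  rPd-suc : ∀ n r → (1# - Q ^ (suc n ∸ r)) * rPd (suc n) r ≈ rPd n r
  rPd-suc n       zero    = rP-suc n
  rPd-suc (suc n) (suc r) = rPd-suc n r
  rPd-suc zero    (suc r) rewrite ℕₚ.0∸n≡0 r = trans (*-congʳ (-‿inverseʳ 1#)) (zeroˡ _)

  rPd-> : ∀ {n r} → n < r → rPd n r ≈ 0#
  rPd-> {zero}  {suc r} h       = refl
  rPd-> {suc n} {suc r} (s≤s h) = rPd-> h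

  rPd-+ : ∀ r m → rPd (r +ℕ m) r ≈ rP m
  rPd-+ zero    m = refl
  rPd-+ (suc r) m = rPd-+ r m

  rPd≈[] : ∀ n r → rPd n r ≈[ n ∸ r ] rP∞
  rPd≈[] n       zero    = rP≈[] n
  rPd≈[] zero    (suc r) = ≈[0]
  rPd≈[] (suc n) (suc r) = rPd≈[] n r

  -- Durfee rectangles: D c does not depend on c because the differences
  -- D c - D (c+1) satisfy a first order recursion that pushes their order to infinity.

  durfeeTerm : ℕ → ℕ → PS
  durfeeTerm c m = Q ^ (m *ℕ m +ℕ c *ℕ m) * rP m * rP (m +ℕ c)

  D : ℕ → PS
  D c = Σ∞ (durfeeTerm c)

  m≤m*m+ : ∀ m k → m ≤ m *ℕ m +ℕ k
  m≤m*m+ zero    k = z≤n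
  m≤m*m+ (suc m) k = ℕₚ.≤-trans (ℕₚ.m≤m*n (suc m) (suc m)) (ℕₚ.m≤m+n _ k)

  durfee-summable : ∀ c → Summable (durfeeTerm c)
  durfee-summable c m = *-orderˡ _ (*-orderˡ _ (^-order-≥ Q∈𝔪 (m≤m*m+ m _)))

  -- Over the common denominator (Q;Q)_m (Q;Q)_{m+c+1} the difference of the terms has numerator
  -- Q^{m²+cm} (1 - Q^{m+c+1} - Q^m), regrouped as (1 - Q^m) - Q^{c+1} Q^m. The part with 1 - Q^m
  -- vanishes at m = 0, cancels a factor of (Q;Q)_m otherwise, and after the shift m → m + 1 gives
  -- Q^{c+1} `D (c + 2)`; the other part is Q^{c+1} `D (c + 1)`.
  durfee-recursion : ∀ c → D c - D (suc c) ≈ - Q ^ suc c * (D (suc c) - D (suc (suc c)))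
  durfee-recursion c = begin
    D c - D (suc c)
      ≈⟨ Σ∞-‿- (durfee-summable c) (durfee-summable (suc c)) ⟨
    Σ∞ (λ m → durfeeTerm c m - durfeeTerm (suc c) m)
      ≈⟨ Σ∞-cong split ⟩
    Σ∞ (λ m → s m - t m)
      ≈⟨ Σ∞-‿- s-summable t-summable ⟩
    Σ∞ s - Σ∞ t
      ≈⟨ +-congʳ (Σ∞-head s-summable) ⟩
    s 0 + Σ∞ (s ∘ suc) - Σ∞ t
      ≈⟨ +-congʳ (+-cong (solve 2 (λ a b → a :* (con 1ℤ :- con 1ℤ) :* b := con 0ℤ) refl (Q ^ (c *ℕ 0) * rP 0) (rP (suc c))) (Σ∞-cong s-suc)) ⟩
    0# + Σ∞ (λ m → Q ^ suc c * durfeeTerm (suc (suc c)) m) - Σ∞ t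
      ≈⟨ +-cong (+-congˡ (Σ∞-* (Q ^ suc c) (durfee-summable (suc (suc c))))) (-‿cong (Σ∞-* (Q ^ suc c) (durfee-summable (suc c)))) ⟨
    0# + Q ^ suc c * D (suc (suc c)) - Q ^ suc c * D (suc c)
      ≈⟨ solve 3 (λ a b c → con 0ℤ :+ a :* b :- a :* c := :- a :* (c :- b)) refl (Q ^ suc c) (D (suc (suc c))) (D (suc c)) ⟩
    - Q ^ suc c * (D (suc c) - D (suc (suc c)))
      ∎
    where
    open ≈-Reasoning
    V : ℕ → PS
    V m = Q ^ (m *ℕ m +ℕ c *ℕ m)

    s t : ℕ → PS
    s m = V m * rP m * (1# - Q ^ m) * rP (m +ℕ suc c)
    t m = Q ^ suc c * durfeeTerm (suc c) m

    s-summable : Summable s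
    s-summable m = *-orderˡ _ (*-orderˡ _ (*-orderˡ _ (^-order-≥ Q∈𝔪 (m≤m*m+ m _))))

    t-summable : Summable t
    t-summable = summable-* _ (durfee-summable (suc c))

    split : ∀ m → durfeeTerm c m - durfeeTerm (suc c) m ≈ s m - t m
    split m = begin
      V m * rP m * rP (m +ℕ c) - Q ^ (m *ℕ m +ℕ suc c *ℕ m) * rP m * w
        ≈⟨ +-cong (*-congˡ (rP-step m)) (-‿cong (*-congʳ (*-congʳ V-suc))) ⟩
      V m * rP m * ((1# - Q ^ m * Q ^ suc c) * w) - V m * Q ^ m * rP m * w
        ≈⟨ solve 5 (λ v r w a b → v :* r :* ((con 1ℤ :- a :* b) :* w) :- v :* a :* r :* w
                     := v :* r :* (con 1ℤ :- a) :* w :- b :* (v :* a :* r :* w)) refl (V m) (rP m) w (Q ^ m) (Q ^ suc c) ⟩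
      V m * rP m * (1# - Q ^ m) * w - Q ^ suc c * (V m * Q ^ m * rP m * w)
        ≈⟨ +-congˡ (-‿cong (*-congˡ (*-congʳ (*-congʳ V-suc)))) ⟨
      s m - t m ∎
      where
      w = rP (m +ℕ suc c)
      rP-step : ∀ m → rP (m +ℕ c) ≈ (1# - Q ^ m * Q ^ suc c) * rP (m +ℕ suc c)
      rP-step m rewrite ℕₚ.+-suc m c = trans (sym (rP-suc (m +ℕ c)))
        (*-congʳ (+-congˡ (-‿cong (trans (*-congˡ (^-homo-* Q m c)) (solve 3 (λ q a b → q :* (a :* b) := a :* (q :* b)) refl Q (Q ^ m) (Q ^ c))))))
      exponent : ∀ m c → m *ℕ m +ℕ suc c *ℕ m ≡ m *ℕ m +ℕ c *ℕ m +ℕ m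
      exponent = solve-∀
      V-suc : Q ^ (m *ℕ m +ℕ suc c *ℕ m) ≈ V m * Q ^ m
      V-suc = trans (^-congʳ Q (exponent m c)) (^-homo-* Q (m *ℕ m +ℕ c *ℕ m) m)

    s-suc : ∀ m → s (suc m) ≈ Q ^ suc c * durfeeTerm (suc (suc c)) m
    s-suc m = begin
      V (suc m) * rP (suc m) * (1# - Q ^ suc m) * rP (suc m +ℕ suc c)
        ≈⟨ solve 4 (λ v r e w → v :* r :* e :* w := v :* (e :* r) :* w) refl (V (suc m)) (rP (suc m)) _ _ ⟩
      V (suc m) * ((1# - Q ^ suc m) * rP (suc m)) * rP (suc m +ℕ suc c)
        ≈⟨ *-cong (*-cong V-step (rP-suc m)) (Ring.reflexive (≡.cong rP (≡.sym (ℕₚ.+-suc m (suc c))))) ⟩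
      Q ^ suc c * Q ^ (m *ℕ m +ℕ suc (suc c) *ℕ m) * rP m * rP (m +ℕ suc (suc c))
        ≈⟨ solve 4 (λ a b c d → a :* b :* c :* d := a :* (b :* c :* d)) refl (Q ^ suc c) (Q ^ (m *ℕ m +ℕ suc (suc c) *ℕ m)) (rP m) _ ⟩
      Q ^ suc c * durfeeTerm (suc (suc c)) m ∎
      where
      exponent : ∀ m c → suc m *ℕ suc m +ℕ c *ℕ suc m ≡ suc c +ℕ (m *ℕ m +ℕ suc (suc c) *ℕ m)
      exponent = solve-∀
      V-step : V (suc m) ≈ Q ^ suc c * Q ^ (m *ℕ m +ℕ suc (suc c) *ℕ m)
      V-step = trans (^-congʳ Q (exponent m c)) (^-homo-* Q (suc c) _)

  durfee-difference-order : ∀ n c → D c - D (suc c) ≈[ n ] 0#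
  durfee-difference-order zero    c = ≈[0]
  durfee-difference-order (suc n) c = Mod.trans (≈⇒≈[] (durfee-recursion c))
    (*-order (-‿order (^-order-suc c Q∈𝔪)) (durfee-difference-order n (suc c)))

  D-const : ∀ c n → D c ≈ D (n +ℕ c)
  D-const c zero    = refl
  D-const c (suc n) = trans (D-const c n) (-≈0⇒≈ (≈[]⇒≈ λ k → durfee-difference-order k (n +ℕ c)))

  -- As c grows only the term m = 0 survives, and it equals 1/(Q;Q)_c, which tends to 1/(Q;Q)∞.
  -- Independence of c carries this limit back to every c.
  durfee : ∀ c → D c ≈ rP∞
  durfee c = ≈[]⇒≈ λ n → let open ≈[]-Reasoning n in begin
    D c                                             ≈⟨ ≈⇒≈[] (D-const c n) ⟩
    D (n +ℕ c)                                      ≈⟨ ≈⇒≈[] (Σ∞-head (durfee-summable (n +ℕ c))) ⟩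
    durfeeTerm (n +ℕ c) 0 + Σ∞ (durfeeTerm (n +ℕ c) ∘ suc)
      ≈⟨ +-cong[] Mod.refl (Σ∞-order (summable-suc (durfee-summable (n +ℕ c))) (λ m → *-orderˡ _ (*-orderˡ _ (^-order-≥ Q∈𝔪 (bound n m))))) ⟩
    durfeeTerm (n +ℕ c) 0 + 0#                      ≈⟨ ≈⇒≈[] (first (n +ℕ c)) ⟩
    rP (n +ℕ c)                                     ≈⟨ weaken (ℕₚ.m≤m+n n c) (rP≈[] (n +ℕ c)) ⟩
    rP∞                                             ∎
    where
    first : ∀ n → durfeeTerm n 0 + 0# ≈ rP n
    first n rewrite ℕₚ.*-zeroʳ n = trans (+-congʳ (*-congʳ (*-congˡ rP-zero))) (solve 1 (λ a → con 1ℤ :* con 1ℤ :* a :+ con 0ℤ := a) refl (rP n))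
    bound : ∀ n m → n ≤ suc m *ℕ suc m +ℕ (n +ℕ c) *ℕ suc m
    bound n m = ℕₚ.≤-trans (ℕₚ.m≤m+n n c) (ℕₚ.≤-trans (ℕₚ.m≤m*n (n +ℕ c) (suc m)) (ℕₚ.m≤n+m _ (suc m *ℕ suc m)))

  -- Euler's product expansion: both sides satisfy F X = (1 + X) F (X Q).

  eulerTerm : PS → ℕ → PS
  eulerTerm X i = X ^ i * Q ^ tri i * rP i

  euler-summable : ∀ {X} → 𝔪 X → Summable (eulerTerm X)
  euler-summable X∈𝔪 i = *-orderˡ _ (*-orderˡ _ (^-order X∈𝔪 i))

  euler-step : ∀ {X} → 𝔪 X → Σ∞ (eulerTerm X) ≈ (1# + X) * Σ∞ (eulerTerm (X * Q))
  euler-step {X} X∈𝔪 = begin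
    E                        ≈⟨ solve 2 (λ e f → e := e :- f :+ f) refl E E′ ⟩
    E - E′ + E′              ≈⟨ +-congʳ difference ⟩
    X * E′ + E′              ≈⟨ solve 2 (λ x e → x :* e :+ e := (con 1ℤ :+ x) :* e) refl X E′ ⟩
    (1# + X) * E′            ∎
    where
    open ≈-Reasoning
    E = Σ∞ (eulerTerm X)
    E′ = Σ∞ (eulerTerm (X * Q))
    XQ∈𝔪 : 𝔪 (X * Q)
    XQ∈𝔪 = *-orderˡ Q X∈𝔪
    s : ℕ → PS
    s i = X ^ i * Q ^ tri i * ((1# - Q ^ i) * rP i)
    s-summable : Summable s
    s-summable i = *-orderˡ _ (*-orderˡ _ (^-order X∈𝔪 i))
    split : ∀ i → eulerTerm X i - eulerTerm (X * Q) i ≈ s i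
    split i = trans (+-congˡ (-‿cong (*-congʳ (*-congʳ (^-distrib-* X Q i)))))
      (solve 4 (λ a b c r → a :* b :* r :- a :* c :* b :* r := a :* b :* ((con 1ℤ :- c) :* r)) refl (X ^ i) (Q ^ tri i) (Q ^ i) (rP i))
    s-suc : ∀ i → s (suc i) ≈ X * eulerTerm (X * Q) i
    s-suc i = begin
      X * X ^ i * Q ^ (tri i +ℕ i) * ((1# - Q ^ suc i) * rP (suc i))
        ≈⟨ *-cong (*-congˡ (^-homo-* Q (tri i) i)) (rP-suc i) ⟩
      X * X ^ i * (Q ^ tri i * Q ^ i) * rP i
        ≈⟨ solve 5 (λ x a b c r → x :* a :* (b :* c) :* r := x :* (a :* c :* b :* r)) refl X (X ^ i) (Q ^ tri i) (Q ^ i) (rP i) ⟩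
      X * (X ^ i * Q ^ i * Q ^ tri i * rP i)
        ≈⟨ *-congˡ (*-congʳ (*-congʳ (^-distrib-* X Q i))) ⟨
      X * eulerTerm (X * Q) i ∎
    difference : E - E′ ≈ X * E′
    difference = begin
      E - E′                                          ≈⟨ Σ∞-‿- (euler-summable X∈𝔪) (euler-summable XQ∈𝔪) ⟨
      Σ∞ (λ i → eulerTerm X i - eulerTerm (X * Q) i)  ≈⟨ Σ∞-cong split ⟩
      Σ∞ s                                            ≈⟨ Σ∞-head s-summable ⟩
      s 0 + Σ∞ (s ∘ suc)                              ≈⟨ +-cong (solve 1 (λ r → con 1ℤ :* con 1ℤ :* ((con 1ℤ :- con 1ℤ) :* r) := con 0ℤ) refl (rP 0)) (Σ∞-cong s-suc) ⟩
      0# + Σ∞ (λ i → X * eulerTerm (X * Q) i)         ≈⟨ +-identityˡ _ ⟩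
      Σ∞ (λ i → X * eulerTerm (X * Q) i)              ≈⟨ Σ∞-* X (euler-summable XQ∈𝔪) ⟨
      X * E′                                          ∎

  euler-steps : ∀ {X} → 𝔪 X → ∀ n → Σ∞ (eulerTerm X) ≈ (⟨ - X ∣ Q ⟩ n) * Σ∞ (eulerTerm (X * Q ^ n))
  euler-steps {X} X∈𝔪 zero = trans (Σ∞-cong (λ i → *-congʳ (*-congʳ (^-congˡ i (sym (*-identityʳ X)))))) (sym (*-identityˡ _))
  euler-steps {X} X∈𝔪 (suc n) = begin
    Σ∞ (eulerTerm X)
      ≈⟨ euler-steps X∈𝔪 n ⟩
    p * Σ∞ (eulerTerm (X * Q ^ n))
      ≈⟨ *-congˡ (euler-step (*-orderˡ _ X∈𝔪)) ⟩
    p * ((1# + X * Q ^ n) * Σ∞ (eulerTerm (X * Q ^ n * Q)))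
      ≈⟨ *-congˡ (*-congˡ (Σ∞-cong (λ i → *-congʳ (*-congʳ (^-congˡ i (solve 3 (λ x a b → x :* a :* b := x :* (b :* a)) refl X (Q ^ n) Q)))))) ⟩
    p * ((1# + X * Q ^ n) * Σ∞ (eulerTerm (X * Q ^ suc n)))
      ≈⟨ solve 4 (λ p x a e → p :* ((con 1ℤ :+ x :* a) :* e) := p :* (con 1ℤ :- (:- x) :* a) :* e) refl p X (Q ^ n) _ ⟩
    p * (1# - - X * Q ^ n) * Σ∞ (eulerTerm (X * Q ^ suc n))
      ∎
    where
    open ≈-Reasoning
    p = ⟨ - X ∣ Q ⟩ n

  -- After n steps of the functional equation the argument is X Q^n, where the series is 1 up to
  -- order n, so only the finite product is left.
  euler : ∀ {X} → 𝔪 X → ⟨ - X ∣ Q ⟩∞ ≈ Σ∞ (eulerTerm X)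
  euler {X} X∈𝔪 = ≈[]⇒≈ λ n → let open ≈[]-Reasoning n in begin
    ⟨ - X ∣ Q ⟩∞
      ≈⟨ poch∞≈[]′ (-‿order X∈𝔪) Q∈𝔪 n ⟩
    (⟨ - X ∣ Q ⟩ n)
      ≈⟨ ≈⇒≈[] (*-identityʳ _) ⟨
    (⟨ - X ∣ Q ⟩ n) * 1#
      ≈⟨ *-cong[] Mod.refl (near-one n) ⟨
    (⟨ - X ∣ Q ⟩ n) * Σ∞ (eulerTerm (X * Q ^ n))
      ≈⟨ ≈⇒≈[] (euler-steps X∈𝔪 n) ⟨
    Σ∞ (eulerTerm X)
      ∎
    where
    near-one : ∀ n → Σ∞ (eulerTerm (X * Q ^ n)) ≈[ n ] 1#
    near-one n = begin
      Σ∞ (eulerTerm V)                          ≈⟨ ≈⇒≈[] (Σ∞-head (euler-summable V∈𝔪)) ⟩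
      1# * 1# * rP 0 + Σ∞ (eulerTerm V ∘ suc)   ≈⟨ +-cong[] (≈⇒≈[] (*-congˡ rP-zero)) (Σ∞-order (summable-suc (euler-summable V∈𝔪)) (λ i → *-orderˡ _ (*-orderˡ _ (*-orderˡ _ (*-orderʳ X (^-order Q∈𝔪 n)))))) ⟩
      1# * 1# * 1# + 0#                         ≈⟨ ≈⇒≈[] (solve 0 (con 1ℤ :* con 1ℤ :* con 1ℤ :+ con 0ℤ := con 1ℤ) refl) ⟩
      1#                                        ∎
      where
      open ≈[]-Reasoning n
      V = X * Q ^ n
      V∈𝔪 : 𝔪 V
      V∈𝔪 = *-orderˡ _ X∈𝔪

  -- Jacobi's triple product: expand both infinite products by Euler, collect
  -- the terms with i - j fixed and sum over the rest by Durfee.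

  thetaTerm : PS → ℕ → PS
  thetaTerm X r = X ^ r * Q ^ tri r

  theta-summable : ∀ {X} → 𝔪 X → Summable (thetaTerm X)
  theta-summable X∈𝔪 r = *-orderˡ _ (^-order X∈𝔪 r)

  -- The exponents j(j-1)/2 of Y and (j+r)(j+r-1)/2 of X combine with X^j Y^j = Q^j into r(r-1)/2 +
  -- j² + rj. The first summand belongs to the theta term, the rest is the exponent of the Durfee
  -- rectangle with c = r.
  euler-diagonal : ∀ {X Y} → X * Y ≈ Q → ∀ j r → eulerTerm X (j +ℕ r) * eulerTerm Y j ≈ thetaTerm X r * durfeeTerm r j
  euler-diagonal {X} {Y} XY≈Q j r = begin
    X ^ (j +ℕ r) * Q ^ tri (j +ℕ r) * rP (j +ℕ r) * (Y ^ j * Q ^ tri j * rP j)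
      ≈⟨ *-congʳ (*-congʳ (*-cong (^-homo-* X j r) Q-split)) ⟩
    X ^ j * X ^ r * (Q ^ tri j * Q ^ tri r * Q ^ (j *ℕ r)) * rP (j +ℕ r) * (Y ^ j * Q ^ tri j * rP j)
      ≈⟨ solve 8 (λ a b c d e f g h → a :* b :* (c :* d :* e) :* f :* (g :* c :* h) := b :* d :* (c :* c :* (a :* g) :* e :* h :* f)) refl
          (X ^ j) (X ^ r) (Q ^ tri j) (Q ^ tri r) (Q ^ (j *ℕ r)) (rP (j +ℕ r)) (Y ^ j) (rP j) ⟩
    X ^ r * Q ^ tri r * (Q ^ tri j * Q ^ tri j * (X ^ j * Y ^ j) * Q ^ (j *ℕ r) * rP j * rP (j +ℕ r))
      ≈⟨ *-congˡ (*-congʳ (*-congʳ Q-join)) ⟩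
    thetaTerm X r * durfeeTerm r j ∎
    where
    open ≈-Reasoning
    Q-split : Q ^ tri (j +ℕ r) ≈ Q ^ tri j * Q ^ tri r * Q ^ (j *ℕ r)
    Q-split = trans (^-congʳ Q (tri-+ j r)) (trans (^-homo-* Q (tri j +ℕ tri r) (j *ℕ r)) (*-congʳ (^-homo-* Q (tri j) (tri r))))
    Q-join : Q ^ tri j * Q ^ tri j * (X ^ j * Y ^ j) * Q ^ (j *ℕ r) ≈ Q ^ (j *ℕ j +ℕ r *ℕ j)
    Q-join = begin
      Q ^ tri j * Q ^ tri j * (X ^ j * Y ^ j) * Q ^ (j *ℕ r)
        ≈⟨ *-cong (*-cong (^-homo-* Q (tri j) (tri j)) (trans (sym (^-congˡ j XY≈Q)) (^-distrib-* X Y j))) (^-congʳ Q (ℕₚ.*-comm r j)) ⟨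
      Q ^ (tri j +ℕ tri j) * Q ^ j * Q ^ (r *ℕ j)
        ≈⟨ *-congʳ (^-homo-* Q (tri j +ℕ tri j) j) ⟨
      Q ^ (tri j +ℕ tri j +ℕ j) * Q ^ (r *ℕ j)
        ≈⟨ ^-homo-* Q (tri j +ℕ tri j +ℕ j) (r *ℕ j) ⟨
      Q ^ (tri j +ℕ tri j +ℕ j +ℕ r *ℕ j)
        ≈⟨ ^-congʳ Q (≡.cong (_+ℕ r *ℕ j) (tri+tri+n j)) ⟩
      Q ^ (j *ℕ j +ℕ r *ℕ j) ∎

  -- The right side is the bilateral series of X^r Q^{r(r-1)/2} over all integers r. The term at -r
  -- would contain negative powers of X; by XY = Q it equals Y^r Q^{r(r-1)/2}, which gives the
  -- second sum.
  jacobi : ∀ {X Y} → 𝔪 X → 𝔪 Y → X * Y ≈ Q → ⟨ - X ∣ Q ⟩∞ * ⟨ - Y ∣ Q ⟩∞ * P∞ ≈ Σ∞ (thetaTerm X) + Σ∞ (thetaTerm Y ∘ suc)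
  jacobi {X} {Y} X∈𝔪 Y∈𝔪 XY≈Q = begin
    ⟨ - X ∣ Q ⟩∞ * ⟨ - Y ∣ Q ⟩∞ * P∞
      ≈⟨ *-congʳ (*-cong (euler X∈𝔪) (euler Y∈𝔪)) ⟩
    Σ∞ (eulerTerm X) * Σ∞ (eulerTerm Y) * P∞
      ≈⟨ *-congʳ (Σ∞-*-Σ∞ (euler-summable X∈𝔪) (euler-summable Y∈𝔪)) ⟩
    Σ∞ (λ i → Σ∞ (λ j → eulerTerm X i * eulerTerm Y j)) * P∞
      ≈⟨ *-congʳ (Σ∞-diagonals ((λ i j → *-orderˡ _ (euler-summable X∈𝔪 i)) , (λ i j → *-orderʳ _ (euler-summable Y∈𝔪 j)))) ⟩
    Σ∞ (diagonal (λ i j → eulerTerm X i * eulerTerm Y j)) * P∞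
      ≈⟨ *-congʳ (Σ∞-cong (λ j → +-cong (Σ∞-cong (euler-diagonal XY≈Q j)) (Σ∞-cong (λ r → trans (*-comm _ _) (euler-diagonal (trans (*-comm Y X) XY≈Q) j (suc r)))))) ⟩
    Σ∞ (λ j → Σ∞ (λ r → thetaTerm X r * durfeeTerm r j) + Σ∞ (λ r → thetaTerm Y (suc r) * durfeeTerm (suc r) j)) * P∞
      ≈⟨ *-congʳ (Σ∞-+ (summable-rows (transpose (summable₂ (theta-summable X∈𝔪) (λ r → r)))) (summable-rows (transpose (summable₂ (summable-suc (theta-summable Y∈𝔪)) suc)))) ⟩
    (Σ∞ (λ j → Σ∞ (λ r → thetaTerm X r * durfeeTerm r j)) + Σ∞ (λ j → Σ∞ (λ r → thetaTerm Y (suc r) * durfeeTerm (suc r) j))) * P∞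
      ≈⟨ *-congʳ (+-cong (collect (theta-summable X∈𝔪) (λ r → r)) (collect (summable-suc (theta-summable Y∈𝔪)) suc)) ⟩
    (rP∞ * Σ∞ (thetaTerm X) + rP∞ * Σ∞ (thetaTerm Y ∘ suc)) * P∞
      ≈⟨ solve 4 (λ i a b p → (i :* a :+ i :* b) :* p := p :* i :* (a :+ b)) refl rP∞ (Σ∞ (thetaTerm X)) (Σ∞ (thetaTerm Y ∘ suc)) P∞ ⟩
    P∞ * rP∞ * (Σ∞ (thetaTerm X) + Σ∞ (thetaTerm Y ∘ suc))
      ≈⟨ trans (*-congʳ (*-inverseʳ P∞-unit)) (*-identityˡ _) ⟩
    Σ∞ (thetaTerm X) + Σ∞ (thetaTerm Y ∘ suc) ∎
    where
    open ≈-Reasoning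
    summable₂ : ∀ {t} → Summable t → (c : ℕ → ℕ) → Summable₂ (λ r j → t r * durfeeTerm (c r) j)
    summable₂ s c = (λ r j → *-orderˡ _ (s r)) , (λ r j → *-orderʳ _ (durfee-summable (c r) j))
    collect : ∀ {t} → Summable t → (c : ℕ → ℕ) → Σ∞ (λ j → Σ∞ (λ r → t r * durfeeTerm (c r) j)) ≈ rP∞ * Σ∞ t
    collect {t} s c = begin
      Σ∞ (λ j → Σ∞ (λ r → t r * durfeeTerm (c r) j))  ≈⟨ Σ∞-swap (transpose (summable₂ s c)) ⟩
      Σ∞ (λ r → Σ∞ (λ j → t r * durfeeTerm (c r) j))  ≈⟨ Σ∞-cong (λ r → Σ∞-* (t r) (durfee-summable (c r))) ⟨
      Σ∞ (λ r → t r * D (c r))                        ≈⟨ Σ∞-cong (λ r → trans (*-comm _ _) (*-congʳ (durfee (c r)))) ⟩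
      Σ∞ (λ r → rP∞ * t r)                            ≈⟨ Σ∞-* rP∞ s ⟨
      rP∞ * Σ∞ t                                      ∎

  -- Partial fractions of 1/((x;Q)_{n+1} (y;Q)_{n+1}) for xy = Q

  weight : ℕ → ℕ → PS
  weight n r = σ r * (1# - Q ^ suc (r +ℕ r)) * rPd n r * rP (suc (n +ℕ r))

  -- The equation Q^n = Q^r Q^{n-r} fails for the truncated difference when n < r; the factor
  -- `rPd n r`, zero in that range, makes it hold for all r and saves case distinctions below.
  Q^-absorb : ∀ n r → Q ^ n * rPd n r ≈ Q ^ r * Q ^ (n ∸ r) * rPd n r
  Q^-absorb n       zero    = *-congʳ (sym (*-identityˡ _))
  Q^-absorb zero    (suc r) = trans (zeroʳ _) (sym (zeroʳ _))
  Q^-absorb (suc n) (suc r) = begin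
    Q * Q ^ n * rPd n r                     ≈⟨ *-assoc _ _ _ ⟩
    Q * (Q ^ n * rPd n r)                   ≈⟨ *-congˡ (Q^-absorb n r) ⟩
    Q * (Q ^ r * Q ^ (n ∸ r) * rPd n r)     ≈⟨ solve 4 (λ q a b c → q :* (a :* b :* c) := q :* a :* b :* c) refl Q (Q ^ r) _ _ ⟩
    Q * Q ^ r * Q ^ (n ∸ r) * rPd n r       ∎
    where open ≈-Reasoning

  -- Indefinite summation: the partial sums have a closed form, checked by induction on R. The
  -- factor 1 - Q^{k+1} lets this form carry `rPd k`, which vanishes once R exceeds k and so ends
  -- the sum.
  weight-telescope : ∀ k R → (1# - Q ^ suc k) * Σ< (suc R) (λ r → Q ^ tri r * weight (suc k) r)
                           ≈ σ R * Q ^ tri (suc R) * (1# - Q ^ suc R) * rPd k R * rP (suc (suc k +ℕ R))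
  weight-telescope k zero = begin
    (1# - Q ^ suc k) * (0# + 1# * (1# * (1# - Q ^ 1) * rP (suc k) * z))
      ≈⟨ solve 4 (λ a b p z → a :* (con 0ℤ :+ con 1ℤ :* (con 1ℤ :* b :* p :* z)) := con 1ℤ :* con 1ℤ :* b :* (a :* p) :* z) refl (1# - Q ^ suc k) (1# - Q ^ 1) (rP (suc k)) z ⟩
    1# * 1# * (1# - Q ^ 1) * ((1# - Q ^ suc k) * rP (suc k)) * z
      ≈⟨ *-congʳ (*-congˡ (rP-suc k)) ⟩
    1# * 1# * (1# - Q ^ 1) * rP k * z ∎
    where
    open ≈-Reasoning
    z = rP (suc (suc k +ℕ 0))
  weight-telescope k (suc R) = begin
    (1# - Q * W) * (S + T * (- 1# * s * (1# - Q ^ suc (suc R +ℕ suc R)) * d * z))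
      ≈⟨ distribˡ _ _ _ ⟩
    (1# - Q * W) * S + (1# - Q * W) * (T * (- 1# * s * (1# - Q ^ suc (suc R +ℕ suc R)) * d * z))
      ≈⟨ +-cong (weight-telescope k R) (*-congˡ (*-congˡ (*-congʳ (*-congʳ (*-congˡ (+-congˡ (-‿cong Q-double))))))) ⟩
    s * T * (1# - Q * B) * d * rP (suc (suc k +ℕ R)) + (1# - Q * W) * (T * (- 1# * s * (1# - Q * (Q * B) * (Q * B)) * d * z))
      ≈⟨ +-congʳ (*-congˡ rP-step) ⟩
    s * T * (1# - Q * B) * d * ((1# - W * (Q * B) * Q * Q) * z) + (1# - Q * W) * (T * (- 1# * s * (1# - Q * (Q * B) * (Q * B)) * d * z))
      ≈⟨ solve 7 (λ q W s T b d z →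
           s :* T :* (con 1ℤ :- q :* b) :* d :* ((con 1ℤ :- W :* (q :* b) :* q :* q) :* z) :+ (con 1ℤ :- q :* W) :* (T :* (:- con 1ℤ :* s :* (con 1ℤ :- q :* (q :* b) :* (q :* b)) :* d :* z))
           := s :* T :* z :* ((con 1ℤ :- q :* b) :* (d :- W :* d :* (q :* b) :* q :* q) :- (d :- q :* (W :* d)) :* (con 1ℤ :- q :* (q :* b) :* (q :* b))))
         refl Q W s T B d z ⟩
    s * T * z * ((1# - Q * B) * (d - W * d * (Q * B) * Q * Q) - (d - Q * (W * d)) * (1# - Q * (Q * B) * (Q * B)))
      ≈⟨ *-congˡ (+-cong (*-congˡ (+-congˡ (-‿cong (*-congʳ (*-congʳ (*-congʳ absorb)))))) (-‿cong (*-congʳ (+-congˡ (-‿cong (*-congˡ absorb)))))) ⟩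
    s * T * z * ((1# - Q * B) * (d - B * Z * d * (Q * B) * Q * Q) - (d - Q * (B * Z * d)) * (1# - Q * (Q * B) * (Q * B)))
      -- The bracket factors by (1 - a)(1 - cZ) - (1 - aZ)(1 - c) = (c - a)(1 - Z) with a = Q^{R+1}
      -- and c = Q^{2R+3}.
      ≈⟨ solve 7 (λ q s T b d z Z →
           s :* T :* z :* ((con 1ℤ :- q :* b) :* (d :- b :* Z :* d :* (q :* b) :* q :* q) :- (d :- q :* (b :* Z :* d)) :* (con 1ℤ :- q :* (q :* b) :* (q :* b)))
           := :- con 1ℤ :* s :* (T :* (q :* b)) :* (con 1ℤ :- q :* (q :* b)) :* ((con 1ℤ :- Z) :* d) :* z)
         refl Q s T B d z Z ⟩
    - 1# * s * (T * (Q * B)) * (1# - Q * (Q * B)) * ((1# - Z) * d) * z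
      ≈⟨ *-congʳ (*-cong (*-congʳ (*-congˡ (sym (^-homo-* Q (tri (suc R)) (suc R))))) (rPd-suc k (suc R))) ⟩
    - 1# * s * Q ^ tri (suc (suc R)) * (1# - Q ^ suc (suc R)) * rPd k (suc R) * z ∎
    where
    open ≈-Reasoning
    S = Σ< (suc R) (λ r → Q ^ tri r * weight (suc k) r)
    T = Q ^ tri (suc R)
    W = Q ^ k
    B = Q ^ R
    Z = Q ^ (k ∸ R)
    d = rPd k R
    s = σ R
    z = rP (suc (suc k +ℕ suc R))
    absorb : W * d ≈ B * Z * d
    absorb = Q^-absorb k R
    Q-double : Q ^ suc (suc R +ℕ suc R) ≈ Q * (Q * B) * (Q * B)
    Q-double = trans (*-congˡ (^-homo-* Q (suc R) (suc R))) (sym (*-assoc Q _ _))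
    exponent : ∀ k R → suc (suc (suc k +ℕ R)) ≡ k +ℕ suc R +ℕ 1 +ℕ 1
    exponent = solve-∀
    Q-step : Q ^ suc (suc (suc k +ℕ R)) ≈ W * (Q * B) * Q * Q
    Q-step = trans (^-congʳ Q (exponent k R)) (trans (^-homo-* Q (k +ℕ suc R +ℕ 1) 1)
      (*-cong (trans (^-homo-* Q (k +ℕ suc R) 1) (*-cong (^-homo-* Q k (suc R)) (*-identityʳ Q))) (*-identityʳ Q)))
    rP-step : rP (suc (suc k +ℕ R)) ≈ (1# - W * (Q * B) * Q * Q) * z
    rP-step = trans (sym (rP-suc (suc (suc k +ℕ R)))) (*-cong (+-congˡ (-‿cong Q-step)) (Ring.reflexive (≡.cong (rP ∘ suc) (≡.sym (ℕₚ.+-suc (suc k) R)))))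

  -- This removes the remainder in the recursion of the partial fractions. Regarded as a function of
  -- s = x + y with xy = Q fixed, the reciprocal of n + 1 linear factors decays like 1/s^{n+1}; for
  -- n ≥ 1 its coefficient of 1/s at infinity therefore vanishes, and that coefficient is the
  -- present sum up to sign. The index `suc k` expresses n ≥ 1.
  weight-sum : ∀ k → Σ< (suc (suc k)) (λ r → Q ^ tri r * weight (suc k) r) ≈ 0#
  weight-sum k = *-cancelˡ (1-𝔪 (^-order-suc k Q∈𝔪)) (begin
    (1# - Q ^ suc k) * Σ< (suc (suc k)) (λ r → Q ^ tri r * weight (suc k) r)  ≈⟨ weight-telescope k (suc k) ⟩
    c * rPd k (suc k) * z                                                     ≈⟨ *-congʳ (*-congˡ (rPd-> {k} ℕₚ.≤-refl)) ⟩
    c * 0# * z                                                                ≈⟨ solve 3 (λ c z a → c :* con 0ℤ :* z := a :* con 0ℤ) refl c z (1# - Q ^ suc k) ⟩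
    (1# - Q ^ suc k) * 0#                                                     ∎)
    where
    open ≈-Reasoning
    c = σ (suc k) * Q ^ tri (suc (suc k)) * (1# - Q ^ suc (suc k))
    z = rP (suc (suc k +ℕ suc k))

  module _ {x y} (x∈𝔪 : 𝔪 x) (y∈𝔪 : 𝔪 y) (xy≈Q : x * y ≈ Q) where

    L K : ℕ → PS
    L r = (1# - x * Q ^ r) * (1# - y * Q ^ r)
    K r = iv (L r)

    L-unit : ∀ r → Unit (L r)
    L-unit r = *-unit (poch-factor-unit x∈𝔪 Q∈𝔪 r) (poch-factor-unit y∈𝔪 Q∈𝔪 r)

    -- Since xy = Q, `L r` is 1 - (x+y) Q^r + Q^{2r+1}, linear in x + y, so the product of `L 0`,
    -- ..., `L n` has simple zeros in x + y. The coefficient of `K r` is the reciprocal of the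
    -- product of the other factors at the zero x = 1/Q^r, y = Q^{r+1}; that is where the sign, 1 -
    -- Q^{2r+1} and the two denominators come from. The expansion itself is proved by induction on
    -- n.
    partialFraction : ℕ → ℕ → PS
    partialFraction n r = Q ^ tri (suc r) * weight n r * K r

    -- Both `L n` and `L r` are linear in x + y, so subtracting Q^{n-r} `L r` from `L n` leaves a
    -- term free of x + y, which factors. The common factor `rPd n r` covers n < r.
    L-split : ∀ n r → L n * rPd n r ≈ (Q ^ (n ∸ r) * L r + (1# - Q ^ (n ∸ r)) * (1# - Q ^ suc (n +ℕ r))) * rPd n r
    L-split n r = begin
      (1# - x * N) * (1# - y * N) * d
        ≈⟨ solve 4 (λ x y n d → (con 1ℤ :- x :* n) :* (con 1ℤ :- y :* n) :* d := d :- (x :+ y) :* (n :* d) :+ x :* y :* n :* (n :* d)) refl x y N d ⟩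
      d - (x + y) * (N * d) + x * y * N * (N * d)
        ≈⟨ +-cong (+-congˡ (-‿cong (*-congˡ absorb))) (*-cong (*-congʳ xy≈Q) absorb) ⟩
      d - (x + y) * (B * Z * d) + Q * N * (B * Z * d)
        ≈⟨ solve 7 (λ x y n d b z q → d :- (x :+ y) :* (b :* z :* d) :+ q :* n :* (b :* z :* d)
             := (con 1ℤ :- (x :+ y) :* (b :* z)) :* d :+ q :* b :* z :* (n :* d)) refl x y N d B Z Q ⟩
      (1# - (x + y) * (B * Z)) * d + Q * B * Z * (N * d)
        ≈⟨ solve 7 (λ x y n d b z q → (con 1ℤ :- (x :+ y) :* (b :* z)) :* d :+ q :* b :* z :* (n :* d)
             := (con 1ℤ :- (x :+ y) :* (b :* z) :- q :* b) :* d :+ q :* b :* d :+ q :* b :* z :* (n :* d)) refl x y N d B Z Q ⟩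
      (1# - (x + y) * (B * Z) - Q * B) * d + Q * B * d + Q * B * Z * (N * d)
        ≈⟨ solve 7 (λ x y n d b z q → (con 1ℤ :- (x :+ y) :* (b :* z) :- q :* b) :* d :+ q :* b :* d :+ q :* b :* z :* (n :* d)
             := (z :* (con 1ℤ :- (x :+ y) :* b :+ q :* b :* b) :+ (con 1ℤ :- z) :* (con 1ℤ :- q :* (n :* b))) :* d
                :+ q :* b :* (n :* d :- b :* z :* d)) refl x y N d B Z Q ⟩
      (Z * (1# - (x + y) * B + Q * B * B) + (1# - Z) * (1# - Q * (N * B))) * d + Q * B * (N * d - B * Z * d)
        ≈⟨ +-cong (*-congʳ (+-cong (*-congˡ (+-congˡ (*-congʳ (*-congʳ (sym xy≈Q))))) (*-congˡ (+-congˡ (-‿cong (*-congˡ (sym (^-homo-* Q n r)))))))) (*-congˡ (≈⇒-≈0 absorb)) ⟩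
      (Z * (1# - (x + y) * B + x * y * B * B) + (1# - Z) * (1# - Q * Q ^ (n +ℕ r))) * d + Q * B * 0#
        ≈⟨ solve 7 (λ x y b z w d q → (z :* (con 1ℤ :- (x :+ y) :* b :+ x :* y :* b :* b) :+ (con 1ℤ :- z) :* w) :* d :+ q :* b :* con 0ℤ
             := (z :* ((con 1ℤ :- x :* b) :* (con 1ℤ :- y :* b)) :+ (con 1ℤ :- z) :* w) :* d) refl x y B Z (1# - Q * Q ^ (n +ℕ r)) d Q ⟩
      (Z * L r + (1# - Z) * (1# - Q ^ suc (n +ℕ r))) * d ∎
      where
      open ≈-Reasoning
      N = Q ^ n
      B = Q ^ r
      Z = Q ^ (n ∸ r)
      d = rPd n r
      absorb : N * d ≈ B * Z * d
      absorb = Q^-absorb n r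

    -- In the first part of `L-split` the factor `L r` cancels `K r` and leaves a multiple of the
    -- summand of `weight-sum`, which disappears on summation. In the second part the factors 1 -
    -- Q^{n+1-r} and 1 - Q^{n+r+2} lower the two denominators from n + 1 to n.
    partialFraction-step : ∀ n r → L (suc n) * partialFraction (suc n) r ≈ Q ^ suc n * (Q ^ tri r * weight (suc n) r) + partialFraction n r
    partialFraction-step n r = begin
      l * (Q ^ tri (suc r) * (s * d * p) * K r)
        ≈⟨ solve 6 (λ l t s d p k → l :* (t :* (s :* d :* p) :* k) := t :* s :* p :* k :* (l :* d)) refl l (Q ^ tri (suc r)) s d p (K r) ⟩
      Q ^ tri (suc r) * s * p * K r * (l * d)
        ≈⟨ *-congˡ (L-split (suc n) r) ⟩
      Q ^ tri (suc r) * s * p * K r * ((Z * L r + (1# - Z) * e) * d)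
        ≈⟨ solve 8 (λ t s p k z l e d → t :* s :* p :* k :* ((z :* l :+ (con 1ℤ :- z) :* e) :* d)
             := t :* s :* p :* (z :* d) :* (l :* k) :+ t :* (s :* ((con 1ℤ :- z) :* d) :* (e :* p)) :* k)
           refl (Q ^ tri (suc r)) s p (K r) Z (L r) e d ⟩
      Q ^ tri (suc r) * s * p * (Z * d) * (L r * K r) + Q ^ tri (suc r) * (s * ((1# - Z) * d) * (e * p)) * K r
        ≈⟨ +-cong (*-cong (*-congʳ (*-congʳ (*-congʳ (^-homo-* Q (tri r) r)))) (*-inverseʳ (L-unit r)))
                  (*-congʳ (*-congˡ (*-cong (*-congˡ (rPd-suc n r)) (rP-suc (suc n +ℕ r))))) ⟩
      Q ^ tri r * Q ^ r * s * p * (Z * d) * 1# + partialFraction n r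
        ≈⟨ +-congʳ (solve 6 (λ t b s p z d → t :* b :* s :* p :* (z :* d) :* con 1ℤ := t :* s :* p :* (b :* z :* d)) refl (Q ^ tri r) (Q ^ r) s p Z d) ⟩
      Q ^ tri r * s * p * (Q ^ r * Z * d) + partialFraction n r
        ≈⟨ +-congʳ (*-congˡ (Q^-absorb (suc n) r)) ⟨
      Q ^ tri r * s * p * (Q ^ suc n * d) + partialFraction n r
        ≈⟨ +-congʳ (solve 5 (λ t s p n d → t :* s :* p :* (n :* d) := n :* (t :* (s :* d :* p))) refl (Q ^ tri r) s p (Q ^ suc n) d) ⟩
      Q ^ suc n * (Q ^ tri r * weight (suc n) r) + partialFraction n r ∎
      where
      open ≈-Reasoning
      l = L (suc n)
      s = σ r * (1# - Q ^ suc (r +ℕ r))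
      d = rPd (suc n) r
      p = rP (suc (suc n +ℕ r))
      Z = Q ^ (suc n ∸ r)
      e = 1# - Q ^ suc (suc n +ℕ r)

    weight-> : ∀ {n r} → n < r → weight n r ≈ 0#
    weight-> {n} {r} h = trans (*-congʳ (*-congˡ (rPd-> h))) (solve 2 (λ a b → a :* con 0ℤ :* b := con 0ℤ) refl _ (rP (suc (n +ℕ r))))

    partialFraction-> : ∀ {n r} → n < r → partialFraction n r ≈ 0#
    partialFraction-> {n} {r} h = trans (*-congʳ (*-congˡ (weight-> h))) (solve 2 (λ a b → a :* con 0ℤ :* b := con 0ℤ) refl _ (K r))

    partialFractions-step : ∀ n → L (suc n) * Σ< (suc (suc n)) (partialFraction (suc n)) ≈ Σ< (suc n) (partialFraction n)
    partialFractions-step n = begin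
      L (suc n) * Σ< (suc (suc n)) (partialFraction (suc n))
        ≈⟨ Σ<-* (L (suc n)) _ (suc (suc n)) ⟩
      Σ< (suc (suc n)) (λ r → L (suc n) * partialFraction (suc n) r)
        ≈⟨ Σ<-cong (suc (suc n)) (partialFraction-step n) ⟩
      Σ< (suc (suc n)) (λ r → Q ^ suc n * (Q ^ tri r * weight (suc n) r) + partialFraction n r)
        ≈⟨ Σ<-+ _ (partialFraction n) (suc (suc n)) ⟩
      Σ< (suc (suc n)) (λ r → Q ^ suc n * (Q ^ tri r * weight (suc n) r)) + (Σ< (suc n) (partialFraction n) + partialFraction n (suc n))
        ≈⟨ +-cong (trans (sym (Σ<-* (Q ^ suc n) _ (suc (suc n)))) (*-congˡ (weight-sum n))) (+-congˡ (partialFraction-> {n} ℕₚ.≤-refl)) ⟩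
      Q ^ suc n * 0# + (Σ< (suc n) (partialFraction n) + 0#)
        ≈⟨ solve 2 (λ a b → a :* con 0ℤ :+ (b :+ con 0ℤ) := b) refl (Q ^ suc n) _ ⟩
      Σ< (suc n) (partialFraction n) ∎
      where open ≈-Reasoning

    denominator : ℕ → PS
    denominator n = (⟨ x ∣ Q ⟩ suc n) * (⟨ y ∣ Q ⟩ suc n)

    denominator-unit : ∀ n → Unit (denominator n)
    denominator-unit n = *-unit (poch-unit x∈𝔪 Q∈𝔪 (suc n)) (poch-unit y∈𝔪 Q∈𝔪 (suc n))

    partialFractions-inverse : ∀ n → denominator n * Σ< (suc n) (partialFraction n) ≈ 1#
    partialFractions-inverse zero = begin
      1# * (1# - x * 1#) * (1# * (1# - y * 1#)) * (0# + 1# * (1# * (1# - Q ^ 1) * rP 0 * rP 1) * K 0)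
        ≈⟨ solve 6 (λ x y q p r k → con 1ℤ :* (con 1ℤ :- x :* con 1ℤ) :* (con 1ℤ :* (con 1ℤ :- y :* con 1ℤ)) :* (con 0ℤ :+ con 1ℤ :* (con 1ℤ :* q :* p :* r) :* k)
             := (con 1ℤ :- x :* con 1ℤ) :* (con 1ℤ :- y :* con 1ℤ) :* k :* p :* (q :* r)) refl x y (1# - Q ^ 1) (rP 0) (rP 1) (K 0) ⟩
      L 0 * K 0 * rP 0 * ((1# - Q ^ 1) * rP 1)
        ≈⟨ *-cong (*-cong (*-inverseʳ (L-unit 0)) rP-zero) (trans (rP-suc 0) rP-zero) ⟩
      1# * 1# * 1#
        ≈⟨ solve 0 (con 1ℤ :* con 1ℤ :* con 1ℤ := con 1ℤ) refl ⟩
      1# ∎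
      where open ≈-Reasoning
    partialFractions-inverse (suc n) = begin
      (⟨ x ∣ Q ⟩ suc n) * (1# - x * Q ^ suc n) * ((⟨ y ∣ Q ⟩ suc n) * (1# - y * Q ^ suc n)) * b
        ≈⟨ solve 5 (λ p a r c b → p :* a :* (r :* c) :* b := p :* r :* (a :* c :* b)) refl
             (⟨ x ∣ Q ⟩ suc n) (1# - x * Q ^ suc n) (⟨ y ∣ Q ⟩ suc n) (1# - y * Q ^ suc n) b ⟩
      denominator n * (L (suc n) * b)
        ≈⟨ *-congˡ (partialFractions-step n) ⟩
      denominator n * Σ< (suc n) (partialFraction n)
        ≈⟨ partialFractions-inverse n ⟩
      1# ∎
      where
      open ≈-Reasoning
      b = Σ< (suc (suc n)) (partialFraction (suc n))

    partialFractions : ∀ n → iv (denominator n) ≈ Σ< (suc n) (partialFraction n)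
    partialFractions n = sym (iv-unique (denominator-unit n) (partialFractions-inverse n))

    lambertTerm : ℕ → PS
    lambertTerm r = Q ^ tri (suc r) * (σ r * (1# - Q ^ suc (r +ℕ r))) * K r

    lambert-summable : Summable lambertTerm
    lambert-summable r = *-orderˡ _ (*-orderˡ _ (^-order-≥ Q∈𝔪 (ℕₚ.m≤n+m r (tri r))))

    partialFraction≈lambert : ∀ n r → partialFraction n r ≈ lambertTerm r * (rPd n r * rP (suc (n +ℕ r)))
    partialFraction≈lambert n r = solve 5 (λ t s d p k → t :* (s :* d :* p) :* k := t :* s :* k :* (d :* p)) refl
      (Q ^ tri (suc r)) (σ r * (1# - Q ^ suc (r +ℕ r))) (rPd n r) (rP (suc (n +ℕ r))) (K r)

    -- The termwise limit is not uniform in r: `rPd n r` agrees with 1/(Q;Q)∞ only below n - r. The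
    -- order r of `lambertTerm r` makes up for the missing places, so all terms are correct below n.
    reciprocal-limit : ∀ n → iv (⟨ x ∣ Q ⟩∞ * ⟨ y ∣ Q ⟩∞) ≈[ n ] (rP∞ * rP∞) * Σ∞ lambertTerm
    reciprocal-limit n = begin
      iv (⟨ x ∣ Q ⟩∞ * ⟨ y ∣ Q ⟩∞)
        ≈⟨ iv-cong[] (*-unit (poch∞-unit x∈𝔪 Q∈𝔪) (poch∞-unit y∈𝔪 Q∈𝔪)) (denominator-unit n)
             (weaken (ℕₚ.n≤1+n n) (*-cong[] (poch∞≈[]′ x∈𝔪 Q∈𝔪 (suc n)) (poch∞≈[]′ y∈𝔪 Q∈𝔪 (suc n)))) ⟩
      iv (denominator n)
        ≈⟨ ≈⇒≈[] (partialFractions n) ⟩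
      Σ< (suc n) (partialFraction n)
        ≈⟨ ≈⇒≈[] (Σ<-cong (suc n) (partialFraction≈lambert n)) ⟩
      Σ< (suc n) (λ r → lambertTerm r * (rPd n r * rP (suc (n +ℕ r))))
        ≈⟨ Σ<-cong[] (suc n) (λ r → *-cong[]-order (lambert-summable r)
             (*-cong[] (rPd≈[] n r) (weaken (ℕₚ.≤-trans (ℕₚ.m∸n≤m n r) (ℕₚ.≤-trans (ℕₚ.m≤m+n n r) (ℕₚ.n≤1+n _))) (rP≈[] (suc (n +ℕ r)))))) ⟩
      Σ< (suc n) (λ r → lambertTerm r * (rP∞ * rP∞))
        ≈⟨ ≈⇒≈[] (trans (Σ<-cong (suc n) (λ r → *-comm _ _)) (sym (Σ<-* (rP∞ * rP∞) lambertTerm (suc n)))) ⟩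
      (rP∞ * rP∞) * Σ< (suc n) lambertTerm
        ≈⟨ *-cong[] Mod.refl (weaken (ℕₚ.n≤1+n n) (Σ∞≈[]Σ< lambert-summable (suc n))) ⟨
      (rP∞ * rP∞) * Σ∞ lambertTerm ∎
      where open ≈[]-Reasoning n

    theta-reciprocal : P∞ * P∞ * iv (⟨ x ∣ Q ⟩∞ * ⟨ y ∣ Q ⟩∞) ≈ Σ∞ lambertTerm
    theta-reciprocal = begin
      P∞ * P∞ * iv (⟨ x ∣ Q ⟩∞ * ⟨ y ∣ Q ⟩∞)      ≈⟨ *-congˡ (≈[]⇒≈ reciprocal-limit) ⟩
      P∞ * P∞ * ((rP∞ * rP∞) * Σ∞ lambertTerm)    ≈⟨ solve 3 (λ p r s → p :* p :* ((r :* r) :* s) := (p :* r) :* (p :* r) :* s) refl P∞ rP∞ (Σ∞ lambertTerm) ⟩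
      (P∞ * rP∞) * (P∞ * rP∞) * Σ∞ lambertTerm    ≈⟨ *-congʳ (*-cong (*-inverseʳ P∞-unit) (*-inverseʳ P∞-unit)) ⟩
      1# * 1# * Σ∞ lambertTerm                    ≈⟨ solve 1 (λ s → con 1ℤ :* con 1ℤ :* s := s) refl (Σ∞ lambertTerm) ⟩
      Σ∞ lambertTerm                              ∎
      where
      open ≈-Reasoning

    -- Bailey's lemma: insert the partial fractions, exchange the sums, apply Durfee.
    watson : Σ∞ (g₃Term x y Q) ≈ rP∞ * Σ∞ (λ r → Q ^ (r *ℕ r +ℕ r) * lambertTerm r)
    watson = begin
      Σ∞ (g₃Term x y Q)
        ≈⟨ Σ∞-cong expand ⟩
      Σ∞ (λ n → Σ∞ (g n))
        ≈⟨ Σ∞-swap summable₂ ⟩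
      Σ∞ (λ r → Σ∞ (λ n → g n r))
        ≈⟨ Σ∞-cong column ⟩
      Σ∞ (λ r → rP∞ * (Q ^ (r *ℕ r +ℕ r) * lambertTerm r))
        ≈⟨ Σ∞-* rP∞ (λ r → *-orderʳ _ (lambert-summable r)) ⟨
      rP∞ * Σ∞ (λ r → Q ^ (r *ℕ r +ℕ r) * lambertTerm r) ∎
      where
      open ≈-Reasoning
      g : ℕ → ℕ → PS
      g n r = Q ^ (n *ℕ n +ℕ n) * (lambertTerm r * (rPd n r * rP (suc (n +ℕ r))))

      summable₂ : Summable₂ g
      summable₂ = (λ n r → *-orderˡ _ (^-order-≥ Q∈𝔪 (ℕₚ.m≤n+m n (n *ℕ n)))) , (λ n r → *-orderʳ _ (*-orderˡ _ (lambert-summable r)))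

      lambert-summable′ : ∀ n → Summable (λ r → lambertTerm r * (rPd n r * rP (suc (n +ℕ r))))
      lambert-summable′ n r = *-orderˡ _ (lambert-summable r)

      expand : ∀ n → g₃Term x y Q n ≈ Σ∞ (g n)
      expand n = begin
        Q ^ (n *ℕ n +ℕ n) * iv (denominator n)
          ≈⟨ *-congˡ (trans (partialFractions n) (Σ<-cong (suc n) (partialFraction≈lambert n))) ⟩
        Q ^ (n *ℕ n +ℕ n) * Σ< (suc n) (λ r → lambertTerm r * (rPd n r * rP (suc (n +ℕ r))))
          ≈⟨ *-congˡ (Σ∞-finite (lambert-summable′ n) (suc n) (λ i → trans (*-congˡ (*-congʳ (rPd-> (s≤s (ℕₚ.m≤m+n n i))))) (solve 2 (λ a b → a :* (con 0ℤ :* b) := con 0ℤ) refl _ (rP (suc (n +ℕ (suc n +ℕ i))))))) ⟨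
        Q ^ (n *ℕ n +ℕ n) * Σ∞ (λ r → lambertTerm r * (rPd n r * rP (suc (n +ℕ r))))
          ≈⟨ Σ∞-* _ (lambert-summable′ n) ⟩
        Σ∞ (g n) ∎

      -- The terms with n < r vanish. For n = r + m the exponent n² + n is r² + r + m² + (2r+1)m,
      -- and the denominators are (Q;Q)_m and (Q;Q)_{m+2r+1}: a Durfee sum with c = 2r + 1.
      column : ∀ r → Σ∞ (λ n → g n r) ≈ rP∞ * (Q ^ (r *ℕ r +ℕ r) * lambertTerm r)
      column r = begin
        Σ∞ (λ n → g n r)
          ≈⟨ Σ∞-drop (λ n → Data.Product.proj₁ summable₂ n r) r (λ n h → trans (*-congˡ (*-congˡ (*-congʳ (rPd-> h)))) (solve 3 (λ a b c → a :* (b :* (con 0ℤ :* c)) := con 0ℤ) refl _ _ (rP (suc (n +ℕ r))))) ⟩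
        Σ∞ (λ m → g (r +ℕ m) r)
          ≈⟨ Σ∞-cong term ⟩
        Σ∞ (λ m → c * durfeeTerm (suc (r +ℕ r)) m)
          ≈⟨ Σ∞-* c (durfee-summable _) ⟨
        c * D (suc (r +ℕ r))
          ≈⟨ trans (*-congˡ (durfee _)) (*-comm _ _) ⟩
        rP∞ * c ∎
        where
        c = Q ^ (r *ℕ r +ℕ r) * lambertTerm r
        exponent : ∀ r m → (r +ℕ m) *ℕ (r +ℕ m) +ℕ (r +ℕ m) ≡ r *ℕ r +ℕ r +ℕ (m *ℕ m +ℕ suc (r +ℕ r) *ℕ m)
        exponent = solve-∀
        index : ∀ r m → suc (r +ℕ m +ℕ r) ≡ m +ℕ suc (r +ℕ r)
        index = solve-∀
        term : ∀ m → g (r +ℕ m) r ≈ c * durfeeTerm (suc (r +ℕ r)) m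
        term m = begin
          Q ^ ((r +ℕ m) *ℕ (r +ℕ m) +ℕ (r +ℕ m)) * (lambertTerm r * (rPd (r +ℕ m) r * rP (suc (r +ℕ m +ℕ r))))
            ≈⟨ *-cong (trans (^-congʳ Q (exponent r m)) (^-homo-* Q (r *ℕ r +ℕ r) _))
                      (*-congˡ (*-cong (rPd-+ r m) (Ring.reflexive (≡.cong rP (index r m))))) ⟩
          Q ^ (r *ℕ r +ℕ r) * V * (lambertTerm r * (rP m * rP (m +ℕ suc (r +ℕ r))))
            ≈⟨ solve 5 (λ a v l p s → a :* v :* (l :* (p :* s)) := a :* l :* (v :* p :* s)) refl (Q ^ (r *ℕ r +ℕ r)) V (lambertTerm r) (rP m) _ ⟩
          c * durfeeTerm (suc (r +ℕ r)) m ∎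
          where V = Q ^ (m *ℕ m +ℕ suc (r +ℕ r) *ℕ m)

    -- With u = x Q^r and v = y Q^r the numerator 1 - Q^{2r+1} is 1 - uv = (1 - v) + v(1 - u), so
    -- each part cancels one denominator.
    lambert-split : ∀ r → lambertTerm r ≈ σ r * Q ^ tri (suc r) * (iv (1# - x * Q ^ r) + y * Q ^ r * iv (1# - y * Q ^ r))
    lambert-split r = begin
      Q ^ tri (suc r) * (σ r * (1# - Q ^ suc (r +ℕ r))) * iv (U * V)
        ≈⟨ *-cong (*-congˡ (*-congˡ (+-congˡ (-‿cong uv)))) (iv-* U-unit V-unit) ⟩
      Q ^ tri (suc r) * (σ r * (1# - u * v)) * (iv U * iv V)
        ≈⟨ solve 6 (λ t s u v i j → t :* (s :* (con 1ℤ :- u :* v)) :* (i :* j)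
             := s :* t :* (i :* ((con 1ℤ :- v) :* j) :+ v :* j :* ((con 1ℤ :- u) :* i))) refl (Q ^ tri (suc r)) (σ r) u v (iv U) (iv V) ⟩
      σ r * Q ^ tri (suc r) * (iv U * (V * iv V) + v * iv V * (U * iv U))
        ≈⟨ *-congˡ (+-cong (*-congˡ (*-inverseʳ V-unit)) (*-congˡ (*-inverseʳ U-unit))) ⟩
      σ r * Q ^ tri (suc r) * (iv U * 1# + v * iv V * 1#)
        ≈⟨ *-congˡ (+-cong (*-identityʳ _) (*-identityʳ _)) ⟩
      σ r * Q ^ tri (suc r) * (iv U + v * iv V) ∎
      where
      open ≈-Reasoning
      u = x * Q ^ r
      v = y * Q ^ r
      U = 1# - u
      V = 1# - v
      U-unit : Unit U
      U-unit = poch-factor-unit x∈𝔪 Q∈𝔪 r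
      V-unit : Unit V
      V-unit = poch-factor-unit y∈𝔪 Q∈𝔪 r
      uv : Q ^ suc (r +ℕ r) ≈ u * v
      uv = trans (*-cong (sym xy≈Q) (^-homo-* Q r r)) (solve 3 (λ x y e → x :* y :* (e :* e) := x :* e :* (y :* e)) refl x y (Q ^ r))

-- Splitting infinite products

^-*-comm : ∀ (Q : PS) k n → Q ^ (n *ℕ k) ≈ (Q ^ k) ^ n
^-*-comm Q k n = trans (^-congʳ Q (ℕₚ.*-comm n k)) (sym (^-assocʳ Q k n))

poch-2 : ∀ u Q n → ⟨ u ∣ Q ⟩ (n *ℕ 2) ≈ (⟨ u ∣ Q ^ 2 ⟩ n) * (⟨ u * Q ∣ Q ^ 2 ⟩ n)
poch-2 u Q zero    = sym (*-identityˡ 1#)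
poch-2 u Q (suc n) = begin
  (⟨ u ∣ Q ⟩ (n *ℕ 2)) * (1# - u * Q ^ (n *ℕ 2)) * (1# - u * (Q * Q ^ (n *ℕ 2)))
    ≈⟨ *-cong (*-cong (poch-2 u Q n) (+-congˡ (-‿cong (*-congˡ (^-*-comm Q 2 n))))) (+-congˡ (-‿cong (*-congˡ (*-congˡ (^-*-comm Q 2 n))))) ⟩
  (⟨ u ∣ Q ^ 2 ⟩ n) * (⟨ u * Q ∣ Q ^ 2 ⟩ n) * (1# - u * (Q ^ 2) ^ n) * (1# - u * (Q * (Q ^ 2) ^ n))
    ≈⟨ solve 5 (λ a b u q e → a :* b :* (con 1ℤ :- u :* e) :* (con 1ℤ :- u :* (q :* e)) := a :* (con 1ℤ :- u :* e) :* (b :* (con 1ℤ :- u :* q :* e)))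
         refl (⟨ u ∣ Q ^ 2 ⟩ n) (⟨ u * Q ∣ Q ^ 2 ⟩ n) u Q ((Q ^ 2) ^ n) ⟩
  (⟨ u ∣ Q ^ 2 ⟩ suc n) * (⟨ u * Q ∣ Q ^ 2 ⟩ suc n) ∎
  where open ≈-Reasoning

poch-3 : ∀ u Q n → ⟨ u ∣ Q ⟩ (n *ℕ 3) ≈ (⟨ u ∣ Q ^ 3 ⟩ n) * (⟨ u * Q ∣ Q ^ 3 ⟩ n) * (⟨ u * Q ^ 2 ∣ Q ^ 3 ⟩ n)
poch-3 u Q zero    = solve 0 (con 1ℤ := con 1ℤ :* con 1ℤ :* con 1ℤ) refl
poch-3 u Q (suc n) = begin
  (⟨ u ∣ Q ⟩ (n *ℕ 3)) * (1# - u * Q ^ (n *ℕ 3)) * (1# - u * (Q * Q ^ (n *ℕ 3))) * (1# - u * (Q * (Q * Q ^ (n *ℕ 3))))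
    ≈⟨ *-cong (*-cong (*-cong (poch-3 u Q n) (+-congˡ (-‿cong (*-congˡ e)))) (+-congˡ (-‿cong (*-congˡ (*-congˡ e))))) (+-congˡ (-‿cong (*-congˡ (*-congˡ (*-congˡ e))))) ⟩
  A * B * C * (1# - u * E) * (1# - u * (Q * E)) * (1# - u * (Q * (Q * E)))
    ≈⟨ solve 6 (λ a b c u q e → a :* b :* c :* (con 1ℤ :- u :* e) :* (con 1ℤ :- u :* (q :* e)) :* (con 1ℤ :- u :* (q :* (q :* e)))
         := a :* (con 1ℤ :- u :* e) :* (b :* (con 1ℤ :- u :* q :* e)) :* (c :* (con 1ℤ :- u :* (q :^ 2) :* e)))
         refl A B C u Q E ⟩
  (⟨ u ∣ Q ^ 3 ⟩ suc n) * (⟨ u * Q ∣ Q ^ 3 ⟩ suc n) * (⟨ u * Q ^ 2 ∣ Q ^ 3 ⟩ suc n) ∎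
  where
  open ≈-Reasoning
  A = ⟨ u ∣ Q ^ 3 ⟩ n
  B = ⟨ u * Q ∣ Q ^ 3 ⟩ n
  C = ⟨ u * Q ^ 2 ∣ Q ^ 3 ⟩ n
  E = (Q ^ 3) ^ n
  e = ^-*-comm Q 3 n

poch-± : ∀ u Q n → (⟨ u ∣ Q ⟩ n) * (⟨ - u ∣ Q ⟩ n) ≈ ⟨ u ^ 2 ∣ Q ^ 2 ⟩ n
poch-± u Q zero    = *-identityˡ 1#
poch-± u Q (suc n) = begin
  a * (1# - u * E) * (b * (1# - - u * E))
    ≈⟨ solve 4 (λ a b u e → a :* (con 1ℤ :- u :* e) :* (b :* (con 1ℤ :- (:- u) :* e)) := a :* b :* (con 1ℤ :- u :^ 2 :* (e :* e))) refl a b u E ⟩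
  a * b * (1# - u ^ 2 * (E * E))
    ≈⟨ *-cong (poch-± u Q n) (+-congˡ (-‿cong (*-congˡ square))) ⟩
  (⟨ u ^ 2 ∣ Q ^ 2 ⟩ suc n) ∎
  where
  open ≈-Reasoning
  a = ⟨ u ∣ Q ⟩ n
  b = ⟨ - u ∣ Q ⟩ n
  E = Q ^ n
  square : E * E ≈ (Q ^ 2) ^ n
  square = trans (sym (^-distrib-* Q Q n)) (^-congˡ n (*-congˡ (sym (*-identityʳ Q))))

module _ {u Q} (u∈𝔪 : 𝔪 u) (Q∈𝔪 : 𝔪 Q) where

  poch∞-2 : ⟨ u ∣ Q ⟩∞ ≈ ⟨ u ∣ Q ^ 2 ⟩∞ * ⟨ u * Q ∣ Q ^ 2 ⟩∞
  poch∞-2 = ≈[]⇒≈ λ n → let open ≈[]-Reasoning n in begin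
    ⟨ u ∣ Q ⟩∞                                      ≈⟨ weaken (m≤m*[1+k] n 1) (poch∞≈[]′ u∈𝔪 Q∈𝔪 (n *ℕ 2)) ⟩
    (⟨ u ∣ Q ⟩ (n *ℕ 2))                            ≈⟨ ≈⇒≈[] (poch-2 u Q n) ⟩
    (⟨ u ∣ Q ^ 2 ⟩ n) * (⟨ u * Q ∣ Q ^ 2 ⟩ n)       ≈⟨ *-cong[] (poch∞≈[]′ u∈𝔪 Q²∈𝔪 n) (poch∞≈[]′ (*-orderˡ Q u∈𝔪) Q²∈𝔪 n) ⟨
    ⟨ u ∣ Q ^ 2 ⟩∞ * ⟨ u * Q ∣ Q ^ 2 ⟩∞             ∎
    where Q²∈𝔪 = ^-order-suc 1 Q∈𝔪

  poch∞-3 : ⟨ u ∣ Q ⟩∞ ≈ ⟨ u ∣ Q ^ 3 ⟩∞ * ⟨ u * Q ∣ Q ^ 3 ⟩∞ * ⟨ u * Q ^ 2 ∣ Q ^ 3 ⟩∞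
  poch∞-3 = ≈[]⇒≈ λ n → let open ≈[]-Reasoning n in begin
    ⟨ u ∣ Q ⟩∞
      ≈⟨ weaken (m≤m*[1+k] n 2) (poch∞≈[]′ u∈𝔪 Q∈𝔪 (n *ℕ 3)) ⟩
    (⟨ u ∣ Q ⟩ (n *ℕ 3))
      ≈⟨ ≈⇒≈[] (poch-3 u Q n) ⟩
    (⟨ u ∣ Q ^ 3 ⟩ n) * (⟨ u * Q ∣ Q ^ 3 ⟩ n) * (⟨ u * Q ^ 2 ∣ Q ^ 3 ⟩ n)
      ≈⟨ *-cong[] (*-cong[] (poch∞≈[]′ u∈𝔪 Q³∈𝔪 n) (poch∞≈[]′ (*-orderˡ _ u∈𝔪) Q³∈𝔪 n)) (poch∞≈[]′ (*-orderˡ _ u∈𝔪) Q³∈𝔪 n) ⟨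
    ⟨ u ∣ Q ^ 3 ⟩∞ * ⟨ u * Q ∣ Q ^ 3 ⟩∞ * ⟨ u * Q ^ 2 ∣ Q ^ 3 ⟩∞ ∎
    where Q³∈𝔪 = ^-order-suc 2 Q∈𝔪

  poch∞-± : ⟨ u ∣ Q ⟩∞ * ⟨ - u ∣ Q ⟩∞ ≈ ⟨ u ^ 2 ∣ Q ^ 2 ⟩∞
  poch∞-± = ≈[]⇒≈ λ n → let open ≈[]-Reasoning n in begin
    ⟨ u ∣ Q ⟩∞ * ⟨ - u ∣ Q ⟩∞          ≈⟨ *-cong[] (poch∞≈[]′ u∈𝔪 Q∈𝔪 n) (poch∞≈[]′ (-‿order u∈𝔪) Q∈𝔪 n) ⟩
    (⟨ u ∣ Q ⟩ n) * (⟨ - u ∣ Q ⟩ n)    ≈⟨ ≈⇒≈[] (poch-± u Q n) ⟩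
    (⟨ u ^ 2 ∣ Q ^ 2 ⟩ n)              ≈⟨ poch∞≈[]′ (^-order-suc 1 u∈𝔪) (^-order-suc 1 Q∈𝔪) n ⟨
    ⟨ u ^ 2 ∣ Q ^ 2 ⟩∞                 ∎

module Eta (p : PS) (p∈𝔪 : 𝔪 p) where

  p^∈𝔪 : ∀ a .{{_ : NonZero a}} → 𝔪 (p ^ a)
  p^∈𝔪 (suc a) = ^-order-suc a p∈𝔪

  G H : ℕ → ℕ → PS
  G a b = ⟨ p ^ a ∣ p ^ b ⟩∞
  H a b = ⟨ - p ^ a ∣ p ^ b ⟩∞

  G-unit : ∀ a b .{{_ : NonZero a}} .{{_ : NonZero b}} → Unit (G a b)
  G-unit a b = poch∞-unit (p^∈𝔪 a) (p^∈𝔪 b)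

  G-2 : ∀ a b .{{_ : NonZero a}} .{{_ : NonZero b}} → G a b ≈ G a (b *ℕ 2) * G (a +ℕ b) (b *ℕ 2)
  G-2 a b = trans (poch∞-2 (p^∈𝔪 a) (p^∈𝔪 b))
    (*-cong (poch∞-cong refl (^-assocʳ p b 2)) (poch∞-cong (sym (^-homo-* p a b)) (^-assocʳ p b 2)))

  G-3 : ∀ a b .{{_ : NonZero a}} .{{_ : NonZero b}} → G a b ≈ G a (b *ℕ 3) * G (a +ℕ b) (b *ℕ 3) * G (a +ℕ b *ℕ 2) (b *ℕ 3)
  G-3 a b = trans (poch∞-3 (p^∈𝔪 a) (p^∈𝔪 b))
    (*-cong (*-cong (poch∞-cong refl (^-assocʳ p b 3)) (poch∞-cong (sym (^-homo-* p a b)) (^-assocʳ p b 3)))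
            (poch∞-cong (trans (*-congˡ (^-assocʳ p b 2)) (sym (^-homo-* p a (b *ℕ 2)))) (^-assocʳ p b 3)))

  G*H : ∀ a b .{{_ : NonZero a}} .{{_ : NonZero b}} → G a b * H a b ≈ G (a *ℕ 2) (b *ℕ 2)
  G*H a b = trans (poch∞-± (p^∈𝔪 a) (p^∈𝔪 b)) (poch∞-cong (^-assocʳ p a 2) (^-assocʳ p b 2))

  -- ψ is Ramanujan's theta function; φ₃ is his f(p,p²).

  ψ : PS
  ψ = G 2 2 * G 2 2 * iv (G 1 1)

  -- The left side is the triple product for X = p³, Y = p, Q = p⁴. Multiplied by (p;p)∞, split by
  -- residues modulo 4, every H meets its G; the products in base p⁸ recombine to (p²;p⁴)∞, and the
  -- whole becomes the square of (p²;p²)∞.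
  H-ψ : H 3 4 * H 1 4 * G 4 4 ≈ ψ
  H-ψ = sym (/-unique (G-unit 1 1) (sym (begin
    H 3 4 * H 1 4 * G 4 4 * G 1 1
      ≈⟨ *-congˡ (trans (G-2 1 1) (*-cong (G-2 1 2) (G-2 2 2))) ⟩
    H 3 4 * H 1 4 * G 4 4 * (G 1 4 * G 3 4 * (G 2 4 * G 4 4))
      ≈⟨ solve 6 (λ a b c d e f → a :* b :* c :* (d :* e :* (f :* c)) := (d :* b) :* (e :* a) :* c :* (f :* c)) refl (H 3 4) (H 1 4) (G 4 4) (G 1 4) (G 3 4) (G 2 4) ⟩
    (G 1 4 * H 1 4) * (G 3 4 * H 3 4) * G 4 4 * (G 2 4 * G 4 4)
      ≈⟨ *-congʳ (*-congʳ (*-cong (G*H 1 4) (G*H 3 4))) ⟩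
    G 2 8 * G 6 8 * G 4 4 * (G 2 4 * G 4 4)
      ≈⟨ *-congʳ (*-congʳ (G-2 2 4)) ⟨
    G 2 4 * G 4 4 * (G 2 4 * G 4 4)
      ≈⟨ *-cong (G-2 2 2) (G-2 2 2) ⟨
    G 2 2 * G 2 2 ∎)))
    where open ≈-Reasoning

  φ₃ : PS
  φ₃ = H 2 3 * H 1 3 * G 3 3

  -- The same pairing with (p;p)∞ split modulo 3. The additional (p⁶;p⁶)∞ supplies the residue class
  -- 0 that completes (p²;p²)∞.
  φ₃-product : φ₃ * (G 1 1 * G 6 6) ≈ G 2 2 * G 3 3 ^ 2
  φ₃-product = begin
    H 2 3 * H 1 3 * G 3 3 * (G 1 1 * G 6 6)
      ≈⟨ *-congˡ (*-congʳ (G-3 1 1)) ⟩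
    H 2 3 * H 1 3 * G 3 3 * (G 1 3 * G 2 3 * G 3 3 * G 6 6)
      ≈⟨ solve 6 (λ a b c d e f → a :* b :* c :* (d :* e :* c :* f) := (d :* b) :* (e :* a) :* f :* c :^ 2) refl (H 2 3) (H 1 3) (G 3 3) (G 1 3) (G 2 3) (G 6 6) ⟩
    (G 1 3 * H 1 3) * (G 2 3 * H 2 3) * G 6 6 * G 3 3 ^ 2
      ≈⟨ *-congʳ (*-congʳ (*-cong (G*H 1 3) (G*H 2 3))) ⟩
    G 2 6 * G 4 6 * G 6 6 * G 3 3 ^ 2
      ≈⟨ *-congʳ (G-3 2 2) ⟨
    G 2 2 * G 3 3 ^ 2 ∎
    where open ≈-Reasoning

-- Theta series for ψ, φ₃ and the Euler product

tri-2r+1 : ∀ r → tri (1 +ℕ r *ℕ 2) ≡ 3 *ℕ r +ℕ 4 *ℕ tri r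
tri-2r+1 zero    = ≡.refl
tri-2r+1 (suc r) = ≡.trans (≡.cong (λ t → t +ℕ suc (r *ℕ 2) +ℕ suc (suc (r *ℕ 2))) (tri-2r+1 r)) (arithmetic r (tri r))
  where
  arithmetic : ∀ r t → 3 *ℕ r +ℕ 4 *ℕ t +ℕ suc (r *ℕ 2) +ℕ suc (suc (r *ℕ 2)) ≡ 3 *ℕ suc r +ℕ 4 *ℕ (t +ℕ r)
  arithmetic = solve-∀

tri-3r+1 : ∀ r → tri (1 +ℕ r *ℕ 3) ≡ 6 *ℕ r +ℕ 9 *ℕ tri r
tri-3r+1 zero    = ≡.refl
tri-3r+1 (suc r) = ≡.trans (≡.cong (λ t → t +ℕ suc (r *ℕ 3) +ℕ suc (suc (r *ℕ 3)) +ℕ suc (suc (suc (r *ℕ 3)))) (tri-3r+1 r)) (arithmetic r (tri r))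
  where
  arithmetic : ∀ r t → 6 *ℕ r +ℕ 9 *ℕ t +ℕ suc (r *ℕ 3) +ℕ suc (suc (r *ℕ 3)) +ℕ suc (suc (suc (r *ℕ 3))) ≡ 6 *ℕ suc r +ℕ 9 *ℕ (t +ℕ r)
  arithmetic = solve-∀

σ-*3 : ∀ r → σ (r *ℕ 3) ≈ σ r
σ-*3 zero    = refl
σ-*3 (suc r) = trans (solve 1 (λ s → :- con 1ℤ :* (:- con 1ℤ :* (:- con 1ℤ :* s)) := :- con 1ℤ :* s) refl (σ (r *ℕ 3))) (*-congˡ (σ-*3 r))

neg-^ : ∀ a r → (- a) ^ r ≈ σ r * a ^ r
neg-^ a r = trans (^-congˡ r (solve 1 (λ a → :- a := :- con 1ℤ :* a) refl a)) (^-distrib-* (- 1#) a r)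

^-*-^ : ∀ p a r b s → (p ^ a) ^ r * (p ^ b) ^ s ≈ p ^ (a *ℕ r +ℕ b *ℕ s)
^-*-^ p a r b s = trans (*-cong (^-assocʳ p a r) (^-assocʳ p b s)) (sym (^-homo-* p (a *ℕ r) (b *ℕ s)))

module ThetaSeries (p : PS) (p∈𝔪 : 𝔪 p) where
  open Eta p p∈𝔪

  ψTerm : ℕ → PS
  ψTerm m = p ^ tri (suc m)

  ψ-summable : Summable ψTerm
  ψ-summable m = ^-order-≥ p∈𝔪 (ℕₚ.m≤n+m m (tri m))

  -- Triangular numbers m(m+1)/2 of even index m = 2r are the exponents 3r + 2r(r-1) in the first
  -- half of the triple product; those of odd index 2r + 1 are the exponents (r+1) + 2r(r+1) in the
  -- second half.
  ψ-series : ψ ≈ Σ∞ ψTerm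
  ψ-series = begin
    ψ
      ≈⟨ H-ψ ⟨
    H 3 4 * H 1 4 * G 4 4
      ≈⟨ jacobi (p^∈𝔪 3) (p^∈𝔪 1) (sym (^-homo-* p 3 1)) ⟩
    Σ∞ (thetaTerm (p ^ 3)) + Σ∞ (thetaTerm (p ^ 1) ∘ suc)
      ≈⟨ Σ∞-+ (theta-summable (p^∈𝔪 3)) (summable-suc (theta-summable (p^∈𝔪 1))) ⟨
    Σ∞ (λ r → thetaTerm (p ^ 3) r + thetaTerm (p ^ 1) (suc r))
      ≈⟨ Σ∞-cong (λ r → +-cong (even r) (odd r)) ⟨
    Σ∞ (λ r → ψTerm (r *ℕ 2) + ψTerm (1 +ℕ r *ℕ 2))
      ≈⟨ Σ∞-2 ψ-summable ⟨
    Σ∞ ψTerm ∎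
    where
    open ≈-Reasoning
    open QSeries (p ^ 4) (p^∈𝔪 4)
    even : ∀ r → ψTerm (r *ℕ 2) ≈ thetaTerm (p ^ 3) r
    even r = trans (^-congʳ p (tri-2r+1 r)) (sym (^-*-^ p 3 r 4 (tri r)))
    arithmetic : ∀ r t → 3 *ℕ r +ℕ 4 *ℕ t +ℕ suc (r *ℕ 2) ≡ 1 *ℕ suc r +ℕ 4 *ℕ (t +ℕ r)
    arithmetic = solve-∀
    odd : ∀ r → ψTerm (1 +ℕ r *ℕ 2) ≈ thetaTerm (p ^ 1) (suc r)
    odd r = trans (^-congʳ p (≡.trans (≡.cong (_+ℕ suc (r *ℕ 2)) (tri-2r+1 r)) (arithmetic r (tri r)))) (sym (^-*-^ p 1 (suc r) 4 (tri (suc r))))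

  φ₃-series : φ₃ ≈ Σ∞ (λ r → p ^ (2 *ℕ r +ℕ 3 *ℕ tri r) + p ^ (1 *ℕ suc r +ℕ 3 *ℕ tri (suc r)))
  φ₃-series = begin
    H 2 3 * H 1 3 * G 3 3
      ≈⟨ jacobi (p^∈𝔪 2) (p^∈𝔪 1) (sym (^-homo-* p 2 1)) ⟩
    Σ∞ (thetaTerm (p ^ 2)) + Σ∞ (thetaTerm (p ^ 1) ∘ suc)
      ≈⟨ Σ∞-+ (theta-summable (p^∈𝔪 2)) (summable-suc (theta-summable (p^∈𝔪 1))) ⟨
    Σ∞ (λ r → thetaTerm (p ^ 2) r + thetaTerm (p ^ 1) (suc r))
      ≈⟨ Σ∞-cong (λ r → +-cong (^-*-^ p 2 r 3 (tri r)) (^-*-^ p 1 (suc r) 3 (tri (suc r)))) ⟩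
    Σ∞ (λ r → p ^ (2 *ℕ r +ℕ 3 *ℕ tri r) + p ^ (1 *ℕ suc r +ℕ 3 *ℕ tri (suc r))) ∎
    where
    open ≈-Reasoning
    open QSeries (p ^ 3) (p^∈𝔪 3)

  -- The exponents are r(3r+1)/2 and (r+1)(3r+2)/2, the generalized pentagonal numbers k(3k-1)/2 at
  -- k = -r and k = r + 1. This pairing is the one produced by a block of three consecutive terms of
  -- the Lambert series for ψ².
  pentagonalTerm : ℕ → PS
  pentagonalTerm r = σ r * (p ^ (2 *ℕ r +ℕ 3 *ℕ tri r) - p ^ (1 *ℕ suc r +ℕ 3 *ℕ tri (suc r)))

  pentagonal-summable : Summable pentagonalTerm
  pentagonal-summable r = *-orderʳ _ (+-order
    (^-order-≥ p∈𝔪 (ℕₚ.≤-trans (ℕₚ.m≤n*m r 2) (ℕₚ.m≤m+n _ _)))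
    (-‿order (^-order-≥ p∈𝔪 (ℕₚ.≤-trans (ℕₚ.n≤1+n r) (ℕₚ.≤-trans (ℕₚ.m≤n*m (suc r) 1) (ℕₚ.m≤m+n _ _))))))

  pentagonal : G 1 1 ≈ Σ∞ pentagonalTerm
  pentagonal = begin
    G 1 1
      ≈⟨ G-3 1 1 ⟩
    G 1 3 * G 2 3 * G 3 3
      -- `jacobi` concerns (-X;Q)∞, so the arguments are written with doubled signs for X = -p² and
      -- Y = -p.
      ≈⟨ *-congʳ (trans (*-comm _ _) (*-cong (poch∞-cong (double (p ^ 2)) refl) (poch∞-cong (double (p ^ 1)) refl))) ⟩
    ⟨ - - p ^ 2 ∣ p ^ 3 ⟩∞ * ⟨ - - p ^ 1 ∣ p ^ 3 ⟩∞ * G 3 3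
      ≈⟨ jacobi X∈𝔪 Y∈𝔪 (trans (solve 2 (λ a b → :- a :* :- b := a :* b) refl (p ^ 2) (p ^ 1)) (sym (^-homo-* p 2 1))) ⟩
    Σ∞ (thetaTerm (- p ^ 2)) + Σ∞ (thetaTerm (- p ^ 1) ∘ suc)
      ≈⟨ Σ∞-+ (theta-summable X∈𝔪) (summable-suc (theta-summable Y∈𝔪)) ⟨
    Σ∞ (λ r → thetaTerm (- p ^ 2) r + thetaTerm (- p ^ 1) (suc r))
      ≈⟨ Σ∞-cong term ⟩
    Σ∞ pentagonalTerm ∎
    where
    open ≈-Reasoning
    open QSeries (p ^ 3) (p^∈𝔪 3)
    X∈𝔪 : 𝔪 (- p ^ 2)
    X∈𝔪 = -‿order (p^∈𝔪 2)
    Y∈𝔪 : 𝔪 (- p ^ 1)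
    Y∈𝔪 = -‿order (p^∈𝔪 1)
    double : ∀ a → a ≈ - - a
    double = solve 1 (λ a → a := :- (:- a)) refl
    theta : ∀ a r → thetaTerm (- p ^ a) r ≈ σ r * p ^ (a *ℕ r +ℕ 3 *ℕ tri r)
    theta a r = trans (*-congʳ (neg-^ (p ^ a) r)) (trans (*-assoc _ _ _) (*-congˡ (^-*-^ p a r 3 (tri r))))
    term : ∀ r → thetaTerm (- p ^ 2) r + thetaTerm (- p ^ 1) (suc r) ≈ pentagonalTerm r
    term r = trans (+-cong (theta 2 r) (theta 1 (suc r)))
      (solve 3 (λ s a b → s :* a :+ :- con 1ℤ :* s :* b := s :* (a :- b)) refl (σ r) (p ^ (2 *ℕ r +ℕ 3 *ℕ tri r)) (p ^ (1 *ℕ suc r +ℕ 3 *ℕ tri (suc r))))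

-- Dissections of ψ and ψ² modulo 3

module Dissection (p : PS) (p∈𝔪 : 𝔪 p) where
  open Eta p p∈𝔪
  open ThetaSeries p p∈𝔪
  private
    module E₃ = Eta (p ^ 3) (p^∈𝔪 3)
    module T₃ = ThetaSeries (p ^ 3) (p^∈𝔪 3)
    module E₆ = Eta (p ^ 6) (p^∈𝔪 6)
    module T₆ = ThetaSeries (p ^ 6) (p^∈𝔪 6)
    module E₉ = Eta (p ^ 9) (p^∈𝔪 9)
    module T₉ = ThetaSeries (p ^ 9) (p^∈𝔪 9)

  -- The triangular number of index 3r + 1 is 1 + 9 r(r+1)/2, which gives p ψ(p⁹). Those of index 3r
  -- and 3r + 2 are multiples of 3 and run through the two halves of f(p³,p⁶).
  ψ-dissection : ψ ≈ E₃.φ₃ + p * E₉.ψ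
  ψ-dissection = begin
    ψ
      ≈⟨ ψ-series ⟩
    Σ∞ ψTerm
      ≈⟨ Σ∞-3 ψ-summable ⟩
    Σ∞ (λ r → ψTerm (r *ℕ 3) + ψTerm (1 +ℕ r *ℕ 3) + ψTerm (2 +ℕ r *ℕ 3))
      ≈⟨ Σ∞-cong (λ r → trans (solve 3 (λ a b c → a :+ b :+ c := a :+ c :+ b) refl _ _ (ψTerm (2 +ℕ r *ℕ 3))) (+-cong (+-cong (first r) (third r)) (second r))) ⟩
    Σ∞ (λ r → ((p ^ 3) ^ (2 *ℕ r +ℕ 3 *ℕ tri r) + (p ^ 3) ^ (1 *ℕ suc r +ℕ 3 *ℕ tri (suc r))) + p * T₉.ψTerm r)
      ≈⟨ Σ∞-+ (λ r → Mod.trans (≈⇒≈[] (sym (+-cong (first r) (third r)))) (summable-+ (summable-3 0) (summable-3 2) r)) (summable-* p T₉.ψ-summable) ⟩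
    Σ∞ (λ r → (p ^ 3) ^ (2 *ℕ r +ℕ 3 *ℕ tri r) + (p ^ 3) ^ (1 *ℕ suc r +ℕ 3 *ℕ tri (suc r))) + Σ∞ (λ r → p * T₉.ψTerm r)
      ≈⟨ +-cong T₃.φ₃-series (trans (*-congˡ T₉.ψ-series) (Σ∞-* p T₉.ψ-summable)) ⟨
    E₃.φ₃ + p * E₉.ψ ∎
    where
    open ≈-Reasoning
    summable-3 : ∀ i → Summable (λ r → ψTerm (i +ℕ r *ℕ 3))
    summable-3 i r = weaken (ℕₚ.≤-trans (m≤m*[1+k] r 2) (ℕₚ.m≤n+m _ i)) (ψ-summable (i +ℕ r *ℕ 3))
    arithmetic₁ : ∀ r t → 6 *ℕ r +ℕ 9 *ℕ t ≡ 3 *ℕ (2 *ℕ r +ℕ 3 *ℕ t)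
    arithmetic₁ = solve-∀
    arithmetic₂ : ∀ r t → 6 *ℕ r +ℕ 9 *ℕ t +ℕ suc (r *ℕ 3) ≡ suc (9 *ℕ (t +ℕ r))
    arithmetic₂ = solve-∀
    arithmetic₃ : ∀ r t → 6 *ℕ r +ℕ 9 *ℕ t +ℕ suc (r *ℕ 3) +ℕ suc (suc (r *ℕ 3)) ≡ 3 *ℕ (1 *ℕ suc r +ℕ 3 *ℕ (t +ℕ r))
    arithmetic₃ = solve-∀
    first : ∀ r → ψTerm (r *ℕ 3) ≈ (p ^ 3) ^ (2 *ℕ r +ℕ 3 *ℕ tri r)
    first r = trans (^-congʳ p (≡.trans (tri-3r+1 r) (arithmetic₁ r (tri r)))) (sym (^-assocʳ p 3 (2 *ℕ r +ℕ 3 *ℕ tri r)))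
    second : ∀ r → ψTerm (1 +ℕ r *ℕ 3) ≈ p * T₉.ψTerm r
    second r = trans (^-congʳ p (≡.trans (≡.cong (_+ℕ suc (r *ℕ 3)) (tri-3r+1 r)) (arithmetic₂ r (tri r)))) (*-congˡ (sym (^-assocʳ p 9 (tri (suc r)))))
    third : ∀ r → ψTerm (2 +ℕ r *ℕ 3) ≈ (p ^ 3) ^ (1 *ℕ suc r +ℕ 3 *ℕ tri (suc r))
    third r = trans (^-congʳ p (≡.trans (≡.cong (λ t → t +ℕ suc (r *ℕ 3) +ℕ suc (suc (r *ℕ 3))) (tri-3r+1 r)) (arithmetic₃ r (tri r)))) (sym (^-assocʳ p 3 (1 *ℕ suc r +ℕ 3 *ℕ tri (suc r))))

  J : ℕ → PS
  J a = iv (1# - p ^ a)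

  J-expand : ∀ a .{{_ : NonZero a}} → J a ≈ 1# + p ^ a * J a
  J-expand a = begin
    J a                               ≈⟨ solve 2 (λ u j → j := (con 1ℤ :- u) :* j :+ u :* j) refl (p ^ a) (J a) ⟩
    (1# - p ^ a) * J a + p ^ a * J a  ≈⟨ +-congʳ (*-inverseʳ (1-𝔪 (p^∈𝔪 a))) ⟩
    1# + p ^ a * J a                  ∎
    where open ≈-Reasoning

  -- The form (1 - p^{a+b})/((1 - p^a)(1 - p^b)) of a Lambert summand after `lambert-split`.
  J₂ : ℕ → ℕ → PS
  J₂ a b = J a + p ^ b * J b

  module _ (a b : ℕ) .{{_ : NonZero a}} .{{_ : NonZero b}} .{{_ : NonZero (a +ℕ b)}} where
    private c = a +ℕ b
    open QSeries (p ^ c) (p^∈𝔪 c)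

    lambert : ∀ r → lambertTerm (p^∈𝔪 a) (p^∈𝔪 b) (sym (^-homo-* p a b)) r ≈ σ r * p ^ (c *ℕ tri (suc r)) * J₂ (a +ℕ c *ℕ r) (b +ℕ c *ℕ r)
    lambert r = trans (lambert-split (p^∈𝔪 a) (p^∈𝔪 b) (sym (^-homo-* p a b)) r)
      (*-cong (*-congˡ (^-assocʳ p c (tri (suc r)))) (+-cong (J-cong a) (*-cong (power b) (J-cong b))))
      where
      power : ∀ a → p ^ a * (p ^ c) ^ r ≈ p ^ (a +ℕ c *ℕ r)
      power a = trans (*-congˡ (^-assocʳ p c r)) (sym (^-homo-* p a (c *ℕ r)))
      J-cong : ∀ a .{{_ : NonZero a}} → iv (1# - p ^ a * (p ^ c) ^ r) ≈ J (a +ℕ c *ℕ r)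
      J-cong a = iv-cong (1-𝔪 (*-orderˡ _ (p^∈𝔪 a))) (+-congˡ (-‿cong (power a)))

    theta-quotient : G c c * G c c * iv (G a c * G b c) ≈ Σ∞ (λ r → σ r * p ^ (c *ℕ tri (suc r)) * J₂ (a +ℕ c *ℕ r) (b +ℕ c *ℕ r))
    theta-quotient = trans (theta-reciprocal (p^∈𝔪 a) (p^∈𝔪 b) (sym (^-homo-* p a b))) (Σ∞-cong lambert)

    -- The exponent is c times 3r(r+1)/2: r² + r comes from Bailey's lemma and r(r+1)/2 from the
    -- partial fractions.
    g₃Lambert : ℕ → PS
    g₃Lambert r = σ r * p ^ (c *ℕ (3 *ℕ tri r +ℕ 3 *ℕ r)) * J₂ (a +ℕ c *ℕ r) (b +ℕ c *ℕ r)

    g₃ : PS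
    g₃ = Σ∞ (g₃Term (p ^ a) (p ^ b) (p ^ c))

    g₃Lambert-summable : Summable g₃Lambert
    g₃Lambert-summable r = *-orderˡ _ (*-orderʳ _ (^-order-≥ p∈𝔪
      (ℕₚ.≤-trans (ℕₚ.≤-trans (ℕₚ.m≤n*m r 3) (ℕₚ.m≤n+m _ (3 *ℕ tri r))) (ℕₚ.m≤n*m _ c))))

    g₃-lambert : G c c * g₃ ≈ Σ∞ g₃Lambert
    g₃-lambert = begin
      G c c * g₃
        ≈⟨ *-congˡ (watson (p^∈𝔪 a) (p^∈𝔪 b) (sym (^-homo-* p a b))) ⟩
      G c c * (rP∞ * Σ∞ (λ r → (p ^ c) ^ (r *ℕ r +ℕ r) * lambertTerm (p^∈𝔪 a) (p^∈𝔪 b) (sym (^-homo-* p a b)) r))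
        ≈⟨ trans (sym (*-assoc _ _ _)) (trans (*-congʳ (*-inverseʳ P∞-unit)) (*-identityˡ _)) ⟩
      Σ∞ (λ r → (p ^ c) ^ (r *ℕ r +ℕ r) * lambertTerm (p^∈𝔪 a) (p^∈𝔪 b) (sym (^-homo-* p a b)) r)
        ≈⟨ Σ∞-cong term ⟩
      Σ∞ g₃Lambert ∎
      where
      open ≈-Reasoning
      arithmetic : ∀ r t → t +ℕ t +ℕ r +ℕ r +ℕ (t +ℕ r) ≡ 3 *ℕ t +ℕ 3 *ℕ r
      arithmetic = solve-∀
      exponent : ∀ r → c *ℕ (r *ℕ r +ℕ r) +ℕ c *ℕ tri (suc r) ≡ c *ℕ (3 *ℕ tri r +ℕ 3 *ℕ r)
      exponent r = ≡.trans (≡.sym (ℕₚ.*-distribˡ-+ c (r *ℕ r +ℕ r) (tri (suc r))))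
        (≡.cong (c *ℕ_) (≡.trans (≡.cong (λ s → s +ℕ r +ℕ tri (suc r)) (≡.sym (tri+tri+n r))) (arithmetic r (tri r))))
      term : ∀ r → (p ^ c) ^ (r *ℕ r +ℕ r) * lambertTerm (p^∈𝔪 a) (p^∈𝔪 b) (sym (^-homo-* p a b)) r ≈ g₃Lambert r
      term r = begin
        (p ^ c) ^ (r *ℕ r +ℕ r) * lambertTerm (p^∈𝔪 a) (p^∈𝔪 b) (sym (^-homo-* p a b)) r
          ≈⟨ *-cong (^-assocʳ p c (r *ℕ r +ℕ r)) (lambert r) ⟩
        p ^ (c *ℕ (r *ℕ r +ℕ r)) * (σ r * p ^ (c *ℕ tri (suc r)) * J₂ (a +ℕ c *ℕ r) (b +ℕ c *ℕ r))
          ≈⟨ solve 4 (λ e s t j → e :* (s :* t :* j) := s :* (e :* t) :* j) refl _ (σ r) _ _ ⟩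
        σ r * (p ^ (c *ℕ (r *ℕ r +ℕ r)) * p ^ (c *ℕ tri (suc r))) * J₂ (a +ℕ c *ℕ r) (b +ℕ c *ℕ r)
          ≈⟨ *-congʳ (*-congˡ (trans (sym (^-homo-* p (c *ℕ (r *ℕ r +ℕ r)) _)) (^-congʳ p (exponent r)))) ⟩
        g₃Lambert r ∎

  -- Because (p;p)∞ = (p;p²)∞ (p²;p²)∞, ψ is also (p²;p²)∞/(p;p²)∞, and its square is the theta
  -- quotient for x = y = p and Q = p².
  ψ²-lambert : ψ * ψ ≈ Σ∞ (λ m → σ m * p ^ (2 *ℕ tri (suc m)) * J₂ (1 +ℕ 2 *ℕ m) (1 +ℕ 2 *ℕ m))
  ψ²-lambert = begin
    ψ * ψ                                  ≈⟨ *-cong ψ≈ ψ≈ ⟩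
    G 2 2 * i * (G 2 2 * i)                ≈⟨ solve 2 (λ g i → g :* i :* (g :* i) := g :* g :* (i :* i)) refl (G 2 2) i ⟩
    G 2 2 * G 2 2 * (i * i)                ≈⟨ *-congˡ (iv-* (G-unit 1 2) (G-unit 1 2)) ⟨
    G 2 2 * G 2 2 * iv (G 1 2 * G 1 2)     ≈⟨ theta-quotient 1 1 ⟩
    Σ∞ (λ m → σ m * p ^ (2 *ℕ tri (suc m)) * J₂ (1 +ℕ 2 *ℕ m) (1 +ℕ 2 *ℕ m)) ∎
    where
    open ≈-Reasoning
    i = iv (G 1 2)
    ψ≈ : ψ ≈ G 2 2 * i
    ψ≈ = /-unique (G-unit 1 1) (begin
      G 2 2 * G 2 2                      ≈⟨ solve 1 (λ g → g :* g := g :* con 1ℤ :* g) refl (G 2 2) ⟩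
      G 2 2 * 1# * G 2 2                 ≈⟨ *-congʳ (*-congˡ (*-inverseʳ (G-unit 1 2))) ⟨
      G 2 2 * (G 1 2 * i) * G 2 2        ≈⟨ solve 3 (λ g h i → g :* (h :* i) :* g := g :* i :* (h :* g)) refl (G 2 2) (G 1 2) i ⟩
      G 2 2 * i * (G 1 2 * G 2 2)        ≈⟨ *-congˡ (G-2 1 1) ⟨
      G 2 2 * i * G 1 1                  ∎)

  -- Splitting the Lambert series for ψ² according to the index modulo 3.
  ψ²-dissection : ψ * ψ ≈ G 6 6 + (p + p) * (G 6 6 * g₃ 1 5) - p ^ 2 * (G 6 6 * g₃ 3 3)
  ψ²-dissection = begin
    ψ * ψ
      ≈⟨ ψ²-lambert ⟩
    Σ∞ c
      ≈⟨ Σ∞-3 c-summable ⟩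
    Σ∞ (λ r → c (r *ℕ 3) + c (1 +ℕ r *ℕ 3) + c (2 +ℕ r *ℕ 3))
      ≈⟨ Σ∞-cong term ⟩
    Σ∞ (λ r → T₆.pentagonalTerm r + (p + p) * g₃Lambert 1 5 r - p ^ 2 * g₃Lambert 3 3 r)
      ≈⟨ Σ∞-‿- (summable-+ T₆.pentagonal-summable W₁-summable) W₃-summable ⟩
    Σ∞ (λ r → T₆.pentagonalTerm r + (p + p) * g₃Lambert 1 5 r) - Σ∞ (λ r → p ^ 2 * g₃Lambert 3 3 r)
      ≈⟨ +-congʳ (Σ∞-+ T₆.pentagonal-summable W₁-summable) ⟩
    Σ∞ T₆.pentagonalTerm + Σ∞ (λ r → (p + p) * g₃Lambert 1 5 r) - Σ∞ (λ r → p ^ 2 * g₃Lambert 3 3 r)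
      ≈⟨ +-cong (+-cong (trans (poch∞-cong (sym (^-assocʳ p 6 1)) (sym (^-assocʳ p 6 1))) T₆.pentagonal)
                        (trans (*-congˡ (g₃-lambert 1 5)) (Σ∞-* (p + p) (g₃Lambert-summable 1 5))))
                (-‿cong (trans (*-congˡ (g₃-lambert 3 3)) (Σ∞-* (p ^ 2) (g₃Lambert-summable 3 3)))) ⟨
    G 6 6 + (p + p) * (G 6 6 * g₃ 1 5) - p ^ 2 * (G 6 6 * g₃ 3 3) ∎
    where
    open ≈-Reasoning
    c : ℕ → PS
    c m = σ m * p ^ (2 *ℕ tri (suc m)) * J₂ (1 +ℕ 2 *ℕ m) (1 +ℕ 2 *ℕ m)
    c-summable : Summable c
    c-summable m = *-orderˡ _ (*-orderʳ _ (^-order-≥ p∈𝔪 (ℕₚ.≤-trans (ℕₚ.m≤n+m m (tri m)) (ℕₚ.m≤n*m _ 2))))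
    W₁-summable : Summable (λ r → (p + p) * g₃Lambert 1 5 r)
    W₁-summable = summable-* (p + p) (g₃Lambert-summable 1 5)
    W₃-summable : Summable (λ r → p ^ 2 * g₃Lambert 3 3 r)
    W₃-summable = summable-* (p ^ 2) (g₃Lambert-summable 3 3)

    module _ (r : ℕ) where
      -- Here e is p^{3r(3r+1)}, the power in `c` at index 3r; each further index contributes a
      -- factor m = p^{6r} and a constant power of p. In these variables the comparison of the block
      -- becomes a polynomial identity.
      e m : PS
      e = p ^ (12 *ℕ r +ℕ 18 *ℕ tri r)
      m = p ^ (6 *ℕ r)
      J₁ J₃ J₅ : PS
      J₁ = J (1 +ℕ 6 *ℕ r)
      J₃ = J (3 +ℕ 6 *ℕ r)
      J₅ = J (5 +ℕ 6 *ℕ r)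

      e*m² : ∀ k → p ^ (12 *ℕ r +ℕ 18 *ℕ tri r +ℕ 6 *ℕ r +ℕ 6 *ℕ r +ℕ k) ≈ e * m * m * p ^ k
      e*m² k = trans (^-homo-* p (12 *ℕ r +ℕ 18 *ℕ tri r +ℕ 6 *ℕ r +ℕ 6 *ℕ r) k)
        (*-congʳ (trans (^-homo-* p (12 *ℕ r +ℕ 18 *ℕ tri r +ℕ 6 *ℕ r) (6 *ℕ r)) (*-congʳ (^-homo-* p (12 *ℕ r +ℕ 18 *ℕ tri r) (6 *ℕ r)))))
      e*m : ∀ k → p ^ (12 *ℕ r +ℕ 18 *ℕ tri r +ℕ 6 *ℕ r +ℕ k) ≈ e * m * p ^ k
      e*m k = trans (^-homo-* p (12 *ℕ r +ℕ 18 *ℕ tri r +ℕ 6 *ℕ r) k) (*-congʳ (^-homo-* p (12 *ℕ r +ℕ 18 *ℕ tri r) (6 *ℕ r)))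

      J₂-at : ∀ {a b a′ b′} → a ≡ a′ → b ≡ b′ → J₂ a b ≈ J₂ a′ b′
      J₂-at e f = Ring.reflexive (≡.cong₂ J₂ e f)

      J₂-expand : ∀ a → J₂ (suc a +ℕ 6 *ℕ r) (suc a +ℕ 6 *ℕ r) ≈ J (suc a +ℕ 6 *ℕ r) + p ^ suc a * m * J (suc a +ℕ 6 *ℕ r)
      J₂-expand a = +-congˡ (*-congʳ (^-homo-* p (suc a) (6 *ℕ r)))

      J-expand′ : ∀ a → J (suc a +ℕ 6 *ℕ r) ≈ 1# + p ^ suc a * m * J (suc a +ℕ 6 *ℕ r)
      J-expand′ a = trans (J-expand (suc a +ℕ 6 *ℕ r)) (+-congˡ (*-congʳ (^-homo-* p (suc a) (6 *ℕ r))))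

      c₀ : c (r *ℕ 3) ≈ σ r * e * (J₁ + p ^ 1 * m * J₁)
      c₀ = *-cong (*-cong (σ-*3 r) (^-congʳ p (≡.trans (≡.cong (2 *ℕ_) (tri-3r+1 r)) (arithmetic r (tri r)))))
                  (trans (J₂-at (index r) (index r)) (J₂-expand 0))
        where
        arithmetic : ∀ r t → 2 *ℕ (6 *ℕ r +ℕ 9 *ℕ t) ≡ 12 *ℕ r +ℕ 18 *ℕ t
        arithmetic = solve-∀
        index : ∀ r → 1 +ℕ 2 *ℕ (r *ℕ 3) ≡ 1 +ℕ 6 *ℕ r
        index = solve-∀

      c₁ : c (1 +ℕ r *ℕ 3) ≈ - 1# * σ r * (e * m * p ^ 2) * (J₃ + p ^ 3 * m * J₃)
      c₁ = *-cong (*-cong (*-congˡ (σ-*3 r)) (trans (^-congʳ p (≡.trans (≡.cong (λ t → 2 *ℕ (t +ℕ suc (r *ℕ 3))) (tri-3r+1 r)) (arithmetic r (tri r)))) (e*m 2)))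
                  (trans (J₂-at (index r) (index r)) (J₂-expand 2))
        where
        arithmetic : ∀ r t → 2 *ℕ (6 *ℕ r +ℕ 9 *ℕ t +ℕ suc (r *ℕ 3)) ≡ 12 *ℕ r +ℕ 18 *ℕ t +ℕ 6 *ℕ r +ℕ 2
        arithmetic = solve-∀
        index : ∀ r → 1 +ℕ 2 *ℕ (1 +ℕ r *ℕ 3) ≡ 3 +ℕ 6 *ℕ r
        index = solve-∀

      c₂ : c (2 +ℕ r *ℕ 3) ≈ - 1# * (- 1# * σ r) * (e * m * m * p ^ 6) * (J₅ + p ^ 5 * m * J₅)
      c₂ = *-cong (*-cong (*-congˡ (*-congˡ (σ-*3 r))) (trans (^-congʳ p (≡.trans (≡.cong (λ t → 2 *ℕ (t +ℕ suc (r *ℕ 3) +ℕ suc (suc (r *ℕ 3)))) (tri-3r+1 r)) (arithmetic r (tri r)))) (e*m² 6)))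
                  (trans (J₂-at (index r) (index r)) (J₂-expand 4))
        where
        arithmetic : ∀ r t → 2 *ℕ (6 *ℕ r +ℕ 9 *ℕ t +ℕ suc (r *ℕ 3) +ℕ suc (suc (r *ℕ 3))) ≡ 12 *ℕ r +ℕ 18 *ℕ t +ℕ 6 *ℕ r +ℕ 6 *ℕ r +ℕ 6
        arithmetic = solve-∀
        index : ∀ r → 1 +ℕ 2 *ℕ (2 +ℕ r *ℕ 3) ≡ 5 +ℕ 6 *ℕ r
        index = solve-∀

      pentagonal-term : T₆.pentagonalTerm r ≈ σ r * (e - e * m * m * p ^ 6)
      pentagonal-term = *-congˡ (+-cong (trans (^-assocʳ p 6 (2 *ℕ r +ℕ 3 *ℕ tri r)) (^-congʳ p (arithmetic₁ r (tri r))))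
                                        (-‿cong (trans (^-assocʳ p 6 (1 *ℕ suc r +ℕ 3 *ℕ tri (suc r))) (trans (^-congʳ p (arithmetic₂ r (tri r))) (e*m² 6)))))
        where
        arithmetic₁ : ∀ r t → 6 *ℕ (2 *ℕ r +ℕ 3 *ℕ t) ≡ 12 *ℕ r +ℕ 18 *ℕ t
        arithmetic₁ = solve-∀
        arithmetic₂ : ∀ r t → 6 *ℕ (1 *ℕ suc r +ℕ 3 *ℕ (t +ℕ r)) ≡ 12 *ℕ r +ℕ 18 *ℕ t +ℕ 6 *ℕ r +ℕ 6 *ℕ r +ℕ 6
        arithmetic₂ = solve-∀

      g₃-exponent : p ^ (6 *ℕ (3 *ℕ tri r +ℕ 3 *ℕ r)) ≈ e * m
      g₃-exponent = trans (^-congʳ p (arithmetic r (tri r))) (^-homo-* p (12 *ℕ r +ℕ 18 *ℕ tri r) (6 *ℕ r))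
        where
        arithmetic : ∀ r t → 6 *ℕ (3 *ℕ t +ℕ 3 *ℕ r) ≡ 12 *ℕ r +ℕ 18 *ℕ t +ℕ 6 *ℕ r
        arithmetic = solve-∀

      W₁ : g₃Lambert 1 5 r ≈ σ r * (e * m) * (J₁ + p ^ 5 * m * J₅)
      W₁ = *-cong (*-congˡ g₃-exponent) (+-congˡ (*-congʳ (^-homo-* p 5 (6 *ℕ r))))

      W₃ : g₃Lambert 3 3 r ≈ σ r * (e * m) * (J₃ + p ^ 3 * m * J₃)
      W₃ = *-cong (*-congˡ g₃-exponent) (J₂-expand 2)

      term : c (r *ℕ 3) + c (1 +ℕ r *ℕ 3) + c (2 +ℕ r *ℕ 3) ≈ T₆.pentagonalTerm r + (p + p) * g₃Lambert 1 5 r - p ^ 2 * g₃Lambert 3 3 r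
      term = begin
        c (r *ℕ 3) + c (1 +ℕ r *ℕ 3) + c (2 +ℕ r *ℕ 3)
          ≈⟨ +-cong (+-cong c₀ c₁) c₂ ⟩
        s * e * (J₁ + p ^ 1 * m * J₁) + - 1# * s * (e * m * p ^ 2) * (J₃ + p ^ 3 * m * J₃) + - 1# * (- 1# * s) * (e * m * m * p ^ 6) * (J₅ + p ^ 5 * m * J₅)
          -- One of the two copies is expanded in opposite directions: `J₁` becomes 1 + p m `J₁`,
          -- whereas p⁵ m `J₅` becomes `J₅` - 1. The constants 1 and -1 yield the two halves of the
          -- pentagonal term, and the doubled `J₁` and `J₅` yield 2p times the term of g₃(p,p⁶).
          ≈⟨ +-cong (+-congʳ (*-congˡ (+-congʳ (J-expand′ 0)))) (*-congˡ (+-congˡ (trans (solve 2 (λ a j → a :* j := con 1ℤ :+ a :* j :- con 1ℤ) refl _ J₅) (+-congʳ (sym (J-expand′ 4)))))) ⟩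
        s * e * (1# + p ^ 1 * m * J₁ + p ^ 1 * m * J₁) + - 1# * s * (e * m * p ^ 2) * (J₃ + p ^ 3 * m * J₃) + - 1# * (- 1# * s) * (e * m * m * p ^ 6) * (J₅ + (J₅ - 1#))
          ≈⟨ solve 7 (λ p s e m j₁ j₃ j₅ →
               s :* e :* (con 1ℤ :+ p :^ 1 :* m :* j₁ :+ p :^ 1 :* m :* j₁) :+ :- con 1ℤ :* s :* (e :* m :* p :^ 2) :* (j₃ :+ p :^ 3 :* m :* j₃) :+ :- con 1ℤ :* (:- con 1ℤ :* s) :* (e :* m :* m :* p :^ 6) :* (j₅ :+ (j₅ :- con 1ℤ))
               := s :* (e :- e :* m :* m :* p :^ 6) :+ (p :+ p) :* (s :* (e :* m) :* (j₁ :+ p :^ 5 :* m :* j₅)) :- p :^ 2 :* (s :* (e :* m) :* (j₃ :+ p :^ 3 :* m :* j₃)))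
               refl p s e m J₁ J₃ J₅ ⟩
        s * (e - e * m * m * p ^ 6) + (p + p) * (s * (e * m) * (J₁ + p ^ 5 * m * J₅)) - p ^ 2 * (s * (e * m) * (J₃ + p ^ 3 * m * J₃))
          ≈⟨ +-cong (+-cong pentagonal-term (*-congˡ W₁)) (-‿cong (*-congˡ W₃)) ⟨
        T₆.pentagonalTerm r + (p + p) * g₃Lambert 1 5 r - p ^ 2 * g₃Lambert 3 3 r ∎
        where s = σ r

-- The substitution q ↦ q³

spread : Series → Series
spread a zero                = a 0
spread a (suc zero)          = 0ℤ
spread a (suc (suc zero))    = 0ℤ
spread a (suc (suc (suc n))) = spread (tail a) n

spread-0 : ∀ a n → spread a (n *ℕ 3) ≡ a n
spread-0 a zero    = ≡.refl
spread-0 a (suc n) = spread-0 (tail a) n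

spread-1 : ∀ a n → spread a (1 +ℕ n *ℕ 3) ≡ 0ℤ
spread-1 a zero    = ≡.refl
spread-1 a (suc n) = spread-1 (tail a) n

spread-2 : ∀ a n → spread a (2 +ℕ n *ℕ 3) ≡ 0ℤ
spread-2 a zero    = ≡.refl
spread-2 a (suc n) = spread-2 (tail a) n

spread-cong : ∀ n {a b : Series} → (∀ k → k < n → a k ≡ b k) → ∀ k → k < n → spread a k ≡ spread b k
spread-cong (suc n) e zero                h       = e 0 h
spread-cong (suc n) e (suc zero)          h       = ≡.refl
spread-cong (suc n) e (suc (suc zero))    h       = ≡.refl
spread-cong (suc n) e (suc (suc (suc k))) (s≤s h) =
  spread-cong n (λ l g → e (suc l) (s≤s g)) k (ℕₚ.≤-trans (ℕₚ.m≤n+m (suc k) 2) h)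

spread-+ : ∀ a b n → spread (a ⊕ b) n ≡ spread a n ℤ.+ spread b n
spread-+ a b zero                = ≡.refl
spread-+ a b (suc zero)          = ≡.refl
spread-+ a b (suc (suc zero))    = ≡.refl
spread-+ a b (suc (suc (suc n))) = spread-+ (tail a) (tail b) n

spread-scale : ∀ c a n → spread (scale c a) n ≡ c ℤ.* spread a n
spread-scale c a zero                = ≡.refl
spread-scale c a (suc zero)          = ≡.sym (ℤₚ.*-zeroʳ c)
spread-scale c a (suc (suc zero))    = ≡.sym (ℤₚ.*-zeroʳ c)
spread-scale c a (suc (suc (suc n))) = spread-scale c (tail a) n

inflate : PS → PS
inflate a = ser (spread (coef a))

inflate-cong[] : ∀ {n a b} → a ≈[ n ] b → inflate a ≈[ n ] inflate b
inflate-cong[] {n} e = below (spread-cong n (at< e))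

inflate-cong : ∀ {a b} → a ≈ b → inflate a ≈ inflate b
inflate-cong e = ≈[]⇒≈ λ n → inflate-cong[] (≈⇒≈[] e)

inflate-+ : ∀ a b → inflate (a + b) ≈ inflate a + inflate b
inflate-+ a b = pointwise λ n → ≡.trans (spread-cong (suc n) (λ k _ → coef-+ a b k) n ℕₚ.≤-refl)
  (≡.trans (spread-+ (coef a) (coef b) n) (≡.sym (coef-+ (inflate a) (inflate b) n)))

inflate-const* : ∀ c a → inflate (const c * a) ≈ const c * inflate a
inflate-const* c a = pointwise λ n → ≡.trans (spread-cong (suc n) (λ k _ → coef-const* c a k) n ℕₚ.≤-refl)
  (≡.trans (spread-scale c (coef a) n) (≡.sym (coef-const* c (inflate a) n)))

inflate-q* : ∀ a → inflate (q * a) ≈ q ^ 3 * inflate a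
inflate-q* a = trans (pointwise shift) (solve 2 (λ q b → q :* (q :* (q :* b)) := q :^ 3 :* b) refl q (inflate a))
  where
  b = inflate a
  shift : ∀ n → coef (inflate (q * a)) n ≡ coef (q * (q * (q * b))) n
  shift zero                = ≡.trans (coef-q*-zero a) (≡.sym (coef-q*-zero (q * (q * b))))
  shift (suc zero)          = ≡.sym (≡.trans (coef-q*-suc (q * (q * b)) 0) (coef-q*-zero (q * b)))
  shift (suc (suc zero))    = ≡.sym (≡.trans (coef-q*-suc (q * (q * b)) 1) (≡.trans (coef-q*-suc (q * b) 0) (coef-q*-zero b)))
  shift (suc (suc (suc n))) = ≡.trans (spread-cong (suc n) (λ k _ → coef-q*-suc a k) n ℕₚ.≤-refl)
    (≡.sym (≡.trans (coef-q*-suc (q * (q * b)) (2 +ℕ n)) (≡.trans (coef-q*-suc (q * b) (1 +ℕ n)) (coef-q*-suc b n))))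

opaque
  unfolding _+_

  coef-const-suc : ∀ c n → coef (const c) (suc n) ≡ 0ℤ
  coef-const-suc c n = ≡.refl

  coef-const-zero : ∀ c → coef (const c) 0 ≡ c
  coef-const-zero c = ≡.refl

head-tail : ∀ a → a ≈ const (coef a 0) + q * ser (tail (coef a))
head-tail a = pointwise λ
  { zero    → ≡.sym (≡.trans (coef-+ _ _ 0) (≡.trans (≡.cong₂ ℤ._+_ (coef-const-zero (coef a 0)) (coef-q*-zero (ser (tail (coef a))))) (ℤₚ.+-identityʳ _)))
  ; (suc n) → ≡.sym (≡.trans (coef-+ _ _ (suc n)) (≡.trans (≡.cong₂ ℤ._+_ (coef-const-suc (coef a 0) n) (coef-q*-suc (ser (tail (coef a))) n)) (ℤₚ.+-identityˡ _)))
  }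

inflate-1 : inflate 1# ≈ 1#
inflate-1 = pointwise one₃
  where
  one₃ : ∀ n → spread (coef 1#) n ≡ coef 1# n
  one₃ zero                = ≡.refl
  one₃ (suc zero)          = ≡.sym (coef-const-suc 1ℤ 0)
  one₃ (suc (suc zero))    = ≡.sym (coef-const-suc 1ℤ 1)
  one₃ (suc (suc (suc n))) = ≡.trans (zeros n) (≡.sym (coef-const-suc 1ℤ (2 +ℕ n)))
    where
    spread-zero : ∀ n → spread (λ _ → 0ℤ) n ≡ 0ℤ
    spread-zero zero                = ≡.refl
    spread-zero (suc zero)          = ≡.refl
    spread-zero (suc (suc zero))    = ≡.refl
    spread-zero (suc (suc (suc n))) = spread-zero n
    zeros : ∀ n → spread (tail (coef 1#)) n ≡ 0ℤ
    zeros n = ≡.trans (spread-cong (suc n) (λ k _ → coef-const-suc 1ℤ k) n ℕₚ.≤-refl) (spread-zero n)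

inflate-const : ∀ c → inflate (const c) ≈ const c
inflate-const c = begin
  inflate (const c)        ≈⟨ inflate-cong (*-identityʳ (const c)) ⟨
  inflate (const c * 1#)   ≈⟨ inflate-const* c 1# ⟩
  const c * inflate 1#     ≈⟨ trans (*-congˡ inflate-1) (*-identityʳ (const c)) ⟩
  const c                  ∎
  where open ≈-Reasoning

q³-order : q ^ 3 ≈[ 1 ] 0#
q³-order = ^-order-suc 2 q≈[1]0

-- Induction on precision: for a = a₀ + q t the part q t is sent to q³ times the image of t, so the
-- claim for t below n gives the claim for a below n + 1.
inflate-* : ∀ a b → inflate (a * b) ≈ inflate a * inflate b
inflate-* a b = ≈[]⇒≈ λ n → go n a
  where
  go : ∀ n a → inflate (a * b) ≈[ n ] inflate a * inflate b
  go zero    a = ≈[0]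
  go (suc n) a = begin
    inflate (a * b)
      ≈⟨ ≈⇒≈[] (inflate-cong (trans (*-congʳ (head-tail a)) (solve 4 (λ c q t b → (c :+ q :* t) :* b := c :* b :+ q :* (t :* b)) refl (const a₀) q t b))) ⟩
    inflate (const a₀ * b + q * (t * b))
      ≈⟨ ≈⇒≈[] (trans (inflate-+ (const a₀ * b) (q * (t * b))) (+-cong (inflate-const* a₀ b) (inflate-q* (t * b)))) ⟩
    const a₀ * inflate b + q ^ 3 * inflate (t * b)
      ≈⟨ +-cong[] Mod.refl (*-cong[]-order q³-order (go n t)) ⟩
    const a₀ * inflate b + q ^ 3 * (inflate t * inflate b)
      ≈⟨ ≈⇒≈[] (solve 4 (λ c q t b → c :* b :+ q :* (t :* b) := (c :+ q :* t) :* b) refl (const a₀) (q ^ 3) (inflate t) (inflate b)) ⟩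
    (const a₀ + q ^ 3 * inflate t) * inflate b
      ≈⟨ ≈⇒≈[] (*-congʳ (trans (inflate-cong (head-tail a)) (trans (inflate-+ (const a₀) (q * t)) (+-cong (inflate-const a₀) (inflate-q* t))))) ⟨
    inflate a * inflate b ∎
    where
    open ≈[]-Reasoning (suc n)
    a₀ = coef a 0
    t = ser (tail (coef a))

inflate-^ : ∀ a n → inflate (a ^ n) ≈ inflate a ^ n
inflate-^ a zero    = inflate-1
inflate-^ a (suc n) = trans (inflate-* a (a ^ n)) (*-congˡ (inflate-^ a n))

inflate-q^ : ∀ n → inflate (q ^ n) ≈ (q ^ 3) ^ n
inflate-q^ n = trans (inflate-^ q n) (^-congˡ n (begin
  inflate q          ≈⟨ inflate-cong (*-identityʳ q) ⟨
  inflate (q * 1#)   ≈⟨ inflate-q* 1# ⟩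
  q ^ 3 * inflate 1# ≈⟨ trans (*-congˡ inflate-1) (*-identityʳ _) ⟩
  q ^ 3              ∎))
  where open ≈-Reasoning

inflate-1- : ∀ a → inflate (1# - a) ≈ 1# - inflate a
inflate-1- a = begin
  inflate (1# - a)                      ≈⟨ inflate-cong (+-congˡ (neg a)) ⟩
  inflate (1# + const (ℤ.- 1ℤ) * a)     ≈⟨ trans (inflate-+ 1# _) (+-cong inflate-1 (inflate-const* _ a)) ⟩
  1# + const (ℤ.- 1ℤ) * inflate a       ≈⟨ +-congˡ (neg (inflate a)) ⟨
  1# - inflate a                        ∎
  where
  open ≈-Reasoning
  neg : ∀ a → - a ≈ const (ℤ.- 1ℤ) * a
  neg = solve 1 (λ a → :- a := con (ℤ.- 1ℤ) :* a) refl

inflate-unit : ∀ {a} → Unit a → Unit (inflate a)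
inflate-unit ua = Mod.trans (inflate-cong[] ua) (≈⇒≈[] inflate-1)

inflate-iv : ∀ {a} → Unit a → inflate (iv a) ≈ iv (inflate a)
inflate-iv {a} ua = iv-unique (inflate-unit ua) (trans (sym (inflate-* a (iv a))) (trans (inflate-cong (*-inverseʳ ua)) inflate-1))

inflate-Σ< : ∀ t n → inflate (Σ< n t) ≈ Σ< n (λ i → inflate (t i))
inflate-Σ< t zero    = inflate-const 0ℤ
inflate-Σ< t (suc n) = trans (inflate-+ (Σ< n t) (t n)) (+-congʳ (inflate-Σ< t n))

inflate-order : ∀ {n a} → a ≈[ n ] 0# → inflate a ≈[ n ] 0#
inflate-order e = Mod.trans (inflate-cong[] e) (≈⇒≈[] (inflate-const 0ℤ))

inflate-Σ∞ : ∀ {t} → Summable t → inflate (Σ∞ t) ≈ Σ∞ (λ i → inflate (t i))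
inflate-Σ∞ {t} s = ≈[]⇒≈ λ n → let open ≈[]-Reasoning n in begin
  inflate (Σ∞ t)                ≈⟨ inflate-cong[] (Σ∞≈[]Σ< s n) ⟩
  inflate (Σ< n t)              ≈⟨ ≈⇒≈[] (inflate-Σ< t n) ⟩
  Σ< n (λ i → inflate (t i))    ≈⟨ Σ∞≈[]Σ< (λ i → inflate-order (s i)) n ⟨
  Σ∞ (λ i → inflate (t i))      ∎

inflate-poch : ∀ u Q n → inflate (⟨ u ∣ Q ⟩ n) ≈ ⟨ inflate u ∣ inflate Q ⟩ n
inflate-poch u Q zero    = inflate-1
inflate-poch u Q (suc n) = trans (inflate-* (⟨ u ∣ Q ⟩ n) _) (*-cong (inflate-poch u Q n)
  (trans (inflate-1- _) (+-congˡ (-‿cong (trans (inflate-* u (Q ^ n)) (*-congˡ (inflate-^ Q n)))))))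

inflate-poch∞ : ∀ {u Q} → 𝔪 u → 𝔪 Q → inflate ⟨ u ∣ Q ⟩∞ ≈ ⟨ inflate u ∣ inflate Q ⟩∞
inflate-poch∞ {u} {Q} u∈𝔪 Q∈𝔪 = ≈[]⇒≈ λ n → let open ≈[]-Reasoning n in begin
  inflate ⟨ u ∣ Q ⟩∞                  ≈⟨ inflate-cong[] (poch∞≈[]′ u∈𝔪 Q∈𝔪 n) ⟩
  inflate (⟨ u ∣ Q ⟩ n)               ≈⟨ ≈⇒≈[] (inflate-poch u Q n) ⟩
  (⟨ inflate u ∣ inflate Q ⟩ n)       ≈⟨ poch∞≈[]′ (inflate-order u∈𝔪) (inflate-order Q∈𝔪) n ⟨
  ⟨ inflate u ∣ inflate Q ⟩∞          ∎

-- The stated series in terms of products and g₃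

open Eta q q≈[1]0
open Dissection q q≈[1]0
module Eta₃ = Eta (q ^ 3) (p^∈𝔪 3)
module Eta₉ = Eta (q ^ 9) (p^∈𝔪 9)

F : ℕ → PS
F k = G k k

ser-factor : ∀ e → ser (one ⊖ mono e) ≈ 1# - q ^ e
ser-factor e = trans (ser-⊖ one (mono e)) (+-cong ser-one (-‿cong (ser-mono e)))

ser-poch : ∀ a b n → ser (poch a b n) ≈ ⟨ q ^ a ∣ q ^ b ⟩ n
ser-poch a b zero    = ser-one
ser-poch a b (suc n) = trans (ser-⊛ (poch a b n) (one ⊖ mono (a +ℕ b *ℕ n))) (*-cong (ser-poch a b n)
  (trans (ser-factor (a +ℕ b *ℕ n)) (+-congˡ (-‿cong (trans (^-homo-* q a (b *ℕ n)) (*-congˡ (sym (^-assocʳ q b n))))))))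

-- Coefficient n of `f` is taken from the product of n factors, which is the diagonal used by `lim`;
-- comparing finite products is therefore enough.
ser-f : ∀ k → ser (f k) ≈ F k
ser-f k = lim-cong {λ n → ser (prod< n (λ j → one ⊖ mono (k *ℕ suc j)))} product
  where
  product : ∀ n → ser (prod< n (λ j → one ⊖ mono (k *ℕ suc j))) ≈ ⟨ q ^ k ∣ q ^ k ⟩ n
  product zero    = ser-one
  product (suc n) = trans (ser-⊛ (prod< n (λ j → one ⊖ mono (k *ℕ suc j))) (one ⊖ mono (k *ℕ suc n)))
    (*-cong (product n) (trans (ser-factor (k *ℕ suc n)) (+-congˡ (-‿cong (sym (^-assocʳ q k (suc n)))))))

ser-f^ : ∀ k n → ser (f k ^ˢ n) ≈ F k ^ n
ser-f^ k n = trans (ser-^ (f k) n) (^-congˡ n (ser-f k))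

ser-inv : ∀ {a b} → Unit b → ser a ≈ b → ser (inv a) ≈ iv b
ser-inv ub e = iv-cong (Mod.trans (≈⇒≈[] e) ub) e

denominator-unit′ : ∀ a b c .{{_ : NonZero a}} .{{_ : NonZero b}} .{{_ : NonZero c}} n → Unit ((⟨ q ^ a ∣ q ^ c ⟩ n) * (⟨ q ^ b ∣ q ^ c ⟩ n))
denominator-unit′ a b c n = *-unit (poch-unit (p^∈𝔪 a) (p^∈𝔪 c) n) (poch-unit (p^∈𝔪 b) (p^∈𝔪 c) n)

ser-ξTerm : ∀ m → ser (ξTerm m) ≈ q * g₃Term (q ^ 1) (q ^ 5) (q ^ 6) m
ser-ξTerm m = begin
  ser (ξTerm m)
    ≈⟨ ser-⊛ (mono (6 *ℕ m *ℕ suc m +ℕ 1)) _ ⟩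
  ser (mono (6 *ℕ m *ℕ suc m +ℕ 1)) * ser (inv (poch 1 6 (suc m) ⊛ poch 5 6 (suc m)))
    ≈⟨ *-cong (trans (ser-mono (6 *ℕ m *ℕ suc m +ℕ 1)) (^-congʳ q (exponent m)))
              (ser-inv (denominator-unit′ 1 5 6 (suc m)) (trans (ser-⊛ (poch 1 6 (suc m)) (poch 5 6 (suc m))) (*-cong (ser-poch 1 6 (suc m)) (ser-poch 5 6 (suc m))))) ⟩
  q * q ^ (6 *ℕ (m *ℕ m +ℕ m)) * i
    ≈⟨ trans (*-assoc _ _ _) (*-congˡ (*-congʳ (sym (^-assocʳ q 6 (m *ℕ m +ℕ m))))) ⟩
  q * g₃Term (q ^ 1) (q ^ 5) (q ^ 6) m ∎
  where
  open ≈-Reasoning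
  i = iv ((⟨ q ^ 1 ∣ q ^ 6 ⟩ suc m) * (⟨ q ^ 5 ∣ q ^ 6 ⟩ suc m))
  exponent : ∀ m → 6 *ℕ m *ℕ suc m +ℕ 1 ≡ suc (6 *ℕ (m *ℕ m +ℕ m))
  exponent = solve-∀

g₃Term-summable : ∀ {x y Q} → 𝔪 Q → Summable (g₃Term x y Q)
g₃Term-summable Q∈𝔪 n = *-orderˡ _ (^-order-≥ Q∈𝔪 (ℕₚ.m≤n+m n (n *ℕ n)))

ser-ξ : ser ξ ≈ 1# + const (+ 2) * (q * g₃ 1 5)
ser-ξ = begin
  ser ξ
    ≈⟨ trans (ser-⊕ one _) (+-cong ser-one (ser-scale (+ 2) (λ N → Σ≤ N (λ m → ξTerm m N)))) ⟩
  1# + const (+ 2) * Σ∞ (λ m → ser (ξTerm m))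
    ≈⟨ +-congˡ (*-congˡ (trans (Σ∞-cong ser-ξTerm) (sym (Σ∞-* q (g₃Term-summable (p^∈𝔪 6)))))) ⟩
  1# + const (+ 2) * (q * g₃ 1 5) ∎
  where open ≈-Reasoning

ser-ωTerm : ∀ m → ser (ωTerm m) ≈ g₃Term (q ^ 1) (q ^ 1) (q ^ 2) m
ser-ωTerm m = trans (ser-⊛ (mono (2 *ℕ m *ℕ suc m)) _)
  (*-cong (trans (ser-mono (2 *ℕ m *ℕ suc m)) (trans (^-congʳ q (exponent m)) (sym (^-assocʳ q 2 (m *ℕ m +ℕ m)))))
          (ser-inv (denominator-unit′ 1 1 2 (suc m)) (trans (ser-^ (poch 1 2 (suc m)) 2)
            (trans (^-congˡ 2 (ser-poch 1 2 (suc m))) (*-congˡ (*-identityʳ _))))))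
  where
  exponent : ∀ m → 2 *ℕ m *ℕ suc m ≡ 2 *ℕ (m *ℕ m +ℕ m)
  exponent = solve-∀

ser-ω : ser ω ≈ Σ∞ (g₃Term (q ^ 1) (q ^ 1) (q ^ 2))
ser-ω = Σ∞-cong ser-ωTerm

inflate-power : ∀ k → inflate (q ^ k) ≈ q ^ (3 *ℕ k)
inflate-power k = trans (inflate-q^ k) (^-assocʳ q 3 k)

g₃Term-cong : ∀ {x x′ y y′ Q Q′} n → Unit ((⟨ x ∣ Q ⟩ suc n) * (⟨ y ∣ Q ⟩ suc n)) → x ≈ x′ → y ≈ y′ → Q ≈ Q′ → g₃Term x y Q n ≈ g₃Term x′ y′ Q′ n
g₃Term-cong n u e f g = *-cong (^-congˡ (n *ℕ n +ℕ n) g) (iv-cong u (*-cong (poch-cong e g (suc n)) (poch-cong f g (suc n))))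

inflate-g₃Term : ∀ {x y Q} n → Unit ((⟨ x ∣ Q ⟩ suc n) * (⟨ y ∣ Q ⟩ suc n)) → inflate (g₃Term x y Q n) ≈ g₃Term (inflate x) (inflate y) (inflate Q) n
inflate-g₃Term {x} {y} {Q} n u = trans (inflate-* (Q ^ (n *ℕ n +ℕ n)) _)
  (*-cong (inflate-^ Q (n *ℕ n +ℕ n)) (trans (inflate-iv u) (iv-cong (inflate-unit u)
    (trans (inflate-* (⟨ x ∣ Q ⟩ suc n) (⟨ y ∣ Q ⟩ suc n)) (*-cong (inflate-poch x Q (suc n)) (inflate-poch y Q (suc n)))))))

inflate-ω : inflate (ser ω) ≈ g₃ 3 3
inflate-ω = begin
  inflate (ser ω)                                              ≈⟨ inflate-cong ser-ω ⟩
  inflate (Σ∞ (g₃Term (q ^ 1) (q ^ 1) (q ^ 2)))                ≈⟨ inflate-Σ∞ (g₃Term-summable (p^∈𝔪 2)) ⟩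
  Σ∞ (λ n → inflate (g₃Term (q ^ 1) (q ^ 1) (q ^ 2) n))        ≈⟨ Σ∞-cong term ⟩
  g₃ 3 3                                                       ∎
  where
  open ≈-Reasoning
  term : ∀ n → inflate (g₃Term (q ^ 1) (q ^ 1) (q ^ 2) n) ≈ g₃Term (q ^ 3) (q ^ 3) (q ^ 6) n
  term n = sym (trans (g₃Term-cong n (denominator-unit′ 3 3 6 (suc n)) (sym (inflate-power 1)) (sym (inflate-power 1)) (sym (inflate-power 2)))
                      (sym (inflate-g₃Term n (denominator-unit′ 1 1 2 (suc n)))))

inflate-F : ∀ k .{{_ : NonZero k}} → inflate (F k) ≈ F (3 *ℕ k)
inflate-F k = trans (inflate-poch∞ (p^∈𝔪 k) (p^∈𝔪 k)) (poch∞-cong (inflate-power k) (inflate-power k))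

F-unit : ∀ k .{{_ : NonZero k}} → Unit (F k)
F-unit k = G-unit k k

^-unit : ∀ {a} → Unit a → ∀ n → Unit (a ^ n)
^-unit ua zero    = Mod.refl
^-unit ua (suc n) = *-unit ua (^-unit ua n)

-- k = 1 gives the quotients of the theorem, k = 3 the same with q³ for q.

quotient₀ quotient₁ quotient₂ : ℕ → PS
quotient₀ k = F (k *ℕ 2) * F (k *ℕ 3) ^ 4 * iv (F (k *ℕ 1) ^ 2 * F (k *ℕ 6) ^ 2)
quotient₁ k = F (k *ℕ 3) * F (k *ℕ 6) * iv (F (k *ℕ 1))
quotient₂ k = F (k *ℕ 6) ^ 4 * iv (F (k *ℕ 2) * F (k *ℕ 3) ^ 2)

inflate-F^ : ∀ k n .{{_ : NonZero k}} → inflate (F k ^ n) ≈ F (3 *ℕ k) ^ n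
inflate-F^ k n = trans (inflate-^ (F k) n) (^-congˡ n (inflate-F k))

inflate-/ : ∀ {a b c d} → Unit b → inflate a ≈ c → inflate b ≈ d → inflate (a * iv b) ≈ c * iv d
inflate-/ {a} {b} ub e f = trans (inflate-* a (iv b)) (*-cong e (trans (inflate-iv ub) (iv-cong (inflate-unit ub) f)))

D₀-unit : Unit (F 1 ^ 2 * F 6 ^ 2)
D₀-unit = *-unit (^-unit (F-unit 1) 2) (^-unit (F-unit 6) 2)

D₂-unit : Unit (F 2 * F 3 ^ 2)
D₂-unit = *-unit (F-unit 2) (^-unit (F-unit 3) 2)

inflate-quotient₀ : inflate (quotient₀ 1) ≈ quotient₀ 3
inflate-quotient₀ = inflate-/ D₀-unit
  (trans (inflate-* (F 2) (F 3 ^ 4)) (*-cong (inflate-F 2) (inflate-F^ 3 4)))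
  (trans (inflate-* (F 1 ^ 2) (F 6 ^ 2)) (*-cong (inflate-F^ 1 2) (inflate-F^ 6 2)))

inflate-quotient₁ : inflate (quotient₁ 1) ≈ quotient₁ 3
inflate-quotient₁ = inflate-/ (F-unit 1) (trans (inflate-* (F 3) (F 6)) (*-cong (inflate-F 3) (inflate-F 6))) (inflate-F 1)

inflate-quotient₂ : inflate (quotient₂ 1) ≈ quotient₂ 3
inflate-quotient₂ = inflate-/ D₂-unit (inflate-F^ 6 4) (trans (inflate-* (F 2) (F 3 ^ 2)) (*-cong (inflate-F 2) (inflate-F^ 3 2)))

ser-quotient₀ : ser (f 2 ⊛ (f 3 ^ˢ 4) ⊛ inv ((f 1 ^ˢ 2) ⊛ (f 6 ^ˢ 2))) ≈ quotient₀ 1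
ser-quotient₀ = trans (ser-⊛ _ _) (*-cong
  (trans (ser-⊛ (f 2) (f 3 ^ˢ 4)) (*-cong (ser-f 2) (ser-f^ 3 4)))
  (ser-inv D₀-unit (trans (ser-⊛ (f 1 ^ˢ 2) (f 6 ^ˢ 2)) (*-cong (ser-f^ 1 2) (ser-f^ 6 2)))))

ser-quotient₁ : ser (f 3 ⊛ f 6 ⊛ inv (f 1)) ≈ quotient₁ 1
ser-quotient₁ = trans (ser-⊛ _ _) (*-cong (trans (ser-⊛ (f 3) (f 6)) (*-cong (ser-f 3) (ser-f 6))) (ser-inv (F-unit 1) (ser-f 1)))

ser-quotient₂ : ser ((f 6 ^ˢ 4) ⊛ inv (f 2 ⊛ (f 3 ^ˢ 2))) ≈ quotient₂ 1
ser-quotient₂ = trans (ser-⊛ _ _) (*-cong (ser-f^ 6 4) (ser-inv D₂-unit (trans (ser-⊛ (f 2) (f 3 ^ˢ 2)) (*-cong (ser-f 2) (ser-f^ 3 2)))))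

-- The parts of ψ² as quotients in q³

G₃ : ∀ k → Eta₃.G k k ≈ F (3 *ℕ k)
G₃ k = poch∞-cong (^-assocʳ q 3 k) (^-assocʳ q 3 k)

G₉ : ∀ k → Eta₉.G k k ≈ F (9 *ℕ k)
G₉ k = poch∞-cong (^-assocʳ q 9 k) (^-assocʳ q 9 k)

φ₃-F : Eta₃.φ₃ * (F 3 * F 18) ≈ F 6 * F 9 ^ 2
φ₃-F = trans (*-congˡ (sym (*-cong (G₃ 1) (G₃ 6)))) (trans Eta₃.φ₃-product (*-cong (G₃ 2) (^-congˡ 2 (G₃ 3))))

ψ₉-F : Eta₉.ψ * F 9 ≈ F 18 ^ 2
ψ₉-F = begin
  g * g * iv (Eta₉.G 1 1) * F 9              ≈⟨ *-congˡ (G₉ 1) ⟨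
  g * g * iv (Eta₉.G 1 1) * Eta₉.G 1 1       ≈⟨ solve 3 (λ g i h → g :* g :* i :* h := g :^ 2 :* (h :* i)) refl g (iv (Eta₉.G 1 1)) (Eta₉.G 1 1) ⟩
  g ^ 2 * (Eta₉.G 1 1 * iv (Eta₉.G 1 1))     ≈⟨ trans (*-congˡ (*-inverseʳ (Eta₉.G-unit 1 1))) (*-identityʳ _) ⟩
  g ^ 2                                      ≈⟨ ^-congˡ 2 (G₉ 2) ⟩
  F 18 ^ 2                                   ∎
  where
  open ≈-Reasoning
  g = Eta₉.G 2 2

Φ Ψ : PS
Φ = Eta₃.φ₃
Ψ = Eta₉.ψ

-- Φ², ΦΨ and Ψ² are the parts of ψ² by exponent modulo 3; divided by f₆ they have to be the stated
-- quotients at q³. The factor f₆ stays on the left, so that `φ₃-F` and `ψ₉-F` apply with all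
-- denominators cleared.
F₆*quotient₀ : F 6 * quotient₀ 3 ≈ Φ * Φ
F₆*quotient₀ = begin
  F 6 * (F 6 * F 9 ^ 4 * iv d)   ≈⟨ *-assoc (F 6) (F 6 * F 9 ^ 4) (iv d) ⟨
  F 6 * (F 6 * F 9 ^ 4) * iv d   ≈⟨ /-unique (*-unit (^-unit (F-unit 3) 2) (^-unit (F-unit 18) 2)) (begin
    F 6 * (F 6 * F 9 ^ 4)                    ≈⟨ solve 2 (λ a b → a :* (a :* b :^ 4) := (a :* b :^ 2) :* (a :* b :^ 2)) refl (F 6) (F 9) ⟩
    (F 6 * F 9 ^ 2) * (F 6 * F 9 ^ 2)        ≈⟨ *-cong φ₃-F φ₃-F ⟨
    Φ * (F 3 * F 18) * (Φ * (F 3 * F 18))    ≈⟨ solve 3 (λ x a b → x :* (a :* b) :* (x :* (a :* b)) := x :* x :* (a :^ 2 :* b :^ 2)) refl Φ (F 3) (F 18) ⟩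
    Φ * Φ * d                                ∎) ⟩
  Φ * Φ                          ∎
  where
  open ≈-Reasoning
  d = F 3 ^ 2 * F 18 ^ 2

F₆*quotient₁ : F 6 * quotient₁ 3 ≈ Φ * Ψ
F₆*quotient₁ = begin
  F 6 * (F 9 * F 18 * iv (F 3))  ≈⟨ *-assoc (F 6) (F 9 * F 18) (iv (F 3)) ⟨
  F 6 * (F 9 * F 18) * iv (F 3)  ≈⟨ /-unique (F-unit 3) (*-cancelˡ (*-unit (F-unit 18) (F-unit 9)) (begin
    F 18 * F 9 * (F 6 * (F 9 * F 18))        ≈⟨ solve 3 (λ a b c → a :* b :* (c :* (b :* a)) := (c :* b :^ 2) :* a :^ 2) refl (F 18) (F 9) (F 6) ⟩
    (F 6 * F 9 ^ 2) * F 18 ^ 2               ≈⟨ *-cong φ₃-F ψ₉-F ⟨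
    Φ * (F 3 * F 18) * (Ψ * F 9)             ≈⟨ solve 5 (λ x y a b c → x :* (a :* b) :* (y :* c) := b :* c :* (x :* y :* a)) refl Φ Ψ (F 3) (F 18) (F 9) ⟩
    F 18 * F 9 * (Φ * Ψ * F 3)               ∎)) ⟩
  Φ * Ψ                          ∎
  where open ≈-Reasoning

F₆*quotient₂ : F 6 * quotient₂ 3 ≈ Ψ * Ψ
F₆*quotient₂ = begin
  F 6 * (F 18 ^ 4 * iv (F 6 * F 9 ^ 2))   ≈⟨ *-assoc (F 6) (F 18 ^ 4) _ ⟨
  F 6 * F 18 ^ 4 * iv (F 6 * F 9 ^ 2)     ≈⟨ /-unique (*-unit (F-unit 6) (^-unit (F-unit 9) 2)) (begin
    F 6 * F 18 ^ 4                           ≈⟨ solve 2 (λ a b → a :* b :^ 4 := a :* (b :^ 2 :* b :^ 2)) refl (F 6) (F 18) ⟩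
    F 6 * (F 18 ^ 2 * F 18 ^ 2)              ≈⟨ *-congˡ (*-cong ψ₉-F ψ₉-F) ⟨
    F 6 * (Ψ * F 9 * (Ψ * F 9))              ≈⟨ solve 3 (λ a y b → a :* (y :* b :* (y :* b)) := y :* y :* (a :* b :^ 2)) refl (F 6) Ψ (F 9) ⟩
    Ψ * Ψ * (F 6 * F 9 ^ 2)                  ∎) ⟩
  Ψ * Ψ                                   ∎
  where open ≈-Reasoning

residue₀ residue₁ residue₂ : Series
residue₀ = f 2 ⊛ (f 3 ^ˢ 4) ⊛ inv ((f 1 ^ˢ 2) ⊛ (f 6 ^ˢ 2))
residue₁ = scale (+ 2) (f 3 ⊛ f 6 ⊛ inv (f 1))
residue₂ = ω ⊕ (f 6 ^ˢ 4) ⊛ inv (f 2 ⊛ (f 3 ^ˢ 2))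

ξ-dissection : ser ξ ≈ inflate (ser residue₀) + q * inflate (ser residue₁) + q * (q * inflate (ser residue₂))
ξ-dissection = *-cancelˡ (F-unit 6) (begin
  F 6 * ser ξ
    ≈⟨ *-congˡ ser-ξ ⟩
  F 6 * (1# + const (+ 2) * (q * g₃ 1 5))
    -- The term q² f₆ g₃(q³,q⁶) is subtracted and added to make the right side of `ψ²-dissection`
    -- appear; the added copy survives as the contribution of ω(q³).
    ≈⟨ solve 4 (λ f q g h → f :* (con 1ℤ :+ con (+ 2) :* (q :* g)) := f :+ (q :+ q) :* (f :* g) :- q :^ 2 :* (f :* h) :+ q :^ 2 :* (f :* h)) refl (F 6) q (g₃ 1 5) (g₃ 3 3) ⟩
  F 6 + (q + q) * (F 6 * g₃ 1 5) - q ^ 2 * (F 6 * g₃ 3 3) + q ^ 2 * (F 6 * g₃ 3 3)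
    ≈⟨ +-congʳ ψ²-dissection ⟨
  ψ * ψ + q ^ 2 * (F 6 * g₃ 3 3)
    ≈⟨ +-congʳ (*-cong ψ-dissection ψ-dissection) ⟩
  (Φ + q * Ψ) * (Φ + q * Ψ) + q ^ 2 * (F 6 * g₃ 3 3)
    -- Φ, Ψ, f₆ and g₃(q³,q⁶) are series in q³, so the explicit powers of q now mark the residue
    -- classes modulo 3.
    ≈⟨ solve 5 (λ x y q f h → (x :+ q :* y) :* (x :+ q :* y) :+ q :^ 2 :* (f :* h) := x :* x :+ q :* (con (+ 2) :* (x :* y)) :+ q :* (q :* (f :* h :+ y :* y))) refl Φ Ψ q (F 6) (g₃ 3 3) ⟩
  Φ * Φ + q * (const (+ 2) * (Φ * Ψ)) + q * (q * (F 6 * g₃ 3 3 + Ψ * Ψ))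
    ≈⟨ +-cong (+-cong F₆*quotient₀ (*-congˡ (*-congˡ F₆*quotient₁))) (*-congˡ (*-congˡ (+-congˡ F₆*quotient₂))) ⟨
  F 6 * quotient₀ 3 + q * (const (+ 2) * (F 6 * quotient₁ 3)) + q * (q * (F 6 * g₃ 3 3 + F 6 * quotient₂ 3))
    ≈⟨ solve 6 (λ f q a b c h → f :* a :+ q :* (con (+ 2) :* (f :* b)) :+ q :* (q :* (f :* h :+ f :* c))
         := f :* (a :+ q :* (con (+ 2) :* b) :+ q :* (q :* (h :+ c)))) refl (F 6) q (quotient₀ 3) (quotient₁ 3) (quotient₂ 3) (g₃ 3 3) ⟩
  F 6 * (quotient₀ 3 + q * (const (+ 2) * quotient₁ 3) + q * (q * (g₃ 3 3 + quotient₂ 3)))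
    ≈⟨ *-congˡ (+-cong (+-cong inflate-residue₀ (*-congˡ inflate-residue₁)) (*-congˡ (*-congˡ inflate-residue₂))) ⟨
  F 6 * (inflate (ser residue₀) + q * inflate (ser residue₁) + q * (q * inflate (ser residue₂))) ∎)
  where
  open ≈-Reasoning
  inflate-residue₀ : inflate (ser residue₀) ≈ quotient₀ 3
  inflate-residue₀ = trans (inflate-cong ser-quotient₀) inflate-quotient₀
  inflate-residue₁ : inflate (ser residue₁) ≈ const (+ 2) * quotient₁ 3
  inflate-residue₁ = trans (inflate-cong (trans (ser-scale (+ 2) _) (*-congˡ ser-quotient₁))) (trans (inflate-const* (+ 2) (quotient₁ 1)) (*-congˡ inflate-quotient₁))
  inflate-residue₂ : inflate (ser residue₂) ≈ g₃ 3 3 + quotient₂ 3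
  inflate-residue₂ = trans (inflate-cong (ser-⊕ ω _)) (trans (inflate-+ (ser ω) _)
    (+-cong inflate-ω (trans (inflate-cong ser-quotient₂) inflate-quotient₂)))

-- Reading off the coefficients by residue class

coef-q*-inflate-0 : ∀ a n → coef (q * inflate a) (n *ℕ 3) ≡ 0ℤ
coef-q*-inflate-0 a zero    = coef-q*-zero (inflate a)
coef-q*-inflate-0 a (suc n) = ≡.trans (coef-q*-suc (inflate a) (2 +ℕ n *ℕ 3)) (spread-2 (coef a) n)

coef-dissection : ∀ a b c n → let s = inflate a + q * inflate b + q * (q * inflate c) in
  coef s (n *ℕ 3) ≡ coef a n × coef s (1 +ℕ n *ℕ 3) ≡ coef b n × coef s (2 +ℕ n *ℕ 3) ≡ coef c n
coef-dissection a b c n = zeroth , first , second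
  where
  s = inflate a + q * inflate b + q * (q * inflate c)
  sum : ∀ k {x y z} → spread (coef a) k ≡ x → coef (q * inflate b) k ≡ y → coef (q * (q * inflate c)) k ≡ z → coef s k ≡ x ℤ.+ y ℤ.+ z
  sum k e f g = ≡.trans (coef-+ (inflate a + q * inflate b) _ k) (≡.cong₂ ℤ._+_ (≡.trans (coef-+ (inflate a) _ k) (≡.cong₂ ℤ._+_ e f)) g)
  q²-0 : ∀ n → coef (q * (q * inflate c)) (n *ℕ 3) ≡ 0ℤ
  q²-0 zero    = coef-q*-zero (q * inflate c)
  q²-0 (suc n) = ≡.trans (coef-q*-suc (q * inflate c) (2 +ℕ n *ℕ 3)) (≡.trans (coef-q*-suc (inflate c) (1 +ℕ n *ℕ 3)) (spread-1 (coef c) n))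
  zeroth : coef s (n *ℕ 3) ≡ coef a n
  zeroth = ≡.trans (sum (n *ℕ 3) (spread-0 (coef a) n) (coef-q*-inflate-0 b n) (q²-0 n))
    (≡.trans (ℤₚ.+-identityʳ _) (ℤₚ.+-identityʳ _))
  first : coef s (1 +ℕ n *ℕ 3) ≡ coef b n
  first = ≡.trans (sum (1 +ℕ n *ℕ 3) (spread-1 (coef a) n) (≡.trans (coef-q*-suc (inflate b) (n *ℕ 3)) (spread-0 (coef b) n))
    (≡.trans (coef-q*-suc (q * inflate c) (n *ℕ 3)) (coef-q*-inflate-0 c n))) (≡.trans (ℤₚ.+-identityʳ _) (ℤₚ.+-identityˡ _))
  second : coef s (2 +ℕ n *ℕ 3) ≡ coef c n
  second = ≡.trans (sum (2 +ℕ n *ℕ 3) (spread-2 (coef a) n) (≡.trans (coef-q*-suc (inflate b) (1 +ℕ n *ℕ 3)) (spread-1 (coef b) n))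
    (≡.trans (coef-q*-suc (q * inflate c) (1 +ℕ n *ℕ 3)) (≡.trans (coef-q*-suc (inflate c) (n *ℕ 3)) (spread-0 (coef c) n)))) (ℤₚ.+-identityˡ _)

pξ-dissection : ∀ n → pξ (n *ℕ 3) ≡ residue₀ n × pξ (1 +ℕ n *ℕ 3) ≡ residue₁ n × pξ (2 +ℕ n *ℕ 3) ≡ residue₂ n
pξ-dissection n with coef-dissection (ser residue₀) (ser residue₁) (ser residue₂) n
... | e₀ , e₁ , e₂ = ≡.trans (at ξ-dissection (n *ℕ 3)) e₀ , ≡.trans (at ξ-dissection (1 +ℕ n *ℕ 3)) e₁ , ≡.trans (at ξ-dissection (2 +ℕ n *ℕ 3)) e₂

theorem3p2 : ((n : ℕ) → pξ (3 *ℕ n) ≡ (f 2 ⊛ (f 3 ^ˢ 4) ⊛ inv ((f 1 ^ˢ 2) ⊛ (f 6 ^ˢ 2))) n)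
    × ((n : ℕ) → pξ (3 *ℕ n +ℕ 1) ≡ scale (+ 2) (f 3 ⊛ f 6 ⊛ inv (f 1)) n)
    × ((n : ℕ) → pξ (3 *ℕ n +ℕ 2) ≡ (ω ⊕ (f 6 ^ˢ 4) ⊛ inv (f 2 ⊛ (f 3 ^ˢ 2))) n)
theorem3p2 =
    (λ n → ≡.trans (≡.cong pξ (ℕₚ.*-comm 3 n)) (proj₁ (pξ-dissection n)))
  , (λ n → ≡.trans (≡.cong pξ (≡.trans (ℕₚ.+-comm (3 *ℕ n) 1) (≡.cong suc (ℕₚ.*-comm 3 n)))) (proj₁ (proj₂ (pξ-dissection n))))
  , (λ n → ≡.trans (≡.cong pξ (≡.trans (ℕₚ.+-comm (3 *ℕ n) 2) (≡.cong (2 +ℕ_) (ℕₚ.*-comm 3 n)))) (proj₂ (proj₂ (pξ-dissection n))))
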